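{- Let $G=(V,E)$ be a connected graph with $n$ vertices and maximum degree $\Delta$, let $k\in\{2,\dots,n-1\}$, let $\mathscr{S}$ be a $k$-block system for $G$ and let $\psi$ be the uniform distribution on $\mathscr{S}$. Fix $\lambda>1$. If $q\ge 2^{k+1}\Delta^{2k}k^{2k+1}\lambda^{\Delta-1+k^{ -1}}$, then for every $\varepsilon>0$, $\tau(\mathcal{M}_{\mathrm{BD}}^{\mathscr{S},\psi}(G,\lambda,q),\varepsilon)\le 2n\log(n\varepsilon^{ -1})$.
   Context: Potts model on $G$: configurations $\sigma\in\Omega=[q]^V$, $\mu(\sigma)$ = number of monochromatic edges, Gibbs distribution $\pi(\sigma)\propto\lambda^{\mu(\sigma)}$. $\tau(\mathcal{M},\varepsilon)=\max_x\min\{t:\|P^t(x,\cdot)-\pi\|_{TV}\le\varepsilon\}$. A $k$-block system for $G$ is a family $\mathscr{S}=\{S_v:v\in V\}$ with $v\in S_v$, $|S_v|=k$ and $G[S_v]$ connected. For $S\subseteq V$, $X\in\Omega$, $c\in[q]^S$: $X^{(S,c)}$ equals $c$ on $S$ and $X$ off $S$, and $\mu_{X,S}(c)$ is the number of monochromatic edges of $X^{(S,c)}$ incident with at least one vertex of $S$. The $(\mathscr{S},\psi)$-block dynamics $\mathcal{M}_{\mathrm{BD}}^{\mathscr{S},\psi}(G,\lambda,q)$ is the chain on $\Omega$ which from $X_t$ picks $S\in\mathscr{S}$ according to $\psi$, picks $c\in[q]^S$ with probability proportional to $\lambda^{\mu_{X_t,S}(c)}$, and moves to $X_t^{(S,c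)}$.
   Formalization: ε is restricted to 0 < ε ≤ n rather than all ε > 0: for ε > n the bound 2n log(n/ε) is negative while the mixing time is at least 0, so the claim fails there for every instance. -}

module Defs where

open import Level using (Level; 0ℓ; _⊔_) renaming (suc to lsuc)
open import Data.Nat.Base as ℕ using (ℕ; zero; suc)
open import Data.Fin.Base as Fin using (Fin)
import Data.Fin.Properties as Fin
open import Data.Fin.Subset using (Subset; inside; outside; _∈_; ∣_∣)
open import Data.Fin.Subset.Properties using (_∈?_)
open import Data.Vec.Base using (Vec; []; _∷_; lookup)
import Data.Vec.Properties as Vec
open import Data.List.Base using (List; length; filter; map; allFin; cartesianProduct)
open import Data.List.Extrema.Nat using (max)
open import Data.Product.Base using (Σ; ∃; _×_; _,_)
open import Data.Sum.Base using (_⊎_)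
open import Data.Bool.Base using (if_then_else_)
open import Relation.Nullary using (¬_; Dec; does)
open import Relation.Nullary.Decidable using (_×-dec_; _⊎-dec_)
open import Relation.Binary.Core using (Rel)
open import Relation.Binary.Definitions using (Decidable; Symmetric)
open import Relation.Binary.Structures using (IsDecTotalOrder)
open import Relation.Binary.PropositionalEquality.Core using (_≡_)
open import Relation.Binary.Construct.Closure.ReflexiveTransitive using (Star)
open import Algebra.Core using (Op₁; Op₂)
open import Algebra.Structures using (IsCommutativeRing)
open import Algebra.Bundles using (CommutativeRing)
import Algebra.Properties.CommutativeMonoid.Sum
import Algebra.Properties.Semiring.Exp
import Algebra.Properties.Semiring.Mult

-- The library has no real numbers. ℝ enters through its classical axioms:
-- it is, up to isomorphism, the unique Dedekind-complete ordered field.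
-- The Archimedean property follows from completeness by contradiction only;
-- it is included so that the natural number is available constructively.
-- As usual in a total signature, 0# ⁻¹ is unspecified.

record CompleteOrderedField (c ℓ₁ ℓ₂ : Level) : Set (lsuc (c ⊔ ℓ₁ ⊔ ℓ₂)) where
  infix  8 _⁻¹
  infix  8 -_
  infixl 7 _*_
  infixl 6 _+_
  infix  4 _≈_ _≤_
  field
    Carrier           : Set c
    _≈_               : Rel Carrier ℓ₁
    _≤_               : Rel Carrier ℓ₂
    _+_ _*_           : Op₂ Carrier
    -_ _⁻¹            : Op₁ Carrier
    0# 1#             : Carrier
    isCommutativeRing : IsCommutativeRing _≈_ _+_ _*_ -_ 0# 1#
    isDecTotalOrder   : IsDecTotalOrder _≈_ _≤_
    0≉1               : ¬ (0# ≈ 1#)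
    ⁻¹-cong           : ∀ {x y} → x ≈ y → x ⁻¹ ≈ y ⁻¹
    *-inverseʳ        : ∀ x → ¬ (x ≈ 0#) → x * x ⁻¹ ≈ 1#
    +-monoˡ-≤         : ∀ z {x y} → x ≤ y → x + z ≤ y + z
    *-nonNeg          : ∀ {x y} → 0# ≤ x → 0# ≤ y → 0# ≤ x * y

  IsUpperBound : (Carrier → Set (c ⊔ ℓ₁ ⊔ ℓ₂)) → Carrier → Set (c ⊔ ℓ₁ ⊔ ℓ₂)
  IsUpperBound P b = ∀ x → P x → x ≤ b

  field
    complete : (P : Carrier → Set (c ⊔ ℓ₁ ⊔ ℓ₂)) → ∃ P → ∃ (IsUpperBound P) →
               Σ Carrier λ s → IsUpperBound P s × (∀ b → IsUpperBound P b → s ≤ b)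

  commutativeRing : CommutativeRing c ℓ₁
  commutativeRing = record { isCommutativeRing = isCommutativeRing }

  open Algebra.Properties.Semiring.Mult (CommutativeRing.semiring commutativeRing)
    using () renaming (_×_ to _·_)

  fromℕ : ℕ → Carrier
  fromℕ m = m · 1#

  field
    archimedean : ∀ x → Σ ℕ λ m → x ≤ fromℕ m

record SimpleGraph (n : ℕ) : Set₁ where
  field
    Adj     : Rel (Fin n) 0ℓ
    adj?    : Decidable Adj
    adj-sym : Symmetric Adj
    irrefl  : ∀ {v} → ¬ Adj v v

module _ {n : ℕ} (G : SimpleGraph n) where
  open SimpleGraph G

  degree : Fin n → ℕ
  degree v = length (filter (adj? v) (allFin n))

  maxDegree : ℕ
  maxDegree = max 0 (map degree (allFin n))

  Connected : Set
  Connected = ∀ u v → Star Adj u v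

  InducedAdj : Subset n → Rel (Fin n) 0ℓ
  InducedAdj S u v = u ∈ S × v ∈ S × Adj u v

  InducedConnected : Subset n → Set
  InducedConnected S = ∀ u v → u ∈ S → v ∈ S → Star (InducedAdj S) u v

  -- Each edge is listed once, with its smaller endpoint first.
  edges : List (Fin n × Fin n)
  edges = filter (λ (u , v) → (u Fin.<? v) ×-dec adj? u v)
                 (cartesianProduct (allFin n) (allFin n))

-- The system is a family indexed by vertices: S_u and S_v may coincide
-- for u ≠ v, and are then counted with multiplicity.

record BlockSystem {n : ℕ} (G : SimpleGraph n) (k : ℕ) : Set where
  field
    block           : Fin n → Subset n
    block-∋         : ∀ v → v ∈ block v
    block-size      : ∀ v → ∣ block v ∣ ≡ k
    block-connected : ∀ v → InducedConnected G (block v)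

Config : ℕ → ℕ → Set
Config q n = Vec (Fin q) n

_≟ᶜ_ : ∀ {q n} → Decidable {A = Config q n} _≡_
_≟ᶜ_ = Vec.≡-dec Fin._≟_

-- overwrite X S c is X^(S,c). An element of [q]^S is a vector listing the
-- colours of the elements of S in increasing order of vertices.

overwrite : ∀ {q n} → Config q n → (S : Subset n) → Config q ∣ S ∣ → Config q n
overwrite []      []            c       = []
overwrite (x ∷ X) (inside  ∷ S) (a ∷ c) = a ∷ overwrite X S c
overwrite (x ∷ X) (outside ∷ S) c       = x ∷ overwrite X S c

module _ {n : ℕ} (G : SimpleGraph n) {q : ℕ} where

  Mono : Config q n → Fin n × Fin n → Set
  Mono σ (u , v) = lookup σ u ≡ lookup σ v

  mono? : ∀ σ e → Dec (Mono σ e)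
  mono? σ (u , v) = lookup σ u Fin.≟ lookup σ v

  Meets : Subset n → Fin n × Fin n → Set
  Meets S (u , v) = u ∈ S ⊎ v ∈ S

  meets? : ∀ S e → Dec (Meets S e)
  meets? S (u , v) = (u ∈? S) ⊎-dec (v ∈? S)

  μ : Config q n → ℕ
  μ σ = length (filter (mono? σ) (edges G))

  μ-block : Config q n → (S : Subset n) → Config q ∣ S ∣ → ℕ
  μ-block X S c =
    length (filter (λ e → mono? (overwrite X S c) e ×-dec meets? S e) (edges G))

module Real {c ℓ₁ ℓ₂} (ℝ : CompleteOrderedField c ℓ₁ ℓ₂) where

  open CompleteOrderedField ℝ public
    using (Carrier; _≈_; _≤_; _+_; _*_; -_; _⁻¹; 0#; 1#; fromℕ)
  open CompleteOrderedField ℝ using (commutativeRing; isDecTotalOrder)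
  open CommutativeRing commutativeRing using (semiring; +-commutativeMonoid)
  open IsDecTotalOrder isDecTotalOrder using (_≤?_)
  open Algebra.Properties.CommutativeMonoid.Sum +-commutativeMonoid public
    using (sum)
  open Algebra.Properties.Semiring.Exp semiring public using (_^_)

  infix  4 _<_
  infixl 6 _-_
  infixl 7 _/_

  _<_ : Rel Carrier (ℓ₁ ⊔ ℓ₂)
  x < y = x ≤ y × ¬ (x ≈ y)

  _-_ _/_ : Op₂ Carrier
  x - y = x + - y
  x / y = x * y ⁻¹

  abs : Carrier → Carrier
  abs x = if does (0# ≤? x) then x else - x

  indicator : ∀ {p} {P : Set p} → Dec P → Carrier
  indicator P? = if does P? then 1# else 0#

  ConvergesTo : (ℕ → Carrier) → Carrier → Set (c ⊔ ℓ₁ ⊔ ℓ₂)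
  ConvergesTo a l =
    ∀ δ → 0# < δ → Σ ℕ λ N → ∀ m → N ℕ.≤ m → abs (a m - l) < δ

  -- x = exp y, with exp y = lim (1 + y/m)^m
  IsExp : Carrier → Carrier → Set (c ⊔ ℓ₁ ⊔ ℓ₂)
  IsExp y x = ConvergesTo (λ m → (1# + y / fromℕ (suc m)) ^ suc m) x

  -- y = log x; over ℝ such a y exists, uniquely, for every x > 0
  IsLog : Carrier → Carrier → Set (c ⊔ ℓ₁ ⊔ ℓ₂)
  IsLog x y = IsExp y x

  -- r = x^(1/k), the nonnegative k-th root; over ℝ it exists, uniquely,
  -- for every x ≥ 0 and k ≥ 1
  IsRoot : ℕ → Carrier → Carrier → Set (ℓ₁ ⊔ ℓ₂)
  IsRoot k x r = 0# ≤ r × r ^ k ≈ x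

  sumConfig : ∀ {q} n → (Config q n → Carrier) → Carrier
  sumConfig zero    f = f []
  sumConfig (suc n) f = sum λ a → sumConfig n λ σ → f (a ∷ σ)

  module _ {q n : ℕ} where

    Distribution : Set c
    Distribution = Config q n → Carrier

    Kernel : Set c
    Kernel = Config q n → Distribution

    _^ᵏ_ : Kernel → ℕ → Kernel
    (P ^ᵏ zero)  x y = indicator (x ≟ᶜ y)
    (P ^ᵏ suc t) x y = sumConfig n λ z → P x z * (P ^ᵏ t) z y

    tv : Distribution → Distribution → Carrier
    tv α β = sumConfig n (λ σ → abs (α σ - β σ)) / fromℕ 2

    -- t = min { s : ‖P^s(x,·) − π‖ ≤ ε }
    IsMixingTimeFrom : Kernel → Distribution → Carrier → Config q n → ℕ → Set ℓ₂
    IsMixingTimeFrom P π ε x t =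
      (tv ((P ^ᵏ t) x) π ≤ ε) × (∀ s → tv ((P ^ᵏ s) x) π ≤ ε → t ℕ.≤ s)

    -- τ is the maximum over x of the above minima, all of which exist
    IsMixingTime : Kernel → Distribution → Carrier → ℕ → Set ℓ₂
    IsMixingTime P π ε τ =
      (∀ x → Σ ℕ λ t → IsMixingTimeFrom P π ε x t × t ℕ.≤ τ) ×
      (∃ λ x → IsMixingTimeFrom P π ε x τ)

  module _ {n : ℕ} (G : SimpleGraph n) (lam : Carrier) (q : ℕ) where

    gibbs : Distribution {q} {n}
    gibbs σ = lam ^ μ G σ / sumConfig n (λ σ′ → lam ^ μ G {q} σ′)

    blockWeight : Config q n → (S : Subset n) → Config q ∣ S ∣ → Carrier
    blockWeight X S c =
      lam ^ μ-block G X S c / sumConfig ∣ S ∣ (λ c′ → lam ^ μ-block G X S c′)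

    blockUpdate : Subset n → Kernel {q} {n}
    blockUpdate S X Y =
      sumConfig ∣ S ∣ λ c → blockWeight X S c * indicator (overwrite X S c ≟ᶜ Y)

    blockDynamics : ∀ {k} → BlockSystem G k → (Fin n → Carrier) → Kernel {q} {n}
    blockDynamics 𝒮 ψ X Y =
      sum λ v → ψ v * blockUpdate (BlockSystem.block 𝒮 v) X Y

  uniform : ∀ n → Fin n → Carrier
  uniform n v = 1# / fromℕ n

-- Path coupling in dual form. Rather than coupling two copies of the chain, one shows that the
-- kernel multiplies the Lipschitz constant of a function, for the Hamming metric, by at most
-- 1 - 3/(4n). Let X and Y differ at v only. A block containing v erases the difference, and a
-- block away from v preserves it. A block S next to v adds at most k disagreements, and only if
-- some neighbour of v in S receives the colour of v in X or in Y. Each such event has probability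
-- at most 2r, where r = λ^(Δ-1+1/k) / q: a connected set of t vertices meets at most (Δ-1)t + 1
-- edges, not all of them monochromatic if it is a monochromatic component smaller than S, and so
-- recolouring it at random shows that it is such a component with probability at most r^t. At
-- most kΔ^k pairs of a block and a neighbour of v in it are involved, by counting walks. Since
-- the Gibbs distribution is stationary, contraction bounds the total variation distance at
-- time t by n(1 - 3/(4n))^t, and the room between 3/4 and 1/2 pays for rounding 2n log(n/ε) down
-- to an integer.

module Submission where

open import Defs
open import Algebra.Bundles using (CommutativeRing)
import Algebra.Properties.CommutativeMonoid.Sum
import Algebra.Properties.CommutativeSemiring.Exp
import Algebra.Properties.Ring
import Algebra.Properties.Semiring.Mult
import Algebra.Properties.Semiring.Sum
import Algebra.Solver.Ring.NaturalCoefficients.Default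
open import Data.Bool.Base using (if_then_else_)
open import Data.Empty using (⊥-elim)
open import Data.Fin.Base as Fin using (Fin; zero; suc)
import Data.Fin.Properties as Fin
open import Data.Fin.Subset
  using (Subset; inside; outside; _∈_; _∉_; ∣_∣; _⊆_; ⊤; ⁅_⁆; _∪_) renaming (_-_ to _∖_)
open import Data.Fin.Subset.Properties
  using ( _∈?_; drop-∷-⊆; ∪-identityʳ; x∈p∪q⁻; p⊆p∪q; x∈⁅x⁆; x∈⁅y⁆⇒x≡y; ∣⁅x⁆∣≡1; ⊆⊤
        ; p⊆q⇒∣p∣≤∣q∣; p⊂q⇒∣p∣<∣q∣; x∈p⇒∣p-x∣<∣p∣; x∈p∧x≢y⇒x∈p-y)
open import Data.List.Base as List using (length; filter; tabulate; allFin; []; _∷_)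
open import Data.List.Extrema.Nat using (xs≤max)
open import Data.List.Membership.Propositional using (lose) renaming (_∈_ to _∈ˡ_)
open import Data.List.Membership.Propositional.Properties
  using (∈-filter⁺; ∈-filter⁻; ∈-cartesianProduct⁺; ∈-allFin; ∈-map⁺)
open import Data.List.Properties using (filter-notAll; filter-some)
import Data.List.Relation.Unary.All as All
import Data.List.Relation.Unary.Any as Any
open import Data.List.Relation.Unary.Any using (here; there)
open import Data.List.Relation.Unary.AllPairs using ([]; _∷_)
open import Data.List.Relation.Unary.Unique.Propositional using (Unique)
import Data.List.Relation.Unary.Unique.Propositional.Properties as Unique
open import Data.Nat.Base as ℕ using (ℕ; zero; suc)
import Data.Nat.Properties as ℕ
open import Data.Nat.Solver using (module +-*-Solver)
open import Data.Product.Base using (Σ; ∃; _×_; _,_; proj₁; proj₂)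
open import Data.Sum.Base using (_⊎_; inj₁; inj₂)
open import Data.Vec.Base as Vec using ([]; _∷_; lookup; here; there; _[_]≔_)
import Data.Vec.Properties as Vec
open import Function.Base using (_∘_; id)
open import Relation.Binary.Bundles using (Poset)
open import Relation.Binary.Construct.Closure.ReflexiveTransitive using (Star; _◅_) renaming (ε to nil)
open import Relation.Binary.Definitions using (DecidableEquality; tri<; tri≈; tri>)
open import Relation.Binary.PropositionalEquality as ≡ using (_≡_; _≢_)
import Relation.Binary.Reasoning.PartialOrder
open import Relation.Binary.Structures using (IsDecTotalOrder)
open import Relation.Nullary using (¬_; Dec; yes; no; does)
open import Relation.Nullary.Decidable using (¬?; _×-dec_; _→-dec_; _⊎-dec_)
open import Relation.Unary using (Pred; Decidable)

-- Ordered fields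

-- The constants come from one budget. A conflict is charged to one of two colours, each of
-- probability at most 2r, under each of the two laws being compared, so a neighbour of v in S costs
-- 8r times the k possible disagreements. Over the kΔ^k pairs this totals 8k²Δ^k r, which the
-- hypothesis on q makes at most 1/4; of the gain 1/n from the block of v, 3/(4n) is left. The
-- exponent 1/k has a single source: if the monochromatic component is all of S, no bichromatic edge
-- is guaranteed, and the extra factor λ is spread over the k vertices of S. The factor 2 in 2r
-- comes from summing over all components that contain a given vertex: growing them one vertex at a
-- time has ratio kr ≤ 1/2. In dual form no coupling has to be constructed: for a fixed function,
-- the two laws on a block are compared through their product, and every estimate is an inequality
-- between finite sums with denominators cleared.

module OrderedField {c ℓ₁ ℓ₂} (ℝ : CompleteOrderedField c ℓ₁ ℓ₂) where

  open Real ℝ public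
  open CompleteOrderedField ℝ public
    using (commutativeRing; 0≉1; ⁻¹-cong; *-inverseʳ; +-monoˡ-≤; *-nonNeg; archimedean)
  open CommutativeRing commutativeRing public
    using ( refl; sym; trans; reflexive; semiring; commutativeSemiring; ring
          ; +-cong; +-congˡ; +-congʳ; *-cong; *-congˡ; *-congʳ
          ; +-assoc; +-comm; +-identityˡ; +-identityʳ; -‿inverseˡ; -‿inverseʳ; -‿cong
          ; *-assoc; *-comm; *-identityˡ; *-identityʳ; zeroˡ; zeroʳ; distribˡ; distribʳ
          ; +-commutativeMonoid)
  open IsDecTotalOrder (CompleteOrderedField.isDecTotalOrder ℝ) public
    using (_≤?_; _≟_; total; isPartialOrder)
    renaming (refl to ≤-refl; trans to ≤-trans; antisym to ≤-antisym; reflexive to ≤-reflexive)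
  open Algebra.Properties.Ring ring public
    using (-‿distribˡ-*; -‿distribʳ-*; -‿involutive; -0#≈0#; -‿+-comm)
  open Algebra.Properties.CommutativeSemiring.Exp commutativeSemiring public
    using (^-congˡ; ^-congʳ; ^-homo-*; ^-assocʳ; ^-distrib-*)
  open Algebra.Properties.Semiring.Mult semiring public
    using () renaming (×-homo-+ to ·-homo-+; ×1-homo-* to ·1-homo-*)
  module Solver = Algebra.Solver.Ring.NaturalCoefficients.Default commutativeSemiring

  ≤-poset : Poset c ℓ₁ ℓ₂
  ≤-poset = record { isPartialOrder = isPartialOrder }

  module ≤R = Relation.Binary.Reasoning.PartialOrder ≤-poset
  open ≤R
  open Solver using (Polynomial; solve; _:+_; _:*_; _:=_; con)

  -- con m evaluates to a sum of m ones, which lacks the final 0# of fromℕ m.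
  numeral : ∀ {k} → ℕ → Polynomial k
  numeral zero    = con 0
  numeral (suc m) = con 1 :+ numeral m

  ≈⇒≤ : ∀ {x y} → x ≈ y → x ≤ y
  ≈⇒≤ = ≤-reflexive

  +-mono-≤ : ∀ {x y u v} → x ≤ y → u ≤ v → x + u ≤ y + v
  +-mono-≤ {x} {y} {u} {v} x≤y u≤v = begin
    x + u ≤⟨ +-monoˡ-≤ u x≤y ⟩
    y + u ≈⟨ +-comm y u ⟩
    u + y ≤⟨ +-monoˡ-≤ y u≤v ⟩
    v + y ≈⟨ +-comm v y ⟩
    y + v ∎

  +-monoʳ-≤ : ∀ z {x y} → x ≤ y → z + x ≤ z + y
  +-monoʳ-≤ z = +-mono-≤ ≤-refl

  x-y+y≈x : ∀ x y → x - y + y ≈ x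
  x-y+y≈x x y = trans (+-assoc x (- y) y) (trans (+-congˡ (-‿inverseˡ y)) (+-identityʳ x))

  x+y-y≈x : ∀ x y → x + y - y ≈ x
  x+y-y≈x x y = trans (+-assoc x y (- y)) (trans (+-congˡ (-‿inverseʳ y)) (+-identityʳ x))

  +-cancelʳ-≤ : ∀ z {x y} → x + z ≤ y + z → x ≤ y
  +-cancelʳ-≤ z {x} {y} h = begin
    x         ≈⟨ x+y-y≈x x z ⟨
    x + z - z ≤⟨ +-monoˡ-≤ (- z) h ⟩
    y + z - z ≈⟨ x+y-y≈x y z ⟩
    y         ∎

  x≤y⇒0≤y-x : ∀ {x y} → x ≤ y → 0# ≤ y - x
  x≤y⇒0≤y-x {x} {y} h = ≤-trans (≈⇒≤ (sym (-‿inverseʳ x))) (+-monoˡ-≤ (- x) h)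

  +-nonNeg : ∀ {x y} → 0# ≤ x → 0# ≤ y → 0# ≤ x + y
  +-nonNeg hx hy = ≤-trans (≈⇒≤ (sym (+-identityˡ 0#))) (+-mono-≤ hx hy)

  x≤x+y : ∀ x {y} → 0# ≤ y → x ≤ x + y
  x≤x+y x hy = ≤-trans (≈⇒≤ (sym (+-identityʳ x))) (+-monoʳ-≤ x hy)

  x≤y+x : ∀ x {y} → 0# ≤ y → x ≤ y + x
  x≤y+x x hy = ≤-trans (≈⇒≤ (sym (+-identityˡ x))) (+-monoˡ-≤ x hy)

  *-monoʳ-≤ : ∀ {z} → 0# ≤ z → ∀ {x y} → x ≤ y → z * x ≤ z * y
  *-monoʳ-≤ {z} 0≤z {x} {y} x≤y = begin
    z * x                 ≤⟨ x≤y+x (z * x) (*-nonNeg 0≤z (x≤y⇒0≤y-x x≤y)) ⟩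
    z * (y - x) + z * x   ≈⟨ distribˡ z (y - x) x ⟨
    z * (y - x + x)       ≈⟨ *-congˡ (x-y+y≈x y x) ⟩
    z * y                 ∎

  *-monoˡ-≤ : ∀ {z} → 0# ≤ z → ∀ {x y} → x ≤ y → x * z ≤ y * z
  *-monoˡ-≤ {z} 0≤z {x} {y} x≤y = begin
    x * z ≈⟨ *-comm x z ⟩
    z * x ≤⟨ *-monoʳ-≤ 0≤z x≤y ⟩
    z * y ≈⟨ *-comm z y ⟩
    y * z ∎

  *-mono-≤ : ∀ {x y u v} → 0# ≤ y → 0# ≤ u → x ≤ y → u ≤ v → x * u ≤ y * v
  *-mono-≤ 0≤y 0≤u x≤y u≤v = ≤-trans (*-monoˡ-≤ 0≤u x≤y) (*-monoʳ-≤ 0≤y u≤v)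

  neg-mono : ∀ {x y} → x ≤ y → - y ≤ - x
  neg-mono {x} {y} h = +-cancelʳ-≤ (x + y) (begin
    - y + (x + y)  ≈⟨ +-congˡ (+-comm x y) ⟩
    - y + (y + x)  ≈⟨ +-assoc (- y) y x ⟨
    - y + y + x    ≈⟨ trans (+-congʳ (-‿inverseˡ y)) (+-identityˡ x) ⟩
    x              ≤⟨ h ⟩
    y              ≈⟨ trans (+-congʳ (-‿inverseˡ x)) (+-identityˡ y) ⟨
    - x + x + y    ≈⟨ +-assoc (- x) x y ⟩
    - x + (x + y)  ∎)

  x≤0⇒0≤-x : ∀ {x} → x ≤ 0# → 0# ≤ - x
  x≤0⇒0≤-x h = ≤-trans (≈⇒≤ (sym -0#≈0#)) (neg-mono h)

  0≤x*x : ∀ x → 0# ≤ x * x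
  0≤x*x x with total 0# x
  ... | inj₁ h = *-nonNeg h h
  ... | inj₂ h = begin
    0#            ≤⟨ *-nonNeg (x≤0⇒0≤-x h) (x≤0⇒0≤-x h) ⟩
    - x * - x     ≈⟨ -‿distribˡ-* x (- x) ⟨
    - (x * - x)   ≈⟨ -‿cong (-‿distribʳ-* x x) ⟨
    - - (x * x)   ≈⟨ -‿involutive (x * x) ⟩
    x * x         ∎

  0≤1 : 0# ≤ 1#
  0≤1 = ≤-trans (0≤x*x 1#) (≈⇒≤ (*-identityˡ 1#))

  1≰0 : ¬ (1# ≤ 0#)
  1≰0 h = 0≉1 (≤-antisym 0≤1 h)

  0<1 : 0# < 1#
  0<1 = 0≤1 , 0≉1

  <⇒≱ : ∀ {x y} → x < y → ¬ (y ≤ x)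
  <⇒≱ (x≤y , x≉y) y≤x = x≉y (≤-antisym x≤y y≤x)

  ≰⇒> : ∀ {x y} → ¬ (x ≤ y) → y < x
  ≰⇒> {x} {y} x≰y with total x y
  ... | inj₁ x≤y = ⊥-elim (x≰y x≤y)
  ... | inj₂ y≤x = y≤x , λ y≈x → x≰y (≈⇒≤ (sym y≈x))

  <-≤-trans : ∀ {x y z} → x < y → y ≤ z → x < z
  <-≤-trans (x≤y , x≉y) y≤z = ≤-trans x≤y y≤z ,
    λ x≈z → x≉y (≤-antisym x≤y (≤-trans y≤z (≈⇒≤ (sym x≈z))))

  1≤⇒0< : ∀ {x} → 1# ≤ x → 0# < x
  1≤⇒0< = <-≤-trans 0<1

  pos⇒≉0 : ∀ {x} → 0# < x → ¬ (x ≈ 0#)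
  pos⇒≉0 (_ , h) x≈0 = h (sym x≈0)

  *-inv : ∀ {x} → 0# < x → x * x ⁻¹ ≈ 1#
  *-inv {x} 0<x = *-inverseʳ x (pos⇒≉0 0<x)

  -- By totality only `y ≤ x` needs an argument. There the hypothesis becomes an equation by
  -- antisymmetry, and `z ⁻¹` cancels it without its sign being known; `inv-nonNeg` can then be
  -- derived from this lemma.
  *-cancelˡ-≤ : ∀ {z x y} → 0# < z → z * x ≤ z * y → x ≤ y
  *-cancelˡ-≤ {z} {x} {y} (0≤z , z≉0) h with total x y
  ... | inj₁ x≤y = x≤y
  ... | inj₂ y≤x = ≈⇒≤ (begin-equality
    x              ≈⟨ *-identityˡ x ⟨
    1# * x         ≈⟨ *-congʳ (trans (*-comm _ _) (*-inv (0≤z , z≉0))) ⟨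
    z ⁻¹ * z * x   ≈⟨ *-assoc _ _ _ ⟩
    z ⁻¹ * (z * x) ≈⟨ *-congˡ (≤-antisym h (*-monoʳ-≤ 0≤z y≤x)) ⟩
    z ⁻¹ * (z * y) ≈⟨ *-assoc _ _ _ ⟨
    z ⁻¹ * z * y   ≈⟨ *-congʳ (trans (*-comm _ _) (*-inv (0≤z , z≉0))) ⟩
    1# * y         ≈⟨ *-identityˡ y ⟩
    y              ∎)

  inv-nonNeg : ∀ {x} → 0# < x → 0# ≤ x ⁻¹
  inv-nonNeg {x} 0<x = *-cancelˡ-≤ 0<x (begin
    x * 0#   ≈⟨ zeroʳ x ⟩
    0#       ≤⟨ 0≤1 ⟩
    1#       ≈⟨ *-inv 0<x ⟨
    x * x ⁻¹ ∎)

  inv-pos : ∀ {x} → 0# < x → 0# < x ⁻¹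
  inv-pos {x} 0<x = inv-nonNeg 0<x , λ 0≈x⁻¹ →
    0≉1 (trans (sym (zeroʳ x)) (trans (*-congˡ 0≈x⁻¹) (*-inv 0<x)))

  *-pos : ∀ {x y} → 0# < x → 0# < y → 0# < x * y
  *-pos {x} {y} 0<x 0<y = *-nonNeg (proj₁ 0<x) (proj₁ 0<y) , λ 0≈xy →
    <⇒≱ 0<y (*-cancelˡ-≤ 0<x (≤-trans (≈⇒≤ (sym 0≈xy)) (≈⇒≤ (sym (zeroʳ x)))))

  *-/-cancel : ∀ {z} → 0# < z → ∀ x → z * (x / z) ≈ x
  *-/-cancel {z} 0<z x = begin-equality
    z * (x * z ⁻¹) ≈⟨ solve 3 (λ a b d → a :* (b :* d) := b :* (a :* d)) refl z x (z ⁻¹) ⟩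
    x * (z * z ⁻¹) ≈⟨ *-congˡ (*-inv 0<z) ⟩
    x * 1#         ≈⟨ *-identityʳ x ⟩
    x              ∎

  x≤y*z⇒x/z≤y : ∀ {x y z} → 0# < z → x ≤ z * y → x / z ≤ y
  x≤y*z⇒x/z≤y 0<z h = *-cancelˡ-≤ 0<z (≤-trans (≈⇒≤ (*-/-cancel 0<z _)) h)

  z*x≤y⇒x≤y/z : ∀ {x y z} → 0# < z → z * x ≤ y → x ≤ y / z
  z*x≤y⇒x≤y/z 0<z h = *-cancelˡ-≤ 0<z (≤-trans h (≈⇒≤ (sym (*-/-cancel 0<z _))))

  ^-nonNeg : ∀ {x} → 0# ≤ x → ∀ m → 0# ≤ x ^ m
  ^-nonNeg 0≤x zero    = 0≤1
  ^-nonNeg 0≤x (suc m) = *-nonNeg 0≤x (^-nonNeg 0≤x m)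

  ^-monoˡ-≤ : ∀ {x y} → 0# ≤ x → x ≤ y → ∀ m → x ^ m ≤ y ^ m
  ^-monoˡ-≤ 0≤x x≤y zero    = ≤-refl
  ^-monoˡ-≤ 0≤x x≤y (suc m) =
    *-mono-≤ (≤-trans 0≤x x≤y) (^-nonNeg 0≤x m) x≤y (^-monoˡ-≤ 0≤x x≤y m)

  1≈1^ : ∀ m → 1# ^ m ≈ 1#
  1≈1^ zero    = refl
  1≈1^ (suc m) = trans (*-identityˡ _) (1≈1^ m)

  1≤x^ : ∀ {x} → 1# ≤ x → ∀ m → 1# ≤ x ^ m
  1≤x^ 1≤x m = ≤-trans (≈⇒≤ (sym (1≈1^ m))) (^-monoˡ-≤ 0≤1 1≤x m)

  x^≤1 : ∀ {x} → 0# ≤ x → x ≤ 1# → ∀ m → x ^ m ≤ 1#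
  x^≤1 0≤x x≤1 m = ≤-trans (^-monoˡ-≤ 0≤x x≤1 m) (≈⇒≤ (1≈1^ m))

  ^-pos : ∀ {x} → 0# < x → ∀ m → 0# < x ^ m
  ^-pos 0<x zero    = 0<1
  ^-pos 0<x (suc m) = *-pos 0<x (^-pos 0<x m)

  ^-monoʳ-≤ : ∀ {x} → 1# ≤ x → ∀ {m o} → m ℕ.≤ o → x ^ m ≤ x ^ o
  ^-monoʳ-≤ 1≤x {o = o} ℕ.z≤n   = 1≤x^ 1≤x o
  ^-monoʳ-≤ 1≤x (ℕ.s≤s m≤o) = *-monoʳ-≤ (≤-trans 0≤1 1≤x) (^-monoʳ-≤ 1≤x m≤o)

  ^-antiʳ-≤ : ∀ {x} → 0# ≤ x → x ≤ 1# → ∀ {m o} → m ℕ.≤ o → x ^ o ≤ x ^ m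
  ^-antiʳ-≤ 0≤x x≤1 {o = o} ℕ.z≤n   = x^≤1 0≤x x≤1 o
  ^-antiʳ-≤ 0≤x x≤1 (ℕ.s≤s m≤o) = *-monoʳ-≤ 0≤x (^-antiʳ-≤ 0≤x x≤1 m≤o)

  -- Serves to compare powers whose exponents match only after doubling. If x > y ≥ 0, then (x -
  -- y)(x + y) is positive, while the hypothesis makes it at most 0.
  square-cancel-≤ : ∀ {x y} → 0# ≤ y → x ^ 2 ≤ y ^ 2 → x ≤ y
  square-cancel-≤ {x} {y} 0≤y h with x ≤? y
  ... | yes x≤y = x≤y
  ... | no x≰y  = ⊥-elim (<⇒≱ (*-pos 0<x-y 0<x+y) (+-cancelʳ-≤ (y * y) (begin
      (x - y) * (x + y) + y * y   ≈⟨ solve 3 (λ a b d → d :* (a :+ b) :+ b :* b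
                                        := d :* a :+ b :* (d :+ b)) refl x y (x - y) ⟩
      (x - y) * x + y * (x - y + y) ≈⟨ +-congˡ (*-congˡ (x-y+y≈x x y)) ⟩
      (x - y) * x + y * x         ≈⟨ distribʳ x (x - y) y ⟨
      (x - y + y) * x             ≈⟨ *-congʳ (x-y+y≈x x y) ⟩
      x * x                       ≈⟨ *-congˡ (*-identityʳ x) ⟨
      x ^ 2                       ≤⟨ h ⟩
      y ^ 2                       ≈⟨ *-congˡ (*-identityʳ y) ⟩
      y * y                       ≈⟨ +-identityˡ _ ⟨
      0# + y * y                  ∎)))
    where
    y<x = ≰⇒> x≰y
    0<x-y : 0# < x - y
    0<x-y = x≤y⇒0≤y-x (proj₁ y<x) , λ 0≈ → proj₂ y<x
      (trans (sym (+-identityˡ y)) (trans (+-congʳ 0≈) (x-y+y≈x x y)))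
    0<x+y : 0# < x + y
    0<x+y = <-≤-trans 0<x (x≤x+y x 0≤y)
      where
      0<x : 0# < x
      0<x = ≤-trans 0≤y (proj₁ y<x) , λ 0≈x → proj₂ y<x
              (≤-antisym (proj₁ y<x) (≤-trans (≈⇒≤ (sym 0≈x)) 0≤y))

  fromℕ-+ : ∀ m o → fromℕ (m ℕ.+ o) ≈ fromℕ m + fromℕ o
  fromℕ-+ = ·-homo-+ 1#

  fromℕ-* : ∀ m o → fromℕ (m ℕ.* o) ≈ fromℕ m * fromℕ o
  fromℕ-* = ·1-homo-*

  fromℕ-^ : ∀ m o → fromℕ (m ℕ.^ o) ≈ fromℕ m ^ o
  fromℕ-^ m zero    = +-identityʳ 1#
  fromℕ-^ m (suc o) = trans (fromℕ-* m (m ℕ.^ o)) (*-congˡ (fromℕ-^ m o))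

  0≤fromℕ : ∀ m → 0# ≤ fromℕ m
  0≤fromℕ zero    = ≤-refl
  0≤fromℕ (suc m) = +-nonNeg 0≤1 (0≤fromℕ m)

  fromℕ-mono : ∀ {m o} → m ℕ.≤ o → fromℕ m ≤ fromℕ o
  fromℕ-mono {o = o} ℕ.z≤n = 0≤fromℕ o
  fromℕ-mono (ℕ.s≤s h)     = +-monoʳ-≤ 1# (fromℕ-mono h)

  1≤fromℕ : ∀ m → 1# ≤ fromℕ (suc m)
  1≤fromℕ m = x≤x+y 1# (0≤fromℕ m)

  fromℕ-pos : ∀ m → 0# < fromℕ (suc m)
  fromℕ-pos m = 1≤⇒0< (1≤fromℕ m)

  fromℕ-reflect-≤ : ∀ {m o} → fromℕ m ≤ fromℕ o → m ℕ.≤ o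
  fromℕ-reflect-≤ {zero}          h = ℕ.z≤n
  fromℕ-reflect-≤ {suc m} {zero}  h = ⊥-elim (1≰0 (≤-trans (1≤fromℕ m) h))
  fromℕ-reflect-≤ {suc m} {suc o} h = ℕ.s≤s (fromℕ-reflect-≤ (+-cancelʳ-≤ 1# (begin
    fromℕ m + 1#  ≈⟨ +-comm _ _ ⟩
    1# + fromℕ m  ≤⟨ h ⟩
    1# + fromℕ o  ≈⟨ +-comm _ _ ⟩
    fromℕ o + 1#  ∎)))

  ind : ∀ {p} {P : Set p} → Dec P → Carrier
  ind = indicator

  ind-yes : ∀ {p} {P : Set p} (P? : Dec P) → P → ind P? ≈ 1#
  ind-yes (yes _) _ = refl
  ind-yes (no ¬p) p = ⊥-elim (¬p p)

  ind-no : ∀ {p} {P : Set p} (P? : Dec P) → ¬ P → ind P? ≈ 0#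
  ind-no (yes p) ¬p = ⊥-elim (¬p p)
  ind-no (no _)  _  = refl

  ind-nonNeg : ∀ {p} {P : Set p} (P? : Dec P) → 0# ≤ ind P?
  ind-nonNeg (yes _) = 0≤1
  ind-nonNeg (no _)  = ≤-refl

  ind-≤1 : ∀ {p} {P : Set p} (P? : Dec P) → ind P? ≤ 1#
  ind-≤1 (yes _) = ≤-refl
  ind-≤1 (no _)  = 0≤1

  abs-cases : ∀ x → (0# ≤ x × abs x ≡ x) ⊎ (x ≤ 0# × abs x ≡ - x)
  abs-cases x with 0# ≤? x
  ... | yes h = inj₁ (h , ≡.refl)
  ... | no h  = inj₂ (proj₁ (≰⇒> h) , ≡.refl)

  x≤abs : ∀ x → x ≤ abs x
  x≤abs x with abs-cases x
  ... | inj₁ (h , eq) = ≈⇒≤ (reflexive (≡.sym eq))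
  ... | inj₂ (h , eq) = ≤-trans h (≤-trans (x≤0⇒0≤-x h) (≈⇒≤ (reflexive (≡.sym eq))))

  -x≤abs : ∀ x → - x ≤ abs x
  -x≤abs x with abs-cases x
  ... | inj₁ (h , eq) = ≤-trans (≤-trans (neg-mono h) (≈⇒≤ -0#≈0#))
                          (≤-trans h (≈⇒≤ (reflexive (≡.sym eq))))
  ... | inj₂ (h , eq) = ≈⇒≤ (reflexive (≡.sym eq))

-- The exponential function and rounding

module ExpBounds {c ℓ₁ ℓ₂} (ℝ : CompleteOrderedField c ℓ₁ ℓ₂) where
  open OrderedField ℝ
  open ≤R
  open Solver using (solve; _:+_; _:*_; _:=_; con)

  -- Bernoulli's inequality (1 - x)^m ≥ 1 - mx without subtraction, `p` standing for 1 - x. The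
  -- induction step drops the term m x², so the sign of x does not matter.
  bernoulli : ∀ {p x} → 0# ≤ p → p + x ≈ 1# → ∀ m → 1# ≤ p ^ m + fromℕ m * x
  bernoulli {p} {x} 0≤p p+x≈1 zero    = x≤x+y 1# (≈⇒≤ (sym (zeroˡ x)))
  bernoulli {p} {x} 0≤p p+x≈1 (suc m) = begin
    1#                                        ≈⟨ p+x≈1 ⟨
    p + x                                     ≤⟨ +-monoˡ-≤ x p≤ ⟩
    p * (p ^ m + fromℕ m * x) + x             ≤⟨ x≤x+y _ (*-nonNeg (0≤fromℕ m) (0≤x*x x)) ⟩
    p * (p ^ m + fromℕ m * x) + x + fromℕ m * (x * x)
      ≈⟨ solve 4 (λ p q m x → p :* (q :+ m :* x) :+ x :+ m :* (x :* x)
            := p :* q :+ ((p :+ x) :* (m :* x) :+ x)) refl p (p ^ m) (fromℕ m) x ⟩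
    p * p ^ m + ((p + x) * (fromℕ m * x) + x) ≈⟨ +-congˡ (+-congʳ (*-congʳ p+x≈1)) ⟩
    p * p ^ m + (1# * (fromℕ m * x) + x)
      ≈⟨ +-congˡ (solve 2 (λ m x → con 1 :* (m :* x) :+ x := (con 1 :+ m) :* x) refl (fromℕ m) x) ⟩
    p ^ suc m + fromℕ (suc m) * x             ∎
    where
    p≤ : p ≤ p * (p ^ m + fromℕ m * x)
    p≤ = ≤-trans (≈⇒≤ (sym (*-identityʳ p))) (*-monoʳ-≤ 0≤p (bernoulli 0≤p p+x≈1 m))

  -- A finite form of e^y (1 - y) ≤ 1 with y = mu. Bernoulli gives z = 1 - mu ≤ (1 - u)^m, and (1 +
  -- u)(1 - u) = 1 - u² ≤ 1.
  [1+u]^m*z≤1 : ∀ {u z} m → u ≤ 1# → - u ≤ 1# → fromℕ m * u + z ≈ 1# →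
                (1# + u) ^ m * z ≤ 1#
  [1+u]^m*z≤1 {u} {z} m u≤1 -u≤1 mu+z≈1 = begin
    (1# + u) ^ m * z             ≤⟨ *-monoʳ-≤ (^-nonNeg 0≤1+u m) z≤ ⟩
    (1# + u) ^ m * (1# - u) ^ m  ≈⟨ ^-distrib-* (1# + u) (1# - u) m ⟨
    ((1# + u) * (1# - u)) ^ m    ≤⟨ x^≤1 (*-nonNeg 0≤1+u 0≤1-u) ≤1 m ⟩
    1#                           ∎
    where
    0≤1-u : 0# ≤ 1# - u
    0≤1-u = x≤y⇒0≤y-x u≤1
    0≤1+u : 0# ≤ 1# + u
    0≤1+u = +-cancelʳ-≤ (- u) (≤-trans (≈⇒≤ (+-identityˡ (- u)))
              (≤-trans -u≤1 (≈⇒≤ (sym (x+y-y≈x 1# u)))))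
    z≤ : z ≤ (1# - u) ^ m
    z≤ = +-cancelʳ-≤ (fromℕ m * u) (begin
      z + fromℕ m * u            ≈⟨ trans (+-comm _ _) mu+z≈1 ⟩
      1#                         ≤⟨ bernoulli 0≤1-u (x-y+y≈x 1# u) m ⟩
      (1# - u) ^ m + fromℕ m * u ∎)
    ≤1 : (1# + u) * (1# - u) ≤ 1#
    ≤1 = begin
      (1# + u) * (1# - u)         ≤⟨ x≤x+y _ (0≤x*x u) ⟩
      (1# + u) * (1# - u) + u * u ≈⟨ solve 2 (λ u v → (con 1 :+ u) :* v :+ u :* u
                                       := v :+ u :* (v :+ u)) refl u (1# - u) ⟩
      (1# - u) + u * (1# - u + u) ≈⟨ +-congˡ (trans (*-congˡ (x-y+y≈x 1# u)) (*-identityʳ u)) ⟩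
      1# - u + u                  ≈⟨ x-y+y≈x 1# u ⟩
      1#                          ∎

  x≤y⇒x/y≤1 : ∀ {x y} → 0# < y → x ≤ y → x / y ≤ 1#
  x≤y⇒x/y≤1 0<y x≤y = x≤y*z⇒x/z≤y 0<y (≤-trans x≤y (≈⇒≤ (sym (*-identityʳ _))))

  -- From e^y ≤ 1/(1 - y), raised to the power T + 1. All estimates of logarithms go through this
  -- inequality. If it failed, E would exceed w = z^-(T+1), and convergence would force a late term
  -- of the sequence above w, whereas a suitable late term is at most w.
  exp-bound : ∀ {L E y z} T → IsExp L E → L ≤ fromℕ (suc T) * y → y + z ≈ 1# → 0# < z →
              E * z ^ suc T ≤ 1#
  exp-bound {L} {E} {y} {z} T lim L≤ y+z≈1 0<z with E * z ^ suc T ≤? 1#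
  ... | yes h = h
  ... | no h  = ⊥-elim (<⇒≱ (lim-close (proj₂ near m N≤m)) term≤w)
    where
    zT = z ^ suc T
    0<zT : 0# < zT
    0<zT = ^-pos 0<z (suc T)
    w = zT ⁻¹
    w<E : w < E
    w<E = ≰⇒> λ E≤w → h (≤-trans (*-monoˡ-≤ (proj₁ 0<zT) E≤w)
                            (≈⇒≤ (trans (*-comm _ _) (*-inv 0<zT))))
    δ = E - w
    0<δ : 0# < δ
    0<δ = x≤y⇒0≤y-x (proj₁ w<E) , λ 0≈ → proj₂ w<E
            (trans (sym (+-identityˡ w)) (trans (+-congʳ 0≈) (x-y+y≈x E w)))
    near = lim δ 0<δ
    N = proj₁ near
    a = proj₁ (archimedean (abs y))
    b = proj₁ (archimedean (abs L))
    -- The sequence is read at `suc m`, which is M(T + 1) by computation, so that its power splits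
    -- into T + 1 blocks of M factors. M exceeds N for the limit, the bound of |y| so that |y/M| ≤
    -- 1, and the bound of |L| so that 1 + L/(m + 1) ≥ 0.
    M′ = N ℕ.+ (a ℕ.+ b)
    M = suc M′
    m = T ℕ.+ M′ ℕ.* suc T
    M′≤m : M′ ℕ.≤ m
    M′≤m = ℕ.≤-trans (ℕ.m≤m*n M′ (suc T)) (ℕ.m≤n+m _ T)
    N≤m : N ℕ.≤ m
    N≤m = ℕ.≤-trans (ℕ.m≤m+n N (a ℕ.+ b)) M′≤m
    term = (1# + L / fromℕ (suc m)) ^ suc m
    absy≤M : abs y ≤ fromℕ M
    absy≤M = ≤-trans (proj₂ (archimedean (abs y)))
      (fromℕ-mono (ℕ.m≤n⇒m≤1+n (ℕ.≤-trans (ℕ.m≤m+n a b) (ℕ.m≤n+m _ N))))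
    absL≤m : abs L ≤ fromℕ (suc m)
    absL≤m = ≤-trans (proj₂ (archimedean (abs L)))
      (fromℕ-mono (ℕ.m≤n⇒m≤1+n (ℕ.≤-trans (ℕ.≤-trans (ℕ.m≤n+m b a) (ℕ.m≤n+m _ N)) M′≤m)))
    0<M = fromℕ-pos M′
    0<m = fromℕ-pos m
    u = y / fromℕ M
    Mu≈y : fromℕ M * u ≈ y
    Mu≈y = *-/-cancel 0<M y
    block : (1# + u) ^ M * z ≤ 1#
    block = [1+u]^m*z≤1 M (x≤y⇒x/y≤1 0<M (≤-trans (x≤abs y) absy≤M))
      (≤-trans (≈⇒≤ (-‿distribˡ-* y _)) (x≤y⇒x/y≤1 0<M (≤-trans (-x≤abs y) absy≤M)))
      (trans (+-congʳ Mu≈y) y+z≈1)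
    L/m≤u : L / fromℕ (suc m) ≤ u
    L/m≤u = x≤y*z⇒x/z≤y 0<m (begin
      L                            ≤⟨ L≤ ⟩
      fromℕ (suc T) * y            ≈⟨ *-congˡ Mu≈y ⟨
      fromℕ (suc T) * (fromℕ M * u)
          ≈⟨ solve 3 (λ x y z → x :* (y :* z) := y :* x :* z) refl (fromℕ (suc T)) (fromℕ M) u ⟩
      fromℕ M * fromℕ (suc T) * u  ≈⟨ *-congʳ (fromℕ-* M (suc T)) ⟨
      fromℕ (suc m) * u            ∎)
    0≤1+L/m : 0# ≤ 1# + L / fromℕ (suc m)
    0≤1+L/m = +-cancelʳ-≤ (- (L / fromℕ (suc m))) (begin
      0# + - (L / fromℕ (suc m))  ≈⟨ +-identityˡ _ ⟩
      - (L / fromℕ (suc m))       ≈⟨ -‿distribˡ-* L _ ⟩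
      - L / fromℕ (suc m)         ≤⟨ x≤y⇒x/y≤1 0<m (≤-trans (-x≤abs L) absL≤m) ⟩
      1#                          ≈⟨ x+y-y≈x 1# _ ⟨
      1# + L / fromℕ (suc m) - L / fromℕ (suc m) ∎)
    0≤1+u : 0# ≤ 1# + u
    0≤1+u = ≤-trans 0≤1+L/m (+-monoʳ-≤ 1# L/m≤u)
    term≤w : term ≤ w
    term≤w = *-cancelˡ-≤ 0<zT (begin
      zT * term                             ≤⟨ *-monoʳ-≤ (proj₁ 0<zT)
                                                 (^-monoˡ-≤ 0≤1+L/m (+-monoʳ-≤ 1# L/m≤u) (suc m)) ⟩
      zT * (1# + u) ^ (M ℕ.* suc T)         ≈⟨ *-congˡ (^-assocʳ (1# + u) M (suc T)) ⟨
      zT * ((1# + u) ^ M) ^ suc T           ≈⟨ *-comm _ _ ⟩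
      ((1# + u) ^ M) ^ suc T * zT           ≈⟨ ^-distrib-* _ z (suc T) ⟨
      ((1# + u) ^ M * z) ^ suc T
          ≤⟨ x^≤1 (*-nonNeg (^-nonNeg 0≤1+u M) (proj₁ 0<z)) block (suc T) ⟩
      1#                                    ≈⟨ *-inv 0<zT ⟨
      zT * w                                ∎)
    lim-close : abs (term - E) < δ → w < term
    lim-close close = ≰⇒> λ term≤w → <⇒≱ close (begin
      E - w           ≤⟨ +-monoʳ-≤ E (neg-mono term≤w) ⟩
      E - term        ≈⟨ +-congʳ (sym (-‿involutive E)) ⟩
      - - E - term    ≈⟨ +-comm _ _ ⟩
      - term + - - E  ≈⟨ -‿+-comm term (- E) ⟩
      - (term - E)    ≤⟨ -x≤abs _ ⟩
      abs (term - E)  ∎)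

  floor : ∀ {x} → 0# ≤ x → Σ ℕ λ t → fromℕ t ≤ x × x < fromℕ (suc t)
  floor {x} 0≤x = search (proj₁ (archimedean x)) (<-≤-trans x<1+x
      (≤-trans (+-monoʳ-≤ 1# (proj₂ (archimedean x))) ≤-refl))
    where
    x<1+x : x < 1# + x
    x<1+x = ≰⇒> λ h → 1≰0 (+-cancelʳ-≤ x (≤-trans h (≈⇒≤ (sym (+-identityˡ x)))))
    search : ∀ m → x < fromℕ (suc m) → Σ ℕ λ t → fromℕ t ≤ x × x < fromℕ (suc t)
    search zero    h = zero , 0≤x , h
    search (suc m) h with fromℕ (suc m) ≤? x
    ... | yes m≤x = suc m , m≤x , h
    ... | no m≰x  = search m (≰⇒> m≰x)

  -- For L < 0, `exp-bound` with T = 0 and y = L gives 1 - L ≤ E(1 - L) ≤ 1, which forces 0 ≤ L.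
  log-nonNeg : ∀ {E L} → IsLog E L → 1# ≤ E → 0# ≤ L
  log-nonNeg {E} {L} isLog 1≤E with 0# ≤? L
  ... | yes h = h
  ... | no h  = +-cancelʳ-≤ (1# - L) (begin
      0# + (1# - L)         ≈⟨ +-identityˡ _ ⟩
      1# - L                ≈⟨ trans (*-identityˡ _) (*-identityʳ _) ⟨
      1# * (1# - L) ^ 1     ≤⟨ *-monoˡ-≤ (^-nonNeg (proj₁ 0<1-L) 1) 1≤E ⟩
      E * (1# - L) ^ 1
          ≤⟨ exp-bound 0 isLog (≈⇒≤ (sym (trans (*-congʳ (+-identityʳ 1#)) (*-identityˡ L))))
          (trans (+-comm _ _) (x-y+y≈x 1# L)) 0<1-L ⟩
      1#                    ≈⟨ trans (+-comm _ _) (x-y+y≈x 1# L) ⟨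
      L + (1# - L)          ∎)
    where
    0<1-L : 0# < 1# - L
    0<1-L = 1≤⇒0< (x≤x+y 1# (x≤0⇒0≤-x (proj₁ (≰⇒> h))))

  ratio : ℕ → ℕ → Carrier
  ratio m o = fromℕ m / fromℕ o

  ratio-pos : ∀ m o → 0# < ratio (suc m) (suc o)
  ratio-pos m o = *-pos (fromℕ-pos m) (inv-pos (fromℕ-pos o))

  ratio-sum : ∀ {m o D} → m ℕ.+ o ≡ suc D → ratio m (suc D) + ratio o (suc D) ≈ 1#
  ratio-sum {m} {o} {D} eq = begin-equality
    ratio m (suc D) + ratio o (suc D)       ≈⟨ distribʳ _ (fromℕ m) (fromℕ o) ⟨
    (fromℕ m + fromℕ o) / fromℕ (suc D)     ≈⟨ *-congʳ (fromℕ-+ m o) ⟨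
    fromℕ (m ℕ.+ o) / fromℕ (suc D)         ≈⟨ *-congʳ (reflexive (≡.cong fromℕ eq)) ⟩
    fromℕ (suc D) / fromℕ (suc D)           ≈⟨ *-inv (fromℕ-pos D) ⟩
    1#                                      ∎

  -- With b = 1 - 3/(4n) and a = 1 - 1/(2n) for n = p + 1, b² ≤ a³; the slack pays for
  -- rounding 2n log(n/ε) down to an integer.
  rate : ℕ → Carrier
  rate p = ratio (suc (4 ℕ.* p)) (4 ℕ.* suc p)

  rate²≤ : ∀ p → rate p ^ 2 ≤ ratio (suc (2 ℕ.* p)) (2 ℕ.* suc p) ^ 3
  rate²≤ p = *-cancelˡ-≤ 0<D (begin
    D * rate p ^ 2                                ≈⟨ *-congʳ D≈B²n ⟩
    B ^ 2 * n * rate p ^ 2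
      ≈⟨ solve 3 (λ B n b → B :* (B :* con 1) :* n :* (b :* (b :* con 1)) :=
          n :* ((B :* b) :* (B :* b))) refl B n (rate p) ⟩
    n * ((B * rate p) * (B * rate p))             ≈⟨ *-congˡ (*-cong Bb≈ Bb≈) ⟩
    n * (fromℕ b′ * fromℕ b′)                     ≈⟨ *-congˡ (fromℕ-* b′ b′) ⟨
    n * fromℕ (b′ ℕ.* b′)                         ≈⟨ fromℕ-* (suc p) (b′ ℕ.* b′) ⟨
    fromℕ (suc p ℕ.* (b′ ℕ.* b′))                 ≤⟨ fromℕ-mono nat ⟩
    fromℕ (2 ℕ.* (a′ ℕ.* (a′ ℕ.* a′)))
        ≈⟨ trans (fromℕ-* 2 (a′ ℕ.* (a′ ℕ.* a′)))
        (*-congˡ (trans (fromℕ-* a′ (a′ ℕ.* a′)) (*-congˡ (fromℕ-* a′ a′)))) ⟩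
    fromℕ 2 * (fromℕ a′ * (fromℕ a′ * fromℕ a′))  ≈⟨ *-congˡ (*-cong Aa≈ (*-cong Aa≈ Aa≈)) ⟨
    fromℕ 2 * ((A * a) * ((A * a) * (A * a)))
      ≈⟨ solve 3 (λ t A a → t :* ((A :* a) :* ((A :* a) :* (A :* a))) :=
          t :* (A :* (A :* (A :* con 1))) :* (a :* (a :* (a :* con 1)))) refl (fromℕ 2) A a ⟩
    D * a ^ 3                                     ∎)
    where
    n = fromℕ (suc p)
    A = fromℕ (2 ℕ.* suc p)
    B = fromℕ (4 ℕ.* suc p)
    a′ = suc (2 ℕ.* p)
    b′ = suc (4 ℕ.* p)
    a = ratio a′ (2 ℕ.* suc p)
    -- A common denominator: with A = 2n and B = 4n, both 2A³ and B²n equal 16n³.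
    D = fromℕ 2 * A ^ 3
    0<A : 0# < A
    0<A = fromℕ-pos (p ℕ.+ 1 ℕ.* suc p)
    0<B : 0# < B
    0<B = fromℕ-pos (p ℕ.+ 3 ℕ.* suc p)
    Bb≈ : B * rate p ≈ fromℕ b′
    Bb≈ = *-/-cancel 0<B (fromℕ b′)
    Aa≈ : A * a ≈ fromℕ a′
    Aa≈ = *-/-cancel 0<A (fromℕ a′)
    0<D : 0# < D
    0<D = *-pos (fromℕ-pos 1) (^-pos 0<A 3)
    D≈B²n : D ≈ B ^ 2 * n
    D≈B²n = begin-equality
      fromℕ 2 * A ^ 3  ≈⟨ *-congˡ (fromℕ-^ (2 ℕ.* suc p) 3) ⟨
      fromℕ 2 * fromℕ ((2 ℕ.* suc p) ℕ.^ 3) ≈⟨ fromℕ-* 2 ((2 ℕ.* suc p) ℕ.^ 3) ⟨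
      fromℕ (2 ℕ.* (2 ℕ.* suc p) ℕ.^ 3) ≈⟨ reflexive (≡.cong fromℕ eqn) ⟩
      fromℕ ((4 ℕ.* suc p) ℕ.^ 2 ℕ.* suc p) ≈⟨ fromℕ-* ((4 ℕ.* suc p) ℕ.^ 2) (suc p) ⟩
      fromℕ ((4 ℕ.* suc p) ℕ.^ 2) * n ≈⟨ *-congʳ (fromℕ-^ (4 ℕ.* suc p) 2) ⟩
      B ^ 2 * n ∎
      where
      open +-*-Solver using () renaming
          (solve to solveℕ; _:*_ to _⊛_; _:^_ to _⊛^_; con to conℕ; _:=_ to _⊜_)
      eqn : 2 ℕ.* (2 ℕ.* suc p) ℕ.^ 3 ≡ (4 ℕ.* suc p) ℕ.^ 2 ℕ.* suc p
      eqn = solveℕ 1 (λ n → conℕ 2 ⊛ (conℕ 2 ⊛ n) ⊛^ 3 ⊜ (conℕ 4 ⊛ n) ⊛^ 2 ⊛ n) ≡.refl (suc p)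
    nat : suc p ℕ.* (b′ ℕ.* b′) ℕ.≤ 2 ℕ.* (a′ ℕ.* (a′ ℕ.* a′))
    -- The two sides differ by exactly 3p + 1.
    nat = ℕ.≤-trans (ℕ.m≤m+n _ (suc (3 ℕ.* p))) (ℕ.≤-reflexive eqn)
      where
      open +-*-Solver using () renaming
          (solve to solveℕ; _:*_ to _⊛_; _:+_ to _⊕_; con to conℕ; _:=_ to _⊜_)
      eqn : suc p ℕ.* (b′ ℕ.* b′) ℕ.+ suc (3 ℕ.* p) ≡ 2 ℕ.* (a′ ℕ.* (a′ ℕ.* a′))
      eqn = solveℕ 1 (λ p → (conℕ 1 ⊕ p) ⊛ ((conℕ 1 ⊕ conℕ 4 ⊛ p) ⊛ (conℕ 1 ⊕ conℕ 4 ⊛ p)) ⊕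
          (conℕ 1 ⊕ conℕ 3 ⊛ p)
              ⊜ conℕ 2 ⊛ ((conℕ 1 ⊕ conℕ 2 ⊛ p) ⊛ ((conℕ 1 ⊕ conℕ 2 ⊛ p) ⊛ (conℕ 1 ⊕ conℕ 2 ⊛ p))))
                  ≡.refl p

  rate-pos : ∀ p → 0# < rate p
  rate-pos p = ratio-pos (4 ℕ.* p) (p ℕ.+ 3 ℕ.* suc p)

  -- Take t to be the integer part of 2nL. Then L ≤ (t + 1)/(2n), so `exp-bound` with a = 1 - 1/(2n)
  -- yields (n/ε) a^(t+1) ≤ 1. It remains to see that rate^t ≤ a^(t+1), where the faster rate
  -- absorbs the missing factor a as soon as t ≥ 2.
  time-bound : ∀ p {ε L} → 2 ℕ.≤ p → 0# < ε → ε ≤ 1# → IsLog (fromℕ (suc p) / ε) L →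
               Σ ℕ λ t → fromℕ t ≤ fromℕ (2 ℕ.* suc p) * L × fromℕ (suc p) * rate p ^ t ≤ ε
  time-bound (suc p′) {ε} {L} 2≤p 0<ε ε≤1 isLog = t , proj₁ (proj₂ fl) , (begin
      fromℕ n * rate p ^ t       ≤⟨ *-monoʳ-≤ (0≤fromℕ n) bᵗ≤aᵗ⁺¹ ⟩
      fromℕ n * a ^ suc t        ≈⟨ *-congʳ (*-/-cancel 0<ε (fromℕ n)) ⟨
      ε * E * a ^ suc t          ≈⟨ *-assoc _ _ _ ⟩
      ε * (E * a ^ suc t)        ≤⟨ *-monoʳ-≤ (proj₁ 0<ε) (exp-bound t isLog L≤ 1/2n+a≈1 0<a) ⟩
      ε * 1#                     ≈⟨ *-identityʳ ε ⟩
      ε                          ∎)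
    where
    p = suc p′
    n = suc p
    E = fromℕ n / ε
    a = ratio (suc (2 ℕ.* p)) (2 ℕ.* n)
    n≤E : fromℕ n ≤ E
    n≤E = z*x≤y⇒x≤y/z 0<ε (≤-trans (*-monoˡ-≤ (0≤fromℕ n) ε≤1) (≈⇒≤ (*-identityˡ _)))
    -- If nL < 1, then e^L (1 - 1/n) ≤ 1. Since e^L = n/ε ≥ n, this gives p = n - 1 ≤ 1, against 2 ≤
    -- p.
    1≤nL : 1# ≤ fromℕ n * L
    1≤nL with 1# ≤? fromℕ n * L
    ... | yes h = h
    ... | no h  = ⊥-elim (ℕ.<⇒≱ 2≤p (fromℕ-reflect-≤ {p} {1} (begin
      fromℕ p                   ≈⟨ *-/-cancel (fromℕ-pos p) (fromℕ p) ⟨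
      fromℕ n * ratio p n       ≤⟨ *-monoˡ-≤ (proj₁ (ratio-pos p′ p)) n≤E ⟩
      E * ratio p n             ≈⟨ *-congˡ (*-identityʳ _) ⟨
      E * ratio p n ^ 1
          ≤⟨ exp-bound 0 isLog L≤1/n (ratio-sum {1} {p} ≡.refl) (ratio-pos p′ p) ⟩
      1#                        ≈⟨ +-identityʳ 1# ⟨
      fromℕ 1                   ∎)))
      where
      L≤1/n : L ≤ fromℕ 1 * ratio 1 n
      L≤1/n = *-cancelˡ-≤ (fromℕ-pos p) (begin
        fromℕ n * L                     ≤⟨ proj₁ (≰⇒> h) ⟩
        1#
            ≈⟨ trans (*-congʳ (+-identityʳ 1#)) (trans (*-identityˡ _) (+-identityʳ 1#)) ⟨
        fromℕ 1 * fromℕ 1               ≈⟨ *-congˡ (*-/-cancel (fromℕ-pos p) (fromℕ 1)) ⟨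
        fromℕ 1 * (fromℕ n * ratio 1 n)
            ≈⟨ solve 3 (λ x y z → x :* (y :* z) := y :* (x :* z)) refl (fromℕ 1) (fromℕ n)
            (ratio 1 n) ⟩
        fromℕ n * (fromℕ 1 * ratio 1 n) ∎)
    0<2n : 0# < fromℕ (2 ℕ.* n)
    0<2n = fromℕ-pos (p ℕ.+ 1 ℕ.* n)
    2nL≈ : fromℕ (2 ℕ.* n) * L ≈ fromℕ 2 * (fromℕ n * L)
    2nL≈ = trans (*-congʳ (fromℕ-* 2 n)) (*-assoc _ _ _)
    2≤2nL : fromℕ 2 ≤ fromℕ (2 ℕ.* n) * L
    2≤2nL = begin
      fromℕ 2                 ≈⟨ *-identityʳ _ ⟨
      fromℕ 2 * 1#            ≤⟨ *-monoʳ-≤ (0≤fromℕ 2) 1≤nL ⟩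
      fromℕ 2 * (fromℕ n * L) ≈⟨ 2nL≈ ⟨
      fromℕ (2 ℕ.* n) * L     ∎
    fl = floor (≤-trans (0≤fromℕ 2) 2≤2nL)
    t = proj₁ fl
    2≤t : 2 ℕ.≤ t
    2≤t = ℕ.≮⇒≥ λ t<2 → <⇒≱ (proj₂ (proj₂ fl)) (≤-trans (fromℕ-mono t<2) 2≤2nL)
    L≤ : L ≤ fromℕ (suc t) * ratio 1 (2 ℕ.* n)
    L≤ = *-cancelˡ-≤ 0<2n (begin
      fromℕ (2 ℕ.* n) * L   ≤⟨ proj₁ (proj₂ (proj₂ fl)) ⟩
      fromℕ (suc t)         ≈⟨ trans (*-congˡ (+-identityʳ 1#)) (*-identityʳ _) ⟨
      fromℕ (suc t) * fromℕ 1 ≈⟨ *-congˡ (*-/-cancel 0<2n (fromℕ 1)) ⟨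
      fromℕ (suc t) * (fromℕ (2 ℕ.* n) * ratio 1 (2 ℕ.* n))
          ≈⟨ solve 3 (λ x y z → x :* (y :* z) := y :* (x :* z)) refl (fromℕ (suc t))
          (fromℕ (2 ℕ.* n)) (ratio 1 (2 ℕ.* n)) ⟩
      fromℕ (2 ℕ.* n) * (fromℕ (suc t) * ratio 1 (2 ℕ.* n)) ∎)
    1/2n+a≈1 : ratio 1 (2 ℕ.* n) + a ≈ 1#
    1/2n+a≈1 = ratio-sum {1} {suc (2 ℕ.* p)} (≡.cong suc (≡.sym (ℕ.+-suc p (p ℕ.+ 0))))
    0<a : 0# < a
    0<a = ratio-pos (2 ℕ.* p) (p ℕ.+ 1 ℕ.* n)
    0≤a = proj₁ 0<a
    a≤1 : a ≤ 1#
    a≤1 = ≤-trans (x≤y+x a (proj₁ (ratio-pos 0 (p ℕ.+ 1 ℕ.* n)))) (≈⇒≤ 1/2n+a≈1)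
    -- On squares: rate^(2t) ≤ a^(3t) ≤ a^(2t+2), where the second inequality uses t ≥ 2 and a ≤ 1.
    bᵗ≤aᵗ⁺¹ : rate p ^ t ≤ a ^ suc t
    bᵗ≤aᵗ⁺¹ = square-cancel-≤ (^-nonNeg 0≤a (suc t)) (begin
      (rate p ^ t) ^ 2    ≈⟨ ^-assocʳ _ t 2 ⟩
      rate p ^ (t ℕ.* 2)  ≈⟨ ^-congʳ _ (ℕ.*-comm t 2) ⟩
      rate p ^ (2 ℕ.* t)  ≈⟨ ^-assocʳ _ 2 t ⟨
      (rate p ^ 2) ^ t    ≤⟨ ^-monoˡ-≤ (^-nonNeg (proj₁ (rate-pos p)) 2) (rate²≤ p) t ⟩
      (a ^ 3) ^ t         ≈⟨ ^-assocʳ _ 3 t ⟩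
      a ^ (3 ℕ.* t)       ≤⟨ ^-antiʳ-≤ 0≤a a≤1 2t+2≤3t ⟩
      a ^ (suc t ℕ.* 2)   ≈⟨ ^-assocʳ _ (suc t) 2 ⟨
      (a ^ suc t) ^ 2     ∎)
      where
      2t+2≤3t : suc t ℕ.* 2 ℕ.≤ 3 ℕ.* t
      2t+2≤3t = ℕ.+-mono-≤ 2≤t (ℕ.≤-reflexive (ℕ.*-comm t 2))

-- Sums over configurations

module FiniteSums {c ℓ₁ ℓ₂} (ℝ : CompleteOrderedField c ℓ₁ ℓ₂) where
  open OrderedField ℝ
  open ≤R
  open Algebra.Properties.CommutativeMonoid.Sum +-commutativeMonoid public
    using (sum-cong-≋; ∑-distrib-+; ∑-comm; sum-replicate; sum-replicate-zero)
  open Algebra.Properties.Semiring.Sum semiring public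
    using (*-distribˡ-sum; *-distribʳ-sum)

  sum-mono : ∀ {n} {f g : Fin n → Carrier} → (∀ i → f i ≤ g i) → sum f ≤ sum g
  sum-mono {zero}  h = ≤-refl
  sum-mono {suc n} h = +-mono-≤ (h zero) (sum-mono (h ∘ suc))

  sum-zero : ∀ {n} {f : Fin n → Carrier} → (∀ i → f i ≈ 0#) → sum f ≈ 0#
  sum-zero {n} h = trans (sum-cong-≋ h) (sum-replicate-zero n)

  sum-const : ∀ n x → sum {n} (λ _ → x) ≈ fromℕ n * x
  sum-const zero    x = sym (zeroˡ x)
  sum-const (suc n) x = trans (+-cong (sym (*-identityˡ x)) (sum-const n x))
      (sym (distribʳ x 1# (fromℕ n)))

  sum-nonNeg : ∀ {n} {f : Fin n → Carrier} → (∀ i → 0# ≤ f i) → 0# ≤ sum f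
  sum-nonNeg {n} h = ≤-trans (≈⇒≤ (sym (sum-replicate-zero n))) (sum-mono h)

  sum-single : ∀ {n} {f : Fin n → Carrier} i → (∀ j → j ≢ i → f j ≈ 0#) → sum f ≈ f i
  sum-single zero    h = trans (+-congˡ (sum-zero λ j → h (suc j) λ ())) (+-identityʳ _)
  sum-single (suc i) h =
    trans (+-cong (h zero λ ()) (sum-single i λ j j≢i → h (suc j) (j≢i ∘ Fin.suc-injective)))
          (+-identityˡ _)

  term≤sum : ∀ {n} {f : Fin n → Carrier} → (∀ i → 0# ≤ f i) → ∀ i → f i ≤ sum f
  term≤sum h zero    = x≤x+y _ (sum-nonNeg (h ∘ suc))
  term≤sum h (suc i) = ≤-trans (term≤sum (h ∘ suc) i) (x≤y+x _ (h zero))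

  sum-ind-tabulate : ∀ {a p} {A : Set a} {P : Pred A p} (P? : Decidable P) {n} (f : Fin n → A) →
                     fromℕ (length (filter P? (tabulate f))) ≈ sum λ i → ind (P? (f i))
  sum-ind-tabulate P? {zero}  f = refl
  sum-ind-tabulate P? {suc n} f with P? (f zero)
  ... | yes _ = +-congˡ (sum-ind-tabulate P? (f ∘ suc))
  ... | no _  = trans (sum-ind-tabulate P? (f ∘ suc)) (sym (+-identityˡ _))

  ind-suc∈ : ∀ {n} (S : Subset n) s i → ind (suc i ∈? (s ∷ S)) ≈ ind (i ∈? S)
  ind-suc∈ S s i with i ∈? S
  ... | yes _ = refl
  ... | no _  = refl

  sum-ind-∈ : ∀ {n} (S : Subset n) → sum (λ i → ind (i ∈? S)) ≈ fromℕ ∣ S ∣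
  sum-ind-∈ []      = refl
  sum-ind-∈ (s ∷ S) with s
  ... | inside  = +-congˡ (trans (sum-cong-≋ (ind-suc∈ S inside)) (sum-ind-∈ S))
  ... | outside = trans (+-identityˡ _) (trans (sum-cong-≋ (ind-suc∈ S outside)) (sum-ind-∈ S))

  module _ {q : ℕ} where

    sumConfig-cong : ∀ n {f g : Config q n → Carrier} → (∀ σ → f σ ≈ g σ) →
        sumConfig n f ≈ sumConfig n g
    sumConfig-cong zero    h = h []
    sumConfig-cong (suc n) h = sum-cong-≋ λ a → sumConfig-cong n λ σ → h (a ∷ σ)

    sumConfig-mono : ∀ n {f g : Config q n → Carrier} → (∀ σ → f σ ≤ g σ) →
        sumConfig n f ≤ sumConfig n g
    sumConfig-mono zero    h = h []
    sumConfig-mono (suc n) h = sum-mono λ a → sumConfig-mono n λ σ → h (a ∷ σ)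

    sumConfig-+ : ∀ n (f g : Config q n → Carrier) →
                  sumConfig n (λ σ → f σ + g σ) ≈ sumConfig n f + sumConfig n g
    sumConfig-+ zero    f g = refl
    sumConfig-+ (suc n) f g =
      trans (sum-cong-≋ λ a → sumConfig-+ n (λ σ → f (a ∷ σ)) (λ σ → g (a ∷ σ)))
            (∑-distrib-+ (λ a → sumConfig n λ σ → f (a ∷ σ)) (λ a → sumConfig n λ σ → g (a ∷ σ)))

    *-distribˡ-sumConfig : ∀ n x (f : Config q n → Carrier) →
                           x * sumConfig n f ≈ sumConfig n (λ σ → x * f σ)
    *-distribˡ-sumConfig zero    x f = refl
    *-distribˡ-sumConfig (suc n) x f =
      trans (*-distribˡ-sum x (λ a → sumConfig n λ σ → f (a ∷ σ)))
            (sum-cong-≋ λ a → *-distribˡ-sumConfig n x λ σ → f (a ∷ σ))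

    *-distribʳ-sumConfig : ∀ n x (f : Config q n → Carrier) →
                           sumConfig n f * x ≈ sumConfig n (λ σ → f σ * x)
    *-distribʳ-sumConfig n x f = trans (*-comm _ x)
      (trans (*-distribˡ-sumConfig n x f) (sumConfig-cong n λ σ → *-comm x (f σ)))

    sumConfig-sum : ∀ n {m} (f : Config q n → Fin m → Carrier) →
                    sumConfig n (λ σ → sum (f σ)) ≈ sum λ i → sumConfig n λ σ → f σ i
    sumConfig-sum zero    f = refl
    sumConfig-sum (suc n) f =
      trans (sum-cong-≋ λ a → sumConfig-sum n λ σ → f (a ∷ σ))
            (∑-comm λ a i → sumConfig n λ σ → f (a ∷ σ) i)

    sumConfig-comm : ∀ n m (f : Config q n → Config q m → Carrier) →
                     sumConfig n (λ σ → sumConfig m (f σ)) ≈ sumConfig m λ τ →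
                         sumConfig n λ σ → f σ τ
    sumConfig-comm n zero    f = refl
    sumConfig-comm n (suc m) f =
      trans (sumConfig-sum n λ σ a → sumConfig m λ τ → f σ (a ∷ τ))
            (sum-cong-≋ λ a → sumConfig-comm n m λ σ τ → f σ (a ∷ τ))

    sumConfig-nonNeg : ∀ n {f : Config q n → Carrier} → (∀ σ → 0# ≤ f σ) → 0# ≤ sumConfig n f
    sumConfig-nonNeg zero    h = h []
    sumConfig-nonNeg (suc n) h = sum-nonNeg λ a → sumConfig-nonNeg n λ σ → h (a ∷ σ)

    sumConfig-zero : ∀ n {f : Config q n → Carrier} → (∀ σ → f σ ≈ 0#) → sumConfig n f ≈ 0#
    sumConfig-zero zero    h = h []
    sumConfig-zero (suc n) h = sum-zero λ a → sumConfig-zero n λ σ → h (a ∷ σ)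

    sumConfig-single : ∀ n {f : Config q n → Carrier} σ → (∀ τ → τ ≢ σ → f τ ≈ 0#) →
        sumConfig n f ≈ f σ
    sumConfig-single zero    []      h = refl
    sumConfig-single (suc n) (a ∷ σ) h =
      trans (sum-single a λ b b≢a → sumConfig-zero n λ τ → h (b ∷ τ) λ { ≡.refl → b≢a ≡.refl })
            (sumConfig-single n σ λ τ τ≢σ → h (a ∷ τ) λ { ≡.refl → τ≢σ ≡.refl })

    term≤sumConfig : ∀ n {f : Config q n → Carrier} → (∀ σ → 0# ≤ f σ) → ∀ σ → f σ ≤ sumConfig n f
    term≤sumConfig zero    h []      = ≤-refl
    term≤sumConfig (suc n) h (a ∷ σ) =
      ≤-trans (term≤sumConfig n (λ τ → h (a ∷ τ)) σ)
              (term≤sum (λ b → sumConfig-nonNeg n λ τ → h (b ∷ τ)) a)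

    sumConfig-const : ∀ n x → sumConfig {q} n (λ _ → x) ≈ fromℕ q ^ n * x
    sumConfig-const zero    x = sym (*-identityˡ x)
    sumConfig-const (suc n) x = trans (sum-cong-≋ {q} λ _ → sumConfig-const n x)
      (trans (sum-const q _) (sym (*-assoc _ _ _)))

    sumConfig-ind : ∀ n σ (f : Config q n → Carrier) → sumConfig n (λ τ → ind (σ ≟ᶜ τ) * f τ) ≈ f σ
    sumConfig-ind n σ f = trans
      (sumConfig-single n σ λ τ τ≢σ → trans (*-congʳ (ind-no (σ ≟ᶜ τ) (τ≢σ ∘ ≡.sym))) (zeroˡ _))
      (trans (*-congʳ (ind-yes (σ ≟ᶜ σ) ≡.refl)) (*-identityˡ _))

    sumOver : ∀ {n} → Config q n → Subset n → (Config q n → Carrier) → Carrier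
    sumOver X S f = sumConfig ∣ S ∣ λ d → f (overwrite X S d)

    -- For T ⊆ S, the pairs (Y, Z) with Y equal to X off S and Z equal to Y off T form a symmetric
    -- relation, and the double sum visits each pair once. This exchange drives both the recolouring
    -- argument and reversibility.
    sumOver-swap : ∀ {n} (X : Config q n) (S T : Subset n) → T ⊆ S →
                   (H : Config q n → Config q n → Carrier) →
                   sumOver X S (λ Y → sumOver Y T (λ Z → H Y Z)) ≈
                   sumOver X S (λ Y → sumOver Y T (λ Z → H Z Y))
    sumOver-swap []      []            []            T⊆S H = refl
    sumOver-swap (x ∷ X) (outside ∷ S) (outside ∷ T) T⊆S H =
      sumOver-swap X S T (drop-∷-⊆ T⊆S) λ Y Z → H (x ∷ Y) (x ∷ Z)
    sumOver-swap (x ∷ X) (outside ∷ S) (inside  ∷ T) T⊆S H with T⊆S here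
    ... | ()
    sumOver-swap (x ∷ X) (inside  ∷ S) (outside ∷ T) T⊆S H =
      sum-cong-≋ λ a → sumOver-swap X S T (drop-∷-⊆ T⊆S) λ Y Z → H (a ∷ Y) (a ∷ Z)
    sumOver-swap {suc n} (x ∷ X) (inside ∷ S) (inside ∷ T) T⊆S H = begin-equality
      (sum λ a → sumOver X S λ Y → sum λ b → sumOver Y T λ Z → H (a ∷ Y) (b ∷ Z))
        ≈⟨ exchange H ⟩
      (sum λ a → sum λ b → sumOver X S λ Y → sumOver Y T λ Z → H (a ∷ Y) (b ∷ Z))
        ≈⟨ (sum-cong-≋ λ a → sum-cong-≋ λ b → sumOver-swap X S T (drop-∷-⊆ T⊆S) λ Y Z →
            H (a ∷ Y) (b ∷ Z)) ⟩
      (sum λ a → sum λ b → sumOver X S λ Y → sumOver Y T λ Z → H (a ∷ Z) (b ∷ Y))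
        ≈⟨ (∑-comm λ a b → sumOver X S λ Y → sumOver Y T λ Z → H (a ∷ Z) (b ∷ Y)) ⟩
      (sum λ b → sum λ a → sumOver X S λ Y → sumOver Y T λ Z → H (a ∷ Z) (b ∷ Y))
        ≈⟨ exchange (λ Y Z → H Z Y) ⟨
      (sum λ b → sumOver X S λ Y → sum λ a → sumOver Y T λ Z → H (a ∷ Z) (b ∷ Y)) ∎
      where
      exchange : (H : Config q (suc n) → Config q (suc n) → Carrier) →
        (sum λ a → sumOver X S λ Y → sum λ b → sumOver Y T λ Z → H (a ∷ Y) (b ∷ Z)) ≈
        (sum λ a → sum λ b → sumOver X S λ Y → sumOver Y T λ Z → H (a ∷ Y) (b ∷ Z))
      exchange H = sum-cong-≋ λ a → sumConfig-sum ∣ S ∣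
        λ d b → sumOver (overwrite X S d) T λ Z → H (a ∷ overwrite X S d) (b ∷ Z)

    sumOver-⊤ : ∀ {n} (X : Config q n) f → sumOver X ⊤ f ≈ sumConfig n f
    sumOver-⊤ []      f = refl
    sumOver-⊤ (x ∷ X) f = sum-cong-≋ λ a → sumOver-⊤ X λ Y → f (a ∷ Y)

-- Counting edges and walks

module _ {a} {A : Set a} where

  count-⊎ : ∀ {p q r} {P : Pred A p} {Q : Pred A q} {R : Pred A r}
            (P? : Decidable P) (Q? : Decidable Q) (R? : Decidable R) xs →
            (∀ {x} → x ∈ˡ xs → P x → Q x ⊎ R x) →
            length (filter P? xs) ℕ.≤ length (filter Q? xs) ℕ.+ length (filter R? xs)
  count-⊎ P? Q? R? []       h = ℕ.z≤n
  count-⊎ P? Q? R? (x ∷ xs) h with ih ← count-⊎ P? Q? R? xs (h ∘ there) | P? x | Q? x | R? x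
  ... | no _   | no _  | no _  = ih
  ... | no _   | yes _ | no _  = ℕ.m≤n⇒m≤1+n ih
  ... | no _   | no _  | yes _ = ℕ.≤-trans ih (ℕ.+-monoʳ-≤ _ (ℕ.n≤1+n _))
  ... | no _   | yes _ | yes _ = ℕ.m≤n⇒m≤1+n (ℕ.≤-trans ih (ℕ.+-monoʳ-≤ _ (ℕ.n≤1+n _)))
  ... | yes _  | yes _ | no _  = ℕ.s≤s ih
  ... | yes _  | yes _ | yes _ = ℕ.s≤s (ℕ.≤-trans ih (ℕ.+-monoʳ-≤ _ (ℕ.n≤1+n _)))
  ... | yes _  | no _  | yes _ = ℕ.≤-trans (ℕ.s≤s ih) (ℕ.≤-reflexive (≡.sym (ℕ.+-suc _ _)))
  ... | yes px | no ¬q | no ¬r with h (here ≡.refl) px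
  ...   | inj₁ qx = ⊥-elim (¬q qx)
  ...   | inj₂ rx = ⊥-elim (¬r rx)

  count-mono : ∀ {p q} {P : Pred A p} {Q : Pred A q} (P? : Decidable P) (Q? : Decidable Q) xs →
               (∀ {x} → x ∈ˡ xs → P x → Q x) →
               length (filter P? xs) ℕ.≤ length (filter Q? xs)
  count-mono P? Q? []       h = ℕ.z≤n
  count-mono P? Q? (x ∷ xs) h with ih ← count-mono P? Q? xs (h ∘ there) | P? x | Q? x
  ... | no _   | no _  = ih
  ... | no _   | yes _ = ℕ.m≤n⇒m≤1+n ih
  ... | yes _  | yes _ = ℕ.s≤s ih
  ... | yes px | no ¬q = ⊥-elim (¬q (h (here ≡.refl) px))

  count-cong : ∀ {p q} {P : Pred A p} {Q : Pred A q} (P? : Decidable P) (Q? : Decidable Q) xs →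
               (∀ {x} → x ∈ˡ xs → P x → Q x) → (∀ {x} → x ∈ˡ xs → Q x → P x) →
               length (filter P? xs) ≡ length (filter Q? xs)
  count-cong P? Q? xs h k = ℕ.≤-antisym (count-mono P? Q? xs h) (count-mono Q? P? xs k)

  count-strict : ∀ {p q} {P : Pred A p} {Q : Pred A q} (P? : Decidable P) (Q? : Decidable Q) xs →
                 (∀ {x} → x ∈ˡ xs → P x → Q x) → ∀ {x} → x ∈ˡ xs → Q x → ¬ P x →
                 length (filter P? xs) ℕ.< length (filter Q? xs)
  count-strict P? Q? (x ∷ xs) h (here ≡.refl) qx ¬px
    with le ← count-mono P? Q? xs (h ∘ there) | P? x | Q? x
  ... | yes px | _     = ⊥-elim (¬px px)
  ... | no _   | yes _ = ℕ.s≤s le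
  ... | no _   | no ¬q = ⊥-elim (¬q qx)
  count-strict P? Q? (x ∷ xs) h (there y∈xs) qy ¬py
    with ih ← count-strict P? Q? xs (h ∘ there) y∈xs qy ¬py | P? x | Q? x
  ... | no _   | no _  = ih
  ... | no _   | yes _ = ℕ.m≤n⇒m≤1+n ih
  ... | yes _  | yes _ = ℕ.s≤s ih
  ... | yes px | no ¬q = ⊥-elim (¬q (h (here ≡.refl) px))

  count-split : ∀ {p q} {P : Pred A p} {Q : Pred A q} (P? : Decidable P) (Q? : Decidable Q) xs →
                length (filter P? xs) ≡ length (filter (λ x → P? x ×-dec Q? x) xs) ℕ.+
                                        length (filter (λ x → P? x ×-dec ¬? (Q? x)) xs)
  count-split P? Q? []       = ≡.refl
  count-split P? Q? (x ∷ xs) with ih ← count-split P? Q? xs | P? x | Q? x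
  ... | no _  | _     = ih
  ... | yes _ | yes _ = ≡.cong suc ih
  ... | yes _ | no _  = ≡.trans (≡.cong suc ih) (≡.sym (ℕ.+-suc _ _))

  -- Pigeonhole by deleting `f x` from the target: injectivity keeps the other images, and the
  -- filtered list is strictly shorter.
  length-injection : ∀ {b} {B : Set b} (_≟_ : DecidableEquality B) (f : A → B) {xs} ys → Unique xs →
                     (∀ {x} → x ∈ˡ xs → f x ∈ˡ ys) →
                     (∀ {x y} → x ∈ˡ xs → y ∈ˡ xs → f x ≡ f y → x ≡ y) →
                     length xs ℕ.≤ length ys
  length-injection _≟_ f {[]}     ys _                 into inj = ℕ.z≤n
  length-injection _≟_ f {x ∷ xs} ys (x∉xs ∷ unique) into inj =
    ℕ.≤-trans (ℕ.s≤s (length-injection _≟_ f (filter ≢fx? ys) unique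
                (λ y∈xs → ∈-filter⁺ ≢fx? (into (there y∈xs))
                  λ fy≡fx → All.lookup x∉xs y∈xs (≡.sym (inj (there y∈xs) (here ≡.refl) fy≡fx)))
                (λ y∈xs z∈xs → inj (there y∈xs) (there z∈xs))))
              (filter-notAll ≢fx? ys (Any.map (λ { ≡.refl ≢fx → ≢fx ≡.refl }) (into (here ≡.refl))))
    where
    ≢fx? = λ y → ¬? (y ≟ f x)

-- Subsets and overwritten configurations.

∣p∪⁅x⁆∣≡1+∣p∣ : ∀ {n} {x : Fin n} (p : Subset n) → x ∉ p → ∣ p ∪ ⁅ x ⁆ ∣ ≡ suc ∣ p ∣
∣p∪⁅x⁆∣≡1+∣p∣ {x = zero}  (inside  ∷ p) x∉p = ⊥-elim (x∉p here)
∣p∪⁅x⁆∣≡1+∣p∣ {x = zero}  (outside ∷ p) x∉p = ≡.cong (suc ∘ ∣_∣) (∪-identityʳ p)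
∣p∪⁅x⁆∣≡1+∣p∣ {x = suc x} (inside  ∷ p) x∉p = ≡.cong suc (∣p∪⁅x⁆∣≡1+∣p∣ p (x∉p ∘ there))
∣p∪⁅x⁆∣≡1+∣p∣ {x = suc x} (outside ∷ p) x∉p = ∣p∪⁅x⁆∣≡1+∣p∣ p (x∉p ∘ there)

x∉p-x : ∀ {n} {x : Fin n} (p : Subset n) → x ∉ p ∖ x
x∉p-x {x = zero}  (inside  ∷ p) ()
x∉p-x {x = zero}  (outside ∷ p) ()
x∉p-x {x = suc x} (_ ∷ p) (there x∈) = x∉p-x p x∈

module _ {q : ℕ} where

  lookup-overwrite-∉ : ∀ {n} (X : Config q n) S c {x} → x ∉ S →
      lookup (overwrite X S c) x ≡ lookup X x
  lookup-overwrite-∉ (x ∷ X) (inside  ∷ S) (a ∷ c) {zero}  x∉S = ⊥-elim (x∉S here)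
  lookup-overwrite-∉ (x ∷ X) (outside ∷ S) c       {zero}  x∉S = ≡.refl
  lookup-overwrite-∉ (x ∷ X) (inside  ∷ S) (a ∷ c) {suc y} x∉S = lookup-overwrite-∉ X S c
      (x∉S ∘ there)
  lookup-overwrite-∉ (x ∷ X) (outside ∷ S) c       {suc y} x∉S = lookup-overwrite-∉ X S c
      (x∉S ∘ there)

  overwrite-update-∉ : ∀ {n} (X : Config q n) S c {v} a → v ∉ S →
                       overwrite (X [ v ]≔ a) S c ≡ overwrite X S c [ v ]≔ a
  overwrite-update-∉ (x ∷ X) (inside  ∷ S) (b ∷ c) {zero}  a v∉S = ⊥-elim (v∉S here)
  overwrite-update-∉ (x ∷ X) (outside ∷ S) c       {zero}  a v∉S = ≡.refl
  overwrite-update-∉ (x ∷ X) (inside  ∷ S) (b ∷ c) {suc v} a v∉S = ≡.cong (b ∷_)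
      (overwrite-update-∉ X S c a (v∉S ∘ there))
  overwrite-update-∉ (x ∷ X) (outside ∷ S) c       {suc v} a v∉S = ≡.cong (x ∷_)
      (overwrite-update-∉ X S c a (v∉S ∘ there))

  overwrite-update-∈ : ∀ {n} (X : Config q n) {S} c {v} a → v ∈ S →
                       overwrite (X [ v ]≔ a) S c ≡ overwrite X S c
  overwrite-update-∈ (x ∷ X)               (b ∷ c) a here        = ≡.refl
  overwrite-update-∈ (x ∷ X) {inside  ∷ S} (b ∷ c) a (there v∈S) = ≡.cong (b ∷_)
      (overwrite-update-∈ X c a v∈S)
  overwrite-update-∈ (x ∷ X) {outside ∷ S} c       a (there v∈S) = ≡.cong (x ∷_)
      (overwrite-update-∈ X c a v∈S)

  overwrite-idem : ∀ {n} (X : Config q n) S c d → overwrite (overwrite X S c) S d ≡ overwrite X S d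
  overwrite-idem []      []            c       d       = ≡.refl
  overwrite-idem (x ∷ X) (inside  ∷ S) (a ∷ c) (b ∷ d) = ≡.cong (b ∷_) (overwrite-idem X S c d)
  overwrite-idem (x ∷ X) (outside ∷ S) c       d       = ≡.cong (x ∷_) (overwrite-idem X S c d)

  overwrite-constant : ∀ {n} (X : Config q n) S c a →
                       (∀ x → x ∈ S → lookup (overwrite X S c) x ≡ a) → c ≡ Vec.replicate ∣ S ∣ a
  overwrite-constant []      []            []      a h = ≡.refl
  overwrite-constant (x ∷ X) (inside  ∷ S) (b ∷ c) a h =
    ≡.cong₂ _∷_ (h zero here) (overwrite-constant X S c a λ y y∈S → h (suc y) (there y∈S))
  overwrite-constant (x ∷ X) (outside ∷ S) c       a h =
    overwrite-constant X S c a λ y y∈S → h (suc y) (there y∈S)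

-- Edges meeting a set, and walks inside a connected set.

module _ {n : ℕ} (G : SimpleGraph n) where
  open SimpleGraph G

  Δ : ℕ
  Δ = maxDegree G

  degree≤Δ : ∀ v → degree G v ℕ.≤ Δ
  degree≤Δ v = All.lookup (xs≤max 0 (List.map (degree G) (allFin n)))
      (∈-map⁺ (degree G) (∈-allFin v))

  edge-∈ : ∀ {u v} → Adj u v → (u , v) ∈ˡ edges G ⊎ (v , u) ∈ˡ edges G
  edge-∈ {u} {v} uv with Fin.<-cmp u v
  ... | tri< u<v _ _    = inj₁ (∈-filter⁺ _ (∈-cartesianProduct⁺ (∈-allFin u) (∈-allFin v))
      (u<v , uv))
  ... | tri≈ _ ≡.refl _ = ⊥-elim (irrefl uv)
  ... | tri> _ _ v<u    = inj₂ (∈-filter⁺ _ (∈-cartesianProduct⁺ (∈-allFin v) (∈-allFin u))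
      (v<u , adj-sym uv))

  edge⁻ : ∀ {u v} → (u , v) ∈ˡ edges G → u Fin.< v × Adj u v
  edge⁻ e∈ = proj₂ (∈-filter⁻ _ {xs = List.cartesianProduct (allFin n) (allFin n)} e∈)

  meeting : ℕ → Subset n → ℕ
  meeting q T = length (filter (meets? G {q} T) (edges G))

  module _ (q : ℕ) where

    -- An edge at x is sent to its other endpoint. This is injective because an edge is listed with
    -- its smaller endpoint first, so (x , y) and (y , x) are never both present.
    meeting-⁅⁆ : ∀ x → meeting q ⁅ x ⁆ ℕ.≤ degree G x
    meeting-⁅⁆ x = length-injection Fin._≟_ other (filter (adj? x) (allFin n))
        (Unique.filter⁺ _ (Unique.filter⁺ _
            (Unique.cartesianProduct⁺ (Unique.allFin⁺ n) (Unique.allFin⁺ n))))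
        (λ {e} → into {e}) (λ {e} {e′} → inj {e} {e′})
      where
      E = filter (meets? G {q} ⁅ x ⁆) (edges G)
      other : Fin n × Fin n → Fin n
      other (u , v) with u Fin.≟ x
      ... | yes _ = v
      ... | no _  = u
      view : ∀ {e} → e ∈ˡ E → Σ (Fin n) λ y → other e ≡ y × Adj x y ×
             ((x Fin.< y × e ≡ (x , y)) ⊎ (y Fin.< x × e ≡ (y , x)))
      view {u , v} e∈ with ∈-filter⁻ (meets? G {q} ⁅ x ⁆) {xs = edges G} e∈
      ... | e∈E , meets with edge⁻ e∈E
      ... | u<v , uv with u Fin.≟ x | meets
      ... | yes ≡.refl | _       = v , ≡.refl , uv , inj₁ (u<v , ≡.refl)
      ... | no u≢x     | inj₁ u∈ = ⊥-elim (u≢x (x∈⁅y⁆⇒x≡y x u∈))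
      ... | no u≢x     | inj₂ v∈ with x∈⁅y⁆⇒x≡y x v∈
      ... | ≡.refl = u , ≡.refl , adj-sym uv , inj₂ (u<v , ≡.refl)
      into : ∀ {e} → e ∈ˡ E → other e ∈ˡ filter (adj? x) (allFin n)
      into {e} e∈ with view {e} e∈
      ... | y , eq , xy , _ = ≡.subst (_∈ˡ _) (≡.sym eq) (∈-filter⁺ (adj? x) (∈-allFin y) xy)
      inj : ∀ {e e′} → e ∈ˡ E → e′ ∈ˡ E → other e ≡ other e′ → e ≡ e′
      inj {e} {e′} e∈ e′∈ eq with view {e} e∈ | view {e′} e′∈
      ... | y , o , _ , s | y′ , o′ , _ , s′ with ≡.trans (≡.sym o) (≡.trans eq o′)
      inj _ _ _ | y , _ , _ , inj₁ (_ , ≡.refl)   | _ , _ , _ , inj₁ (_ , ≡.refl)   | ≡.refl =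
          ≡.refl
      inj _ _ _ | y , _ , _ , inj₂ (_ , ≡.refl)   | _ , _ , _ , inj₂ (_ , ≡.refl)   | ≡.refl =
          ≡.refl
      inj _ _ _ | y , _ , _ , inj₁ (x<y , ≡.refl) | _ , _ , _ , inj₂ (y<x , ≡.refl) | ≡.refl =
          ⊥-elim (Fin.<-asym x<y y<x)
      inj _ _ _ | y , _ , _ , inj₂ (y<x , ≡.refl) | _ , _ , _ , inj₁ (x<y , ≡.refl) | ≡.refl =
          ⊥-elim (Fin.<-asym x<y y<x)

    -- Among the at most Δ edges at x, the one to y already meets T. Iterated from a single vertex,
    -- this gives the bound (Δ - 1)t + 1 for connected sets.
    meeting-∪ : ∀ {T x y} → x ∉ T → y ∈ T → Adj y x →
                meeting q (T ∪ ⁅ x ⁆) ℕ.≤ meeting q T ℕ.+ (Δ ℕ.∸ 1)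
    meeting-∪ {T} {x} {y} x∉T y∈T yx = ℕ.≤-trans
        (count-⊎ (meets? G {q} (T ∪ ⁅ x ⁆)) (meets? G {q} T) new? (edges G) λ _ → split)
        (ℕ.+-monoʳ-≤ (meeting q T)
            (ℕ.≤-trans (ℕ.∸-monoˡ-≤ 1 new<)
            (ℕ.∸-monoˡ-≤ 1 (ℕ.≤-trans (meeting-⁅⁆ x) (degree≤Δ x)))))
      where
      new? = λ e → meets? G {q} ⁅ x ⁆ e ×-dec ¬? (meets? G {q} T e)
      split : ∀ {e} → Meets G {q} (T ∪ ⁅ x ⁆) e →
          Meets G {q} T e ⊎ (Meets G {q} ⁅ x ⁆ e × ¬ Meets G {q} T e)
      split {e} m with meets? G {q} T e
      split m        | yes t = inj₁ t
      split (inj₁ u) | no ¬t with x∈p∪q⁻ T ⁅ x ⁆ u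
      ... | inj₁ u∈T = ⊥-elim (¬t (inj₁ u∈T))
      ... | inj₂ u∈x = inj₂ (inj₁ u∈x , ¬t)
      split (inj₂ v) | no ¬t with x∈p∪q⁻ T ⁅ x ⁆ v
      ... | inj₁ v∈T = ⊥-elim (¬t (inj₂ v∈T))
      ... | inj₂ v∈x = inj₂ (inj₂ v∈x , ¬t)
      new< : length (filter new? (edges G)) ℕ.< meeting q ⁅ x ⁆
      new< with edge-∈ yx
      ... | inj₁ e∈ = count-strict new? (meets? G {q} ⁅ x ⁆) (edges G) (λ _ → proj₁) e∈
          (inj₂ (x∈⁅x⁆ x)) λ (_ , ¬t) → ¬t (inj₁ y∈T)
      ... | inj₂ e∈ = count-strict new? (meets? G {q} ⁅ x ⁆) (edges G) (λ _ → proj₁) e∈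
          (inj₁ (x∈⁅x⁆ x)) λ (_ , ¬t) → ¬t (inj₂ y∈T)

  data Walk : ℕ → Fin n → Fin n → Set where
    stop : ∀ {u} → Walk zero u u
    step : ∀ {j u z w} → Adj u z → Walk j z w → Walk (suc j) u w

  -- Cutting a path at its last visit to u.
  last-exit : ∀ {S u x w} → Star (InducedAdj G S) x w →
              Star (InducedAdj G (S ∖ u)) x w ⊎ (u ≡ w) ⊎
              ∃ λ z → Adj u z × z ∈ S ∖ u × Star (InducedAdj G (S ∖ u)) z w
  last-exit nil = inj₁ nil
  last-exit {S} {u} {x} {w} (_◅_ {j = y} (x∈S , y∈S , xy) path) with last-exit {u = u} path
  ... | inj₂ exit = inj₂ exit
  ... | inj₁ path′ with x Fin.≟ u | y Fin.≟ u
  ...   | yes ≡.refl | yes ≡.refl = ⊥-elim (irrefl xy)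
  ...   | yes ≡.refl | no y≢u     = inj₂ (inj₂ (y , xy , x∈p∧x≢y⇒x∈p-y y∈S y≢u , path′))
  ...   | no x≢u     | no y≢u     = inj₁
      ((x∈p∧x≢y⇒x∈p-y x∈S x≢u , x∈p∧x≢y⇒x∈p-y y∈S y≢u , xy) ◅ path′)
  ...   | no x≢u     | yes ≡.refl with path′
  ...     | nil               = inj₂ (inj₁ ≡.refl)
  ...     | (y∈S-y , _) ◅ _ = ⊥-elim (x∉p-x S y∈S-y)

  -- After the last visit to u the path stays in S without u, so each step of the walk uses up a
  -- vertex of S. Hence the walk has fewer steps than S has vertices.
  short-walk : ∀ s {S u w} → ∣ S ∣ ℕ.≤ s → u ∈ S → Star (InducedAdj G S) u w →
               ∃ λ j → j ℕ.< s × Walk j u w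
  short-walk zero    {S} {u} ∣S∣≤0 u∈S path with ℕ.<-≤-trans (x∈p⇒∣p-x∣<∣p∣ u∈S) ∣S∣≤0
  ... | ()
  short-walk (suc s) {S} {u} ∣S∣≤s u∈S path with last-exit {u = u} path
  ... | inj₁ nil              = zero , ℕ.z<s , stop
  ... | inj₁ ((u∈S-u , _) ◅ _) = ⊥-elim (x∉p-x S u∈S-u)
  ... | inj₂ (inj₁ ≡.refl)    = zero , ℕ.z<s , stop
  ... | inj₂ (inj₂ (z , uz , z∈ , path′))
    with short-walk s (ℕ.≤-pred (ℕ.<-≤-trans (x∈p⇒∣p-x∣<∣p∣ u∈S) ∣S∣≤s)) z∈ path′
  ...   | j , j<s , walk = suc j , ℕ.s≤s j<s , step uz walk

  crossing : ∀ {S T u y} → Star (InducedAdj G S) u y → u ∈ T → y ∉ T →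
             ∃ λ x → x ∈ S × x ∉ T × ∃ λ z → z ∈ T × Adj z x
  crossing nil u∈T y∉T = ⊥-elim (y∉T u∈T)
  crossing {T = T} {u} (_◅_ {j = x} (_ , x∈S , ux) path) u∈T y∉T with x ∈? T
  ... | yes x∈T = crossing path x∈T y∉T
  ... | no x∉T  = x , x∈S , x∉T , u , u∈T , ux

module Walks {c ℓ₁ ℓ₂} (ℝ : CompleteOrderedField c ℓ₁ ℓ₂) {n : ℕ} (G : SimpleGraph n) where
  open OrderedField ℝ
  open FiniteSums ℝ
  open ≤R
  open SimpleGraph G

  -- The entries of the powers of the adjacency matrix, as field elements so that they can be summed
  -- together with indicators.
  walks : ℕ → Fin n → Fin n → Carrier
  walks zero    u w = ind (u Fin.≟ w)
  walks (suc j) u w = sum λ z → ind (adj? u z) * walks j z w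

  walks-nonNeg : ∀ j u w → 0# ≤ walks j u w
  walks-nonNeg zero    u w = ind-nonNeg (u Fin.≟ w)
  walks-nonNeg (suc j) u w = sum-nonNeg λ z → *-nonNeg (ind-nonNeg (adj? u z)) (walks-nonNeg j z w)

  1≤walks : ∀ {j u w} → Walk G j u w → 1# ≤ walks j u w
  1≤walks {u = u} stop = ≈⇒≤ (sym (ind-yes (u Fin.≟ u) ≡.refl))
  1≤walks {suc j} {u} {w} (step {z = z} uz walk) = begin
    1#                              ≤⟨ 1≤walks walk ⟩
    walks j z w                     ≈⟨ trans (*-congʳ (ind-yes (adj? u z) uz)) (*-identityˡ _) ⟨
    ind (adj? u z) * walks j z w
        ≤⟨ term≤sum (λ y → *-nonNeg (ind-nonNeg (adj? u y)) (walks-nonNeg j y w)) z ⟩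
    walks (suc j) u w               ∎

  sum-adj≤Δ : ∀ u → sum (λ z → ind (adj? u z)) ≤ fromℕ (Δ G)
  sum-adj≤Δ u = ≤-trans (≈⇒≤ (sym (sum-ind-tabulate (adj? u) id))) (fromℕ-mono (degree≤Δ G u))

  sum-adj-* : ∀ {f : Fin n → Carrier} {x} → (∀ z → f z ≤ x) → 0# ≤ x → ∀ u →
              sum (λ z → ind (adj? u z) * f z) ≤ fromℕ (Δ G) * x
  sum-adj-* {f} {x} h 0≤x u = begin
    sum (λ z → ind (adj? u z) * f z)  ≤⟨ sum-mono (λ z → *-monoʳ-≤ (ind-nonNeg (adj? u z)) (h z)) ⟩
    sum (λ z → ind (adj? u z) * x)    ≈⟨ *-distribʳ-sum x (λ z → ind (adj? u z)) ⟨
    sum (λ z → ind (adj? u z)) * x    ≤⟨ *-monoˡ-≤ 0≤x (sum-adj≤Δ u) ⟩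
    fromℕ (Δ G) * x                   ∎

  sum-walks≤ : ∀ j u → sum (walks j u) ≤ fromℕ (Δ G) ^ j
  sum-walks≤ zero u = ≈⇒≤ (trans (sum-single u λ w w≢u → ind-no (u Fin.≟ w) (w≢u ∘ ≡.sym))
                                 (ind-yes (u Fin.≟ u) ≡.refl))
  sum-walks≤ (suc j) u = begin
    sum (λ w → sum λ z → ind (adj? u z) * walks j z w)
        ≈⟨ ∑-comm (λ w z → ind (adj? u z) * walks j z w) ⟩
    sum (λ z → sum λ w → ind (adj? u z) * walks j z w)
        ≈⟨ sum-cong-≋ (λ z → *-distribˡ-sum (ind (adj? u z)) (walks j z)) ⟨
    sum (λ z → ind (adj? u z) * sum (walks j z))
        ≤⟨ sum-adj-* (sum-walks≤ j) (^-nonNeg (0≤fromℕ (Δ G)) j) u ⟩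
    fromℕ (Δ G) ^ suc j                                ∎

  module _ {k : ℕ} (𝒮 : BlockSystem G k) (1≤Δ : 1 ℕ.≤ Δ G) where
    open BlockSystem 𝒮

    -- A block is connected, has k vertices and contains its index w, so a member u reaches w in
    -- fewer than k steps. This bounds the number of blocks through u even though blocks may repeat:
    -- they are distinguished by the endpoint w.
    ind-block≤walks : ∀ w u → ind (u ∈? block w) ≤ sum {k} λ j → walks (Fin.toℕ j) u w
    ind-block≤walks w u with u ∈? block w
    ... | no _   = sum-nonNeg {k} λ j → walks-nonNeg (Fin.toℕ j) u w
    ... | yes u∈ with short-walk G k (ℕ.≤-reflexive (block-size w)) u∈
        (block-connected w u w u∈ (block-∋ w))
    ...   | j , j<k , walk = begin
      1#                                    ≤⟨ 1≤walks walk ⟩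
      walks j u w
          ≈⟨ reflexive (≡.cong (λ i → walks i u w) (Fin.toℕ-fromℕ< j<k)) ⟨
      walks (Fin.toℕ (Fin.fromℕ< j<k)) u w
          ≤⟨ term≤sum {k} (λ i → walks-nonNeg (Fin.toℕ i) u w) (Fin.fromℕ< j<k) ⟩
      (sum {k} λ j → walks (Fin.toℕ j) u w)  ∎

    Δ^<k : ∀ (j : Fin k) → fromℕ (Δ G) ^ suc (Fin.toℕ j) ≤ fromℕ (Δ G) ^ k
    Δ^<k j = ^-monoʳ-≤ (≤-trans (≈⇒≤ (sym (+-identityʳ 1#))) (fromℕ-mono 1≤Δ)) (Fin.toℕ<n j)

    -- A neighbour u of v followed by a walk of length j < k from u to w is a walk of length j + 1 ≤
    -- k from v. There are at most Δ^(j+1) ≤ Δ^k of these for each of the k values of j.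
    sum-neighbours-in-blocks : ∀ v → sum (λ w → sum λ u → ind (adj? v u) * ind (u ∈? block w)) ≤
                               fromℕ k * fromℕ (Δ G) ^ k
    sum-neighbours-in-blocks v = begin
      sum (λ w → sum λ u → ind (adj? v u) * ind (u ∈? block w))
        ≤⟨ sum-mono (λ w → sum-mono λ u → *-monoʳ-≤ (ind-nonNeg (adj? v u)) (ind-block≤walks w u)) ⟩
      sum (λ w → sum λ u → ind (adj? v u) * sum {k} λ j → walks (Fin.toℕ j) u w)
        ≈⟨ sum-cong-≋ (λ w → sum-cong-≋ λ u → *-distribˡ-sum {k} (ind (adj? v u)) λ j →
            walks (Fin.toℕ j) u w) ⟩
      sum (λ w → sum λ u → sum {k} λ j → ind (adj? v u) * walks (Fin.toℕ j) u w)
        ≈⟨ sum-cong-≋ (λ w → ∑-comm {n} {k} λ u j → ind (adj? v u) * walks (Fin.toℕ j) u w) ⟩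
      sum (λ w → sum {k} λ j → walks (suc (Fin.toℕ j)) v w)
        ≈⟨ ∑-comm {n} {k} (λ w j → walks (suc (Fin.toℕ j)) v w) ⟩
      (sum {k} λ j → sum (walks (suc (Fin.toℕ j)) v))
        ≤⟨ sum-mono {k} (λ j → ≤-trans (sum-walks≤ (suc (Fin.toℕ j)) v) (Δ^<k j)) ⟩
      (sum {k} λ _ → fromℕ (Δ G) ^ k)
        ≈⟨ sum-const k _ ⟩
      fromℕ k * fromℕ (Δ G) ^ k ∎

-- The probability of a colour in a block

module ColourBound {c ℓ₁ ℓ₂} (ℝ : CompleteOrderedField c ℓ₁ ℓ₂)
                   {n : ℕ} (G : SimpleGraph n) (q : ℕ) (lam : CompleteOrderedField.Carrier ℝ) where
  open OrderedField ℝ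
  open FiniteSums ℝ
  open ≤R
  open SimpleGraph G

  mono-meeting : Config q n → Subset n → ℕ
  mono-meeting Y S = length (filter (λ e → mono? G Y e ×-dec meets? G {q} S e) (edges G))

  -- On `overwrite X S c` this is by definition lam to the power `μ-block G X S c`. Seen as a
  -- function of the whole configuration, it can be evaluated after recolouring a part of S.
  weight : Subset n → Config q n → Carrier
  weight S Y = lam ^ mono-meeting Y S

  module _ (1≤lam : 1# ≤ lam) where

    0≤lam : 0# ≤ lam
    0≤lam = ≤-trans 0≤1 1≤lam

    weight-pos : ∀ S Y → 0# < weight S Y
    weight-pos S Y = 1≤⇒0< (1≤x^ 1≤lam (mono-meeting Y S))

    weight-nonNeg : ∀ S Y → 0# ≤ weight S Y
    weight-nonNeg S Y = proj₁ (weight-pos S Y)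

    module _ (a : Fin q) where

      AllColoured : Subset n → Config q n → Set
      AllColoured T Y = ∀ x → x ∈ T → lookup Y x ≡ a

      allColoured? : ∀ T Y → Dec (AllColoured T Y)
      allColoured? T Y = Fin.all? λ x → (x ∈? T) →-dec (lookup Y x Fin.≟ a)

      -- Resampling a set T that is entirely coloured a loses at most the monochromatic edges meeting T,
      -- while the original configuration can be recovered from the resampled one.
      resample : ∀ {S T} X M {p} {B : Config q n → Set p} (B? : ∀ Y → Dec (B Y)) → T ⊆ S →
                 (∀ Y → B Y → AllColoured T Y × mono-meeting Y T ℕ.≤ M) →
                 fromℕ q ^ ∣ T ∣ * sumOver X S (λ Y → weight S Y * ind (B? Y)) ≤
                 lam ^ M * sumOver X S (weight S)
      resample {S} {T} X M {B = B} B? T⊆S hB = begin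
        fromℕ q ^ ∣ T ∣ * sumOver X S (λ Y → weight S Y * ind (B? Y))
          ≈⟨ *-distribˡ-sumConfig ∣ S ∣ (fromℕ q ^ ∣ T ∣)
              (λ d → weight S (overwrite X S d) * ind (B? (overwrite X S d))) ⟩
        sumOver X S (λ Y → fromℕ q ^ ∣ T ∣ * (weight S Y * ind (B? Y)))
          -- q^|T| counts the recolourings Z of T, so the factor turns into a sum over Z.
          ≈⟨ sumConfig-cong ∣ S ∣ (λ d →
              sumConfig-const ∣ T ∣ (weight S (overwrite X S d) * ind (B? (overwrite X S d)))) ⟨
        sumOver X S (λ Y → sumOver Y T λ Z → weight S Y * ind (B? Y))
          ≤⟨ sumConfig-mono ∣ S ∣ (λ d → sumConfig-mono ∣ T ∣ λ e → pointwise (overwrite X S d) e) ⟩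
        sumOver X S (λ Y → sumOver Y T λ Z → lam ^ M * weight S Z * ind (B? Y))
          -- After the exchange the weight belongs to the outer configuration, and the inner sum
          -- counts those recolourings of T that satisfy `B`; only the one that is constantly `a`
          -- can.
          ≈⟨ sumOver-swap X S T T⊆S (λ Y Z → lam ^ M * weight S Z * ind (B? Y)) ⟩
        sumOver X S (λ Y → sumOver Y T λ Z → lam ^ M * weight S Y * ind (B? Z))
          ≈⟨ sumConfig-cong ∣ S ∣ (λ d →
              *-distribˡ-sumConfig ∣ T ∣ (lam ^ M * weight S (overwrite X S d)) λ e →
              ind (B? (overwrite (overwrite X S d) T e))) ⟨
        sumOver X S (λ Y → lam ^ M * weight S Y * sumOver Y T λ Z → ind (B? Z))
          ≤⟨ sumConfig-mono ∣ S ∣ (λ d →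
              *-monoʳ-≤ (*-nonNeg (^-nonNeg 0≤lam M) (weight-nonNeg S (overwrite X S d)))
              (at-most-one (overwrite X S d))) ⟩
        sumOver X S (λ Y → lam ^ M * weight S Y * 1#)
          ≈⟨ sumConfig-cong ∣ S ∣ (λ d → *-identityʳ _) ⟩
        sumOver X S (λ Y → lam ^ M * weight S Y)
          ≈⟨ *-distribˡ-sumConfig ∣ S ∣ (lam ^ M) (λ d → weight S (overwrite X S d)) ⟨
        lam ^ M * sumOver X S (weight S) ∎
        where
        at-most-one : ∀ Y → sumOver Y T (λ Z → ind (B? Z)) ≤ 1#
        at-most-one Y = ≤-trans (≈⇒≤ (sumConfig-single ∣ T ∣ (Vec.replicate ∣ T ∣ a) λ d d≢ →
            ind-no (B? (overwrite Y T d)) λ b → d≢ (overwrite-constant Y T d a (proj₁ (hB _ b)))))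
          (ind-≤1 (B? _))

        loss : ∀ Y d → B Y → mono-meeting Y S ℕ.≤ M ℕ.+ mono-meeting (overwrite Y T d) S
        loss Y d b = ℕ.≤-trans
          (count-⊎ (λ e → mono? G Y e ×-dec meets? G {q} S e)
                   (λ e → mono? G Y e ×-dec meets? G {q} T e)
                   (λ e → mono? G (overwrite Y T d) e ×-dec meets? G {q} S e) (edges G) λ {e} _ →
                       split e)
          (ℕ.+-monoˡ-≤ _ (proj₂ (hB Y b)))
          where
          split : ∀ e → Mono G Y e × Meets G {q} S e →
                  (Mono G Y e × Meets G {q} T e) ⊎ (Mono G (overwrite Y T d) e × Meets G {q} S e)
          split (u , v) (m , s) with u ∈? T | v ∈? T
          ... | yes u∈T | _       = inj₁ (m , inj₁ u∈T)
          ... | no _    | yes v∈T = inj₁ (m , inj₂ v∈T)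
          ... | no u∉T  | no v∉T  = inj₂ (≡.trans (lookup-overwrite-∉ Y T d u∉T)
                                      (≡.trans m (≡.sym (lookup-overwrite-∉ Y T d v∉T))) , s)

        pointwise : ∀ Y d → weight S Y * ind (B? Y) ≤ lam ^ M * weight S
            (overwrite Y T d) * ind (B? Y)
        pointwise Y d with B? Y
        ... | no _  = ≈⇒≤ (trans (zeroʳ _) (sym (zeroʳ _)))
        ... | yes b = *-monoˡ-≤ 0≤1 (begin
          lam ^ mono-meeting Y S                                 ≤⟨ ^-monoʳ-≤ 1≤lam (loss Y d b) ⟩
          lam ^ (M ℕ.+ mono-meeting (overwrite Y T d) S)         ≈⟨ ^-homo-* lam M _ ⟩
          lam ^ M * weight S (overwrite Y T d)                   ∎)

      -- r bounds, up to a factor 2, the probability of a colour at a vertex of S. The first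
      -- estimate is for monochromatic components smaller than S, the second for S itself.
      module _ {S : Subset n} (connected : InducedConnected G S) (X : Config q n)
               {r : Carrier} (0≤r : 0# ≤ r) (1≤q : 1 ℕ.≤ q)
               (component : ∀ t → lam ^ ((Δ G ℕ.∸ 1) ℕ.* t) ≤ fromℕ q ^ t * r ^ t)
               (component-S : lam ^ ((Δ G ℕ.∸ 1) ℕ.* ∣ S ∣ ℕ.+ 1) ≤ fromℕ q ^ ∣ S ∣ * r ^ ∣ S ∣)
               (2kr≤1 : fromℕ 2 * (fromℕ ∣ S ∣ * r) ≤ 1#) where

        Z : Carrier
        Z = sumOver X S (weight S)

        0≤Z : 0# ≤ Z
        0≤Z = sumConfig-nonNeg ∣ S ∣ λ d → weight-nonNeg S (overwrite X S d)

        0<q : 0# < fromℕ q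
        0<q = 1≤⇒0< (≤-trans (≈⇒≤ (sym (+-identityʳ 1#))) (fromℕ-mono 1≤q))

        Frontier : Subset n → Fin n → Set
        Frontier T x = x ∈ S × x ∉ T × ∃ λ y → y ∈ T × Adj y x

        frontier? : ∀ T x → Dec (Frontier T x)
        frontier? T x = (x ∈? S) ×-dec (¬? (x ∈? T) ×-dec Fin.any? λ y → (y ∈? T) ×-dec adj? y x)

        -- For a connected T inside S, this says that T is a component of the set of vertices of S
        -- coloured `a`.
        Isolated : Subset n → Config q n → Set
        Isolated T Y = AllColoured T Y × ¬ (∃ λ x → Frontier T x × lookup Y x ≡ a)

        isolated? : ∀ T Y → Dec (Isolated T Y)
        isolated? T Y = allColoured? T Y ×-dec ¬?
            (Fin.any? λ x → frontier? T x ×-dec (lookup Y x Fin.≟ a))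

        mass : Subset n → Carrier
        mass T = sumOver X S λ Y → weight S Y * ind (allColoured? T Y)

        -- If T misses a vertex of S, connectivity of S yields an edge from T to its frontier;
        -- isolation makes it bichromatic, which removes the +1 from the edge count. If T is all of
        -- S there is no such edge, and `component-S` pays for the extra factor lam.
        mass-isolated : ∀ {T u} → u ∈ T → T ⊆ S → meeting G q T ℕ.≤ (Δ G ℕ.∸ 1) ℕ.* ∣ T ∣ ℕ.+ 1 →
                        sumOver X S (λ Y → weight S Y * ind (isolated? T Y)) ≤ r ^ ∣ T ∣ * Z
        mass-isolated {T} {u} u∈T T⊆S meeting≤ with Fin.any? (λ y → (y ∈? S) ×-dec ¬? (y ∈? T))
        ... | yes (y , y∈S , y∉T) = *-cancelˡ-≤ (^-pos 0<q ∣ T ∣) (begin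
            fromℕ q ^ ∣ T ∣ * sumOver X S (λ Y → weight S Y * ind (isolated? T Y))
              ≤⟨ resample X ((Δ G ℕ.∸ 1) ℕ.* ∣ T ∣) (isolated? T) T⊆S
                  (λ Y iso → proj₁ iso , few Y iso) ⟩
            lam ^ ((Δ G ℕ.∸ 1) ℕ.* ∣ T ∣) * Z  ≤⟨ *-monoˡ-≤ 0≤Z (component ∣ T ∣) ⟩
            fromℕ q ^ ∣ T ∣ * r ^ ∣ T ∣ * Z    ≈⟨ *-assoc _ _ _ ⟩
            fromℕ q ^ ∣ T ∣ * (r ^ ∣ T ∣ * Z)  ∎)
          where
          few : ∀ Y → Isolated T Y → mono-meeting Y T ℕ.≤ (Δ G ℕ.∸ 1) ℕ.* ∣ T ∣
          few Y (all , none) with crossing G {S} {T} (connected u y (T⊆S u∈T) y∈S) u∈T y∉T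
          ... | x , x∈S , x∉T , z , z∈T , zx = ℕ.≤-pred
              (ℕ.≤-trans fewer (ℕ.≤-trans meeting≤ (ℕ.≤-reflexive (ℕ.+-comm _ 1))))
            where
            x≢a : lookup Y x ≢ a
            x≢a eq = none (x , (x∈S , x∉T , z , z∈T , zx) , eq)
            nonmono = count-strict (λ e → mono? G Y e ×-dec meets? G {q} T e) (meets? G {q} T)
                (edges G) (λ _ → proj₂)
            fewer : mono-meeting Y T ℕ.< meeting G q T
            fewer with edge-∈ G zx
            ... | inj₁ e∈ = nonmono e∈ (inj₁ z∈T) λ (m , _) → x≢a (≡.trans (≡.sym m) (all z z∈T))
            ... | inj₂ e∈ = nonmono e∈ (inj₂ z∈T) λ (m , _) → x≢a (≡.trans m (all z z∈T))
        ... | no none = *-cancelˡ-≤ (^-pos 0<q ∣ T ∣) (begin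
            fromℕ q ^ ∣ T ∣ * sumOver X S (λ Y → weight S Y * ind (isolated? T Y))
              ≤⟨ resample X ((Δ G ℕ.∸ 1) ℕ.* ∣ T ∣ ℕ.+ 1) (isolated? T) T⊆S
                   (λ Y iso → proj₁ iso , ℕ.≤-trans
                       (count-mono (λ e → mono? G Y e ×-dec meets? G {q} T e) (meets? G {q} T)
                       (edges G) λ _ → proj₂) meeting≤) ⟩
            lam ^ ((Δ G ℕ.∸ 1) ℕ.* ∣ T ∣ ℕ.+ 1) * Z  ≤⟨ *-monoˡ-≤ 0≤Z component-T ⟩
            fromℕ q ^ ∣ T ∣ * r ^ ∣ T ∣ * Z    ≈⟨ *-assoc _ _ _ ⟩
            fromℕ q ^ ∣ T ∣ * (r ^ ∣ T ∣ * Z)  ∎)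
          where
          S⊆T : S ⊆ T
          S⊆T {x} x∈S with x ∈? T
          ... | yes x∈T = x∈T
          ... | no x∉T  = ⊥-elim (none (x , x∈S , x∉T))
          component-T : lam ^ ((Δ G ℕ.∸ 1) ℕ.* ∣ T ∣ ℕ.+ 1) ≤ fromℕ q ^ ∣ T ∣ * r ^ ∣ T ∣
          component-T rewrite ℕ.≤-antisym (p⊆q⇒∣p∣≤∣q∣ T⊆S) (p⊆q⇒∣p∣≤∣q∣ S⊆T) = component-S

        T∪x⊆S : ∀ {T x} → T ⊆ S → x ∈ S → T ∪ ⁅ x ⁆ ⊆ S
        T∪x⊆S {T} {x} T⊆S x∈S y∈ with x∈p∪q⁻ T ⁅ x ⁆ y∈
        ... | inj₁ y∈T = T⊆S y∈T
        ... | inj₂ y∈x rewrite x∈⁅y⁆⇒x≡y x y∈x = x∈S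

        -- Union bound: a set coloured `a` either is isolated or can be enlarged by a frontier
        -- vertex that also has colour `a`.
        coloured-grow : ∀ T Y → ind (allColoured? T Y) ≤
          ind (isolated? T Y) + sum λ x → ind (frontier? T x) * ind (allColoured? (T ∪ ⁅ x ⁆) Y)
        coloured-grow T Y = helper (allColoured? T Y)
            (Fin.any? λ x → frontier? T x ×-dec (lookup Y x Fin.≟ a))
          where
          term-nonNeg : ∀ x → 0# ≤ ind (frontier? T x) * ind (allColoured? (T ∪ ⁅ x ⁆) Y)
          term-nonNeg x = *-nonNeg (ind-nonNeg (frontier? T x))
              (ind-nonNeg (allColoured? (T ∪ ⁅ x ⁆) Y))
          rest-nonNeg = sum-nonNeg term-nonNeg
          helper : (A? : Dec (AllColoured T Y)) → Dec (∃ λ x → Frontier T x × lookup Y x ≡ a) →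
            ind A? ≤ ind (isolated? T Y) + sum λ x →
                ind (frontier? T x) * ind (allColoured? (T ∪ ⁅ x ⁆) Y)
          helper (no _)    _         = +-nonNeg (ind-nonNeg (isolated? T Y)) rest-nonNeg
          helper (yes all) (no none) = ≤-trans (≈⇒≤ (sym (ind-yes (isolated? T Y) (all , none))))
              (x≤x+y _ rest-nonNeg)
          helper (yes all) (yes (x , fr , x≡a)) = begin
            1#         ≈⟨ trans
                (*-cong (ind-yes (frontier? T x) fr) (ind-yes (allColoured? (T ∪ ⁅ x ⁆) Y) all′))
                (*-identityˡ 1#) ⟨
            ind (frontier? T x) * ind (allColoured? (T ∪ ⁅ x ⁆) Y)   ≤⟨ term≤sum term-nonNeg x ⟩
            _          ≤⟨ x≤y+x _ (ind-nonNeg (isolated? T Y)) ⟩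
            _          ∎
            where
            all′ : AllColoured (T ∪ ⁅ x ⁆) Y
            all′ y y∈ with x∈p∪q⁻ T ⁅ x ⁆ y∈
            ... | inj₁ y∈T = all y y∈T
            ... | inj₂ y∈x rewrite x∈⁅y⁆⇒x≡y x y∈x = x≡a

        mass-grow : ∀ T → mass T ≤ sumOver X S (λ Y → weight S Y * ind (isolated? T Y)) +
                                   sum λ x → ind (frontier? T x) * mass (T ∪ ⁅ x ⁆)
        mass-grow T = begin
          mass T
            ≤⟨ sumConfig-mono ∣ S ∣ (λ d →
                *-monoʳ-≤ (weight-nonNeg S (Y d)) (coloured-grow T (Y d))) ⟩
          sumOver X S (λ Y → weight S Y * (ind (isolated? T Y) + rest Y))
            ≈⟨ sumConfig-cong ∣ S ∣ (λ d → distribˡ (weight S (Y d)) _ _) ⟩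
          sumOver X S (λ Y → weight S Y * ind (isolated? T Y) + weight S Y * rest Y)
            ≈⟨ sumConfig-+ ∣ S ∣ (λ d → weight S (Y d) * ind (isolated? T (Y d)))
                (λ d → weight S (Y d) * rest (Y d)) ⟩
          _ + sumOver X S (λ Y → weight S Y * rest Y)
            ≈⟨ +-congˡ (sumConfig-cong ∣ S ∣ λ d →
                trans (*-distribˡ-sum (weight S (Y d)) λ x →
                ind (frontier? T x) * ind (allColoured? (T ∪ ⁅ x ⁆) (Y d)))
                 (sum-cong-≋ λ x → swap (weight S (Y d)) (ind (frontier? T x))
                     (ind (allColoured? (T ∪ ⁅ x ⁆) (Y d))))) ⟩
          _ + sumOver X S (λ Y → sum λ x →
              ind (frontier? T x) * (weight S Y * ind (allColoured? (T ∪ ⁅ x ⁆) Y)))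
            ≈⟨ +-congˡ (sumConfig-sum ∣ S ∣ λ d x →
                ind (frontier? T x) * (weight S (Y d) * ind (allColoured? (T ∪ ⁅ x ⁆) (Y d)))) ⟩
          _ + sum (λ x → sumOver X S
              (λ Y → ind (frontier? T x) * (weight S Y * ind (allColoured? (T ∪ ⁅ x ⁆) Y))))
            ≈⟨ +-congˡ (sum-cong-≋ λ x → *-distribˡ-sumConfig ∣ S ∣ (ind (frontier? T x)) λ d →
                weight S (Y d) * ind (allColoured? (T ∪ ⁅ x ⁆) (Y d))) ⟨
          _ + (sum λ x → ind (frontier? T x) * mass (T ∪ ⁅ x ⁆)) ∎
          where
          Y : Config q ∣ S ∣ → Config q n
          Y d = overwrite X S d
          rest : Config q n → Carrier
          rest Y = sum λ x → ind (frontier? T x) * ind (allColoured? (T ∪ ⁅ x ⁆) Y)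
          open Solver using (solve; _:*_; _:=_)
          swap : ∀ x y z → x * (y * z) ≈ y * (x * z)
          swap = solve 3 (λ x y z → x :* (y :* z) := y :* (x :* z)) refl

        -- Induction on the number of vertices of S outside T, with `m` as fuel. The isolated part
        -- contributes B = r^|T| Z, and each of at most |S| extensions contributes at most 2rB;
        -- since 2|S|r ≤ 1, the extensions together add no more than another B.
        mass≤ : ∀ m {T u} → u ∈ T → T ⊆ S → ∣ S ∣ ℕ.≤ m ℕ.+ ∣ T ∣ →
                meeting G q T ℕ.≤ (Δ G ℕ.∸ 1) ℕ.* ∣ T ∣ ℕ.+ 1 → mass T ≤ fromℕ 2 * (r ^ ∣ T ∣ * Z)
        mass≤ m {T} {u} u∈T T⊆S fuel meeting≤ = begin
          mass T                                               ≤⟨ mass-grow T ⟩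
          _ + (sum λ x → ind (frontier? T x) * mass (T ∪ ⁅ x ⁆))
              ≤⟨ +-mono-≤ (mass-isolated u∈T T⊆S meeting≤) (sum-mono extend) ⟩
          B + (sum λ x → ind (x ∈? S) * (fromℕ 2 * (r * B)))
              ≈⟨ +-congˡ (*-distribʳ-sum (fromℕ 2 * (r * B)) λ x → ind (x ∈? S)) ⟨
          B + sum (λ x → ind (x ∈? S)) * (fromℕ 2 * (r * B))   ≈⟨ +-congˡ (*-congʳ (sum-ind-∈ S)) ⟩
          B + fromℕ ∣ S ∣ * (fromℕ 2 * (r * B))
            ≈⟨ solve 4 (λ b k t r → b :+ k :* (t :* (r :* b)) := b :+ t :* (k :* r) :* b) refl B
                (fromℕ ∣ S ∣) (fromℕ 2) r ⟩
          B + fromℕ 2 * (fromℕ ∣ S ∣ * r) * B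
              ≤⟨ +-monoʳ-≤ B (*-monoˡ-≤ 0≤B 2kr≤1) ⟩
          B + 1# * B
              ≈⟨ solve 1 (λ b → b :+ con 1 :* b := numeral 2 :* b) refl B ⟩
          fromℕ 2 * B                                          ∎
          where
          open Solver using (solve; _:+_; _:*_; _:=_; con)
          B = r ^ ∣ T ∣ * Z
          0≤B : 0# ≤ B
          0≤B = *-nonNeg (^-nonNeg 0≤r ∣ T ∣) 0≤Z
          extend : ∀ x → ind (frontier? T x) * mass (T ∪ ⁅ x ⁆) ≤ ind (x ∈? S) * (fromℕ 2 * (r * B))
          extend x = by-cases (frontier? T x)
            where
            by-cases : (F? : Dec (Frontier T x)) →
                ind F? * mass (T ∪ ⁅ x ⁆) ≤ ind (x ∈? S) * (fromℕ 2 * (r * B))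
            by-cases (no _) = ≤-trans (≈⇒≤ (zeroˡ _))
                (*-nonNeg (ind-nonNeg (x ∈? S)) (*-nonNeg (0≤fromℕ 2) (*-nonNeg 0≤r 0≤B)))
            by-cases (yes (x∈S , x∉T , y , y∈T , yx)) = begin
              1# * mass (T ∪ ⁅ x ⁆)                      ≈⟨ *-identityˡ _ ⟩
              mass (T ∪ ⁅ x ⁆)                           ≤⟨ bound m fuel ⟩
              fromℕ 2 * (r ^ ∣ T ∪ ⁅ x ⁆ ∣ * Z)
                  ≈⟨ *-congˡ (*-congʳ (reflexive (≡.cong (r ^_) size))) ⟩
              fromℕ 2 * (r ^ suc ∣ T ∣ * Z)              ≈⟨ *-congˡ (*-assoc r (r ^ ∣ T ∣) Z) ⟩
              fromℕ 2 * (r * B)                          ≈⟨ *-identityˡ _ ⟨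
              1# * (fromℕ 2 * (r * B))                   ≈⟨ *-congʳ (ind-yes (x ∈? S) x∈S) ⟨
              ind (x ∈? S) * (fromℕ 2 * (r * B))         ∎
              where
              size = ∣p∪⁅x⁆∣≡1+∣p∣ T x∉T
              meeting≤′ : meeting G q (T ∪ ⁅ x ⁆) ℕ.≤ (Δ G ℕ.∸ 1) ℕ.* ∣ T ∪ ⁅ x ⁆ ∣ ℕ.+ 1
              meeting≤′ rewrite size = ℕ.≤-trans (meeting-∪ G q x∉T y∈T yx)
                (ℕ.≤-trans (ℕ.+-monoˡ-≤ (Δ G ℕ.∸ 1) meeting≤)
                    (ℕ.≤-reflexive (≡.trans (ℕ.+-comm _ (Δ G ℕ.∸ 1))
                  (≡.trans (≡.sym (ℕ.+-assoc (Δ G ℕ.∸ 1) _ 1))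
                      (≡.cong (ℕ._+ 1) (≡.sym (ℕ.*-suc (Δ G ℕ.∸ 1) ∣ T ∣)))))))
              bound : ∀ m → ∣ S ∣ ℕ.≤ m ℕ.+ ∣ T ∣ →
                  mass (T ∪ ⁅ x ⁆) ≤ fromℕ 2 * (r ^ ∣ T ∪ ⁅ x ⁆ ∣ * Z)
              -- Without fuel T would be as large as S, yet x lies in S outside T.
              bound zero    fuel = ⊥-elim (ℕ.<⇒≱ (p⊂q⇒∣p∣<∣q∣ (T⊆S , x , x∈S , x∉T)) fuel)
              bound (suc m) fuel = mass≤ m (p⊆p∪q ⁅ x ⁆ u∈T) (T∪x⊆S T⊆S x∈S)
                (ℕ.≤-trans fuel (ℕ.≤-reflexive
                    (≡.trans (≡.sym (ℕ.+-suc m ∣ T ∣)) (≡.cong (m ℕ.+_) (≡.sym size))))) meeting≤′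

        colour-probability : ∀ {u} → u ∈ S →
          sumOver X S (λ Y → weight S Y * ind (lookup Y u Fin.≟ a)) ≤ fromℕ 2 * (r * Z)
        colour-probability {u} u∈S = begin
          sumOver X S (λ Y → weight S Y * ind (lookup Y u Fin.≟ a))
            ≤⟨ sumConfig-mono ∣ S ∣ (λ d → *-monoʳ-≤ (weight-nonNeg S (overwrite X S d))
                (single (overwrite X S d))) ⟩
          mass ⁅ u ⁆
              ≤⟨ mass≤ ∣ S ∣ (x∈⁅x⁆ u) ⁅u⁆⊆S (ℕ.m≤m+n ∣ S ∣ ∣ ⁅ u ⁆ ∣) meeting≤ ⟩
          fromℕ 2 * (r ^ ∣ ⁅ u ⁆ ∣ * Z)
              ≈⟨ *-congˡ (*-congʳ (trans (reflexive (≡.cong (r ^_) (∣⁅x⁆∣≡1 u))) (*-identityʳ r))) ⟩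
          fromℕ 2 * (r * Z)                ∎
          where
          single : ∀ Y → ind (lookup Y u Fin.≟ a) ≤ ind (allColoured? ⁅ u ⁆ Y)
          single Y with lookup Y u Fin.≟ a
          ... | no _    = ind-nonNeg (allColoured? ⁅ u ⁆ Y)
          ... | yes u≡a = ≈⇒≤
              (sym (ind-yes (allColoured? ⁅ u ⁆ Y) λ x x∈ →
              ≡.trans (≡.cong (lookup Y) (x∈⁅y⁆⇒x≡y u x∈)) u≡a))
          ⁅u⁆⊆S : ⁅ u ⁆ ⊆ S
          ⁅u⁆⊆S x∈ rewrite x∈⁅y⁆⇒x≡y u x∈ = u∈S
          meeting≤ : meeting G q ⁅ u ⁆ ℕ.≤ (Δ G ℕ.∸ 1) ℕ.* ∣ ⁅ u ⁆ ∣ ℕ.+ 1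
          -- Truncated subtraction gives Δ ≤ 1 + (Δ ∸ 1), which is what the bound asks of a single
          -- vertex.
          meeting≤ rewrite ∣⁅x⁆∣≡1 u = ℕ.≤-trans (ℕ.≤-trans (meeting-⁅⁆ G q u) (degree≤Δ G u))
            (ℕ.≤-trans (ℕ.m≤n+m∸n (Δ G) 1)
                (ℕ.≤-reflexive (≡.trans (ℕ.+-comm 1 _)
                (≡.cong (ℕ._+ 1) (≡.sym (ℕ.*-identityʳ (Δ G ℕ.∸ 1)))))))

-- Contraction under a block update

module Comparison {c ℓ₁ ℓ₂} (ℝ : CompleteOrderedField c ℓ₁ ℓ₂) {q : ℕ} (m : ℕ) where
  open OrderedField ℝ
  open FiniteSums ℝ
  open ≤R
  open Solver using (solve; _:+_; _:*_; _:=_; con)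

  doubleSum : (Config q m → Config q m → Carrier) → Carrier
  doubleSum F = sumConfig m λ d → sumConfig m (F d)

  doubleSum-+ : ∀ F H → doubleSum (λ d e → F d e + H d e) ≈ doubleSum F + doubleSum H
  doubleSum-+ F H = trans (sumConfig-cong m λ d → sumConfig-+ m (F d) (H d))
    (sumConfig-+ m (λ d → sumConfig m (F d)) (λ d → sumConfig m (H d)))

  doubleSum-* : ∀ f h → doubleSum (λ d e → f d * h e) ≈ sumConfig m f * sumConfig m h
  doubleSum-* f h = trans (sumConfig-cong m λ d → sym (*-distribˡ-sumConfig m (f d) h))
    (sym (*-distribʳ-sumConfig m (sumConfig m h) f))

  -- Two expectations of g are compared under the independent coupling: the pairs of good
  -- configurations carry a symmetric weight, so their contributions cancel.
  expectation-gap :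
    ∀ {w w′ g b : Config q m → Carrier} {R} {p} {Bad : Config q m → Set p}
        (bad? : ∀ d → Dec (Bad d)) →
    (∀ d → 0# ≤ w d) → (∀ d → 0# ≤ w′ d) → (∀ d → 0# ≤ b d) → 0# ≤ R →
    (∀ d → ¬ Bad d → w d ≈ w′ d) → (∀ d → Bad d → 1# ≤ b d) → (∀ d e → g d ≤ g e + R) →
    sumConfig m (λ d → w′ d * g d) * sumConfig m w ≤
    sumConfig m w′ * sumConfig m (λ d → w d * g d) +
    (R * (sumConfig m (λ d → w′ d * b d) * sumConfig m w) + R *
        (sumConfig m w′ * sumConfig m (λ d → w d * b d)))
  expectation-gap {w} {w′} {g} {b} {R} {Bad = Bad} bad? 0≤w 0≤w′ 0≤b 0≤R same 1≤b g≤ = +-cancelʳ-≤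
      (U * Ug) (begin
    sumConfig m (λ d → w′ d * g d) * sumConfig m w + U * Ug
      ≈⟨ +-cong (doubleSum-* (λ d → w′ d * g d) w) (doubleSum-* u (λ d → u d * g d)) ⟨
    doubleSum (λ d e → w′ d * g d * w e) + doubleSum (λ d e → u d * (u e * g e))
      ≈⟨ doubleSum-+ _ _ ⟨
    doubleSum (λ d e → w′ d * g d * w e + u d * (u e * g e))
      ≤⟨ sumConfig-mono m (λ d → sumConfig-mono m λ e → pointwise d e (bad? d) (bad? e)) ⟩
    doubleSum (λ d e → w′ d * (w e * g e) + (R * (w′ d * b d) * w e + R * w′ d * (w e * b e)) + u
        d * g d * u e)
      ≈⟨ trans (doubleSum-+ _ _)
          (+-cong (trans (doubleSum-+ _ _) (+-cong (doubleSum-* w′ (λ d → w d * g d))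
           (trans (doubleSum-+ _ _)
               (+-cong (scaled (λ d → w′ d * b d) w) (scaled w′ (λ d → w d * b d))))))
           (trans (doubleSum-* (λ d → u d * g d) u) (*-comm Ug U))) ⟩
    _ + U * Ug ∎)
    where
    -- The common part of `w` and `w′`, supported on good configurations. The product U Ug is added
    -- to both sides with the roles of d and e exchanged; on a good pair the two sides then agree up
    -- to the nonnegative error terms.
    u : Config q m → Carrier
    u d = ind (¬? (bad? d)) * w d
    U = sumConfig m u
    Ug = sumConfig m λ d → u d * g d
    scaled : ∀ f h → doubleSum (λ d e → R * f d * h e) ≈ R * (sumConfig m f * sumConfig m h)
    scaled f h = trans (doubleSum-* (λ d → R * f d) h)
      (trans (*-congʳ (sym (*-distribˡ-sumConfig m R f))) (*-assoc _ _ _))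

    -- Here x and y are the indicators that d and e are good. As one of the pair is bad, their
    -- product vanishes, and the crude bound by R is charged to `b d + b e`.
    pointwise-bad : ∀ d e x y → x * y ≈ 0# → 1# ≤ b d + b e →
      w′ d * g d * w e + x * w d * (y * w e * g e) ≤
      w′ d * (w e * g e) + (R * (w′ d * b d) * w e + R * w′ d * (w e * b e)) + x * w d * g d *
          (y * w e)
    pointwise-bad d e x y xy≈0 1≤b+b = begin
      w′ d * g d * w e + x * w d * (y * w e * g e)
        ≈⟨ solve 7 (λ w′d gd we x wd y ge → w′d :* gd :* we :+ x :* wd :* (y :* we :* ge)
             := w′d :* we :* gd :+ x :* y :* (wd :* we :* ge)) refl (w′ d) (g d) (w e) x (w d) y
                 (g e) ⟩
      w′ d * w e * g d + x * y * (w d * w e * g e)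
        ≤⟨ +-mono-≤ (*-monoʳ-≤ 0≤ww (≤-trans (g≤ d e) (+-monoʳ-≤ (g e)
             (≤-trans (≈⇒≤ (sym (*-identityʳ R))) (*-monoʳ-≤ 0≤R 1≤b+b))))) (≈⇒≤ (vanish _ _)) ⟩
      w′ d * w e * (g e + R * (b d + b e)) + x * y * (w d * w e * g d)
        ≈⟨ solve 10 (λ w′d gd we x wd y ge R bd be →
            w′d :* we :* (ge :+ R :* (bd :+ be)) :+ x :* y :* (wd :* we :* gd)
             := w′d :* (we :* ge) :+ (R :* (w′d :* bd) :* we :+ R :* w′d :* (we :* be)) :+ x :* wd
                 :* gd :* (y :* we))
             refl (w′ d) (g d) (w e) x (w d) y (g e) R (b d) (b e) ⟩
      _ ∎
      where
      0≤ww : 0# ≤ w′ d * w e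
      0≤ww = *-nonNeg (0≤w′ d) (0≤w e)
      vanish : ∀ s t → x * y * s ≈ x * y * t
      vanish s t = trans (*-congʳ xy≈0) (trans (zeroˡ s) (sym (trans (*-congʳ xy≈0) (zeroˡ t))))

    pointwise : ∀ d e (B? : Dec (Bad d)) (C? : Dec (Bad e)) →
      w′ d * g d * w e + ind (¬? B?) * w d * (ind (¬? C?) * w e * g e) ≤
      w′ d * (w e * g e) + (R * (w′ d * b d) * w e + R * w′ d * (w e * b e)) + ind (¬? B?) * w
          d * g d * (ind (¬? C?) * w e)
    pointwise d e (yes bd) C?       = pointwise-bad d e _ _ (zeroˡ _)
        (≤-trans (1≤b d bd) (x≤x+y (b d) (0≤b e)))
    pointwise d e (no _)   (yes be) = pointwise-bad d e _ _ (zeroʳ _)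
        (≤-trans (1≤b e be) (x≤y+x (b e) (0≤b d)))
    pointwise d e (no gd)  (no ge)  = begin
      w′ d * g d * w e + 1# * w d * (1# * w e * g e)  ≈⟨ +-congʳ (*-congʳ (*-congʳ (same d gd))) ⟨
      w d * g d * w e + 1# * w d * (1# * w e * g e)
        ≈⟨ solve 4 (λ wd gd we ge → wd :* gd :* we :+ con 1 :* wd :* (con 1 :* we :* ge)
             := wd :* (we :* ge) :+ con 1 :* wd :* gd :* (con 1 :* we)) refl (w d) (g d) (w e)
                 (g e) ⟩
      w d * (w e * g e) + 1# * w d * g d * (1# * w e) ≈⟨ +-congʳ (*-congʳ (same d gd)) ⟩
      w′ d * (w e * g e) + 1# * w d * g d * (1# * w e)
        ≤⟨ +-monoˡ-≤ _ (x≤x+y _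
            (+-nonNeg (*-nonNeg (*-nonNeg 0≤R (*-nonNeg (0≤w′ d) (0≤b d))) (0≤w e))
                                          (*-nonNeg (*-nonNeg 0≤R (0≤w′ d))
                                              (*-nonNeg (0≤w e) (0≤b e))))) ⟩
      _ ∎

module Lipschitz {c ℓ₁ ℓ₂} (ℝ : CompleteOrderedField c ℓ₁ ℓ₂) {q : ℕ} where
  open OrderedField ℝ
  open ≤R

  -- The Lipschitz condition for the Hamming metric, reduced to single changes. A one-sided bound
  -- suffices, because restoring the old colour gives the other side.
  Lip : ∀ {n} → Carrier → (Config q n → Carrier) → Set ℓ₂
  Lip L f = ∀ X v a → f (X [ v ]≔ a) ≤ f X + L

  Lip-∷ : ∀ {n L} {f : Config q (suc n) → Carrier} x → Lip L f → Lip L (λ X → f (x ∷ X))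
  Lip-∷ x lip X v a = lip (x ∷ X) (suc v) a

  Lip-overwrite : ∀ {n L} {f : Config q n → Carrier} → Lip L f → ∀ X S d e →
                  f (overwrite X S d) ≤ f (overwrite X S e) + fromℕ ∣ S ∣ * L
  Lip-overwrite {L = L} lip []      []            []      []      = x≤x+y _ (≈⇒≤ (sym (zeroˡ L)))
  Lip-overwrite {f = f} lip (x ∷ X) (outside ∷ S) d e = Lip-overwrite {f = λ Y → f (x ∷ Y)}
      (Lip-∷ {f = f} x lip) X S d e
  Lip-overwrite {L = L} {f} lip (x ∷ X) (inside ∷ S) (a ∷ d) (b ∷ e) = begin
    f (a ∷ overwrite X S d)                           ≤⟨ lip (b ∷ overwrite X S d) zero a ⟩
    f (b ∷ overwrite X S d) + L
        ≤⟨ +-monoˡ-≤ L (Lip-overwrite {f = λ Y → f (b ∷ Y)} (Lip-∷ {f = f} b lip) X S d e) ⟩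
    f (b ∷ overwrite X S e) + fromℕ ∣ S ∣ * L + L
        ≈⟨ trans (+-assoc _ _ _)
        (+-congˡ (trans (+-comm _ _)
        (sym (trans (distribʳ L 1# (fromℕ ∣ S ∣)) (+-congʳ (*-identityˡ L)))))) ⟩
    f (b ∷ overwrite X S e) + fromℕ (suc ∣ S ∣) * L   ∎

  Lip-global : ∀ {n L} {f : Config q n → Carrier} → Lip L f → ∀ X Y → f X ≤ f Y + fromℕ n * L
  Lip-global {L = L} lip [] [] = x≤x+y _ (≈⇒≤ (sym (zeroˡ L)))
  Lip-global {suc n} {L} {f} lip (a ∷ X) (b ∷ Y) = begin
    f (a ∷ X)                       ≤⟨ lip (b ∷ X) zero a ⟩
    f (b ∷ X) + L
        ≤⟨ +-monoˡ-≤ L (Lip-global {f = λ Y → f (b ∷ Y)} (Lip-∷ {f = f} b lip) X Y) ⟩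
    f (b ∷ Y) + fromℕ n * L + L
        ≈⟨ trans (+-assoc _ _ _)
        (+-congˡ (trans (+-comm _ _)
        (sym (trans (distribʳ L 1# (fromℕ n)) (+-congʳ (*-identityˡ L)))))) ⟩
    f (b ∷ Y) + fromℕ (suc n) * L   ∎

module BlockContraction {c ℓ₁ ℓ₂} (ℝ : CompleteOrderedField c ℓ₁ ℓ₂)
                        {n : ℕ} (G : SimpleGraph n) (q : ℕ) (lam : CompleteOrderedField.Carrier ℝ)
                            where
  open OrderedField ℝ
  open FiniteSums ℝ
  open ≤R
  open SimpleGraph G
  open ColourBound ℝ G q lam using (mono-meeting; weight; weight-pos; weight-nonNeg)
  open Lipschitz ℝ {q}

  -- The update of a fixed block as an operator on functions: the conditional expectation of `f`
  -- given the colours off S.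
  heatBath : Subset n → (Config q n → Carrier) → Config q n → Carrier
  heatBath S f X = sumConfig ∣ S ∣ λ d → blockWeight G lam q X S d * f (overwrite X S d)

  partition : Subset n → Config q n → Carrier
  partition S X = sumOver X S (weight S)

  heatBath≈ : ∀ S f X → heatBath S f X ≈ sumOver X S (λ Y → weight S Y * f Y) / partition S X
  heatBath≈ S f X = trans (sumConfig-cong ∣ S ∣ λ d →
      solve 3 (λ x y z → x :* y :* z := x :* z :* y) refl _ (partition S X ⁻¹) _)
      (sym (*-distribʳ-sumConfig ∣ S ∣ (partition S X ⁻¹) λ d →
          weight S (overwrite X S d) * f (overwrite X S d)))
    where open Solver using (solve; _:*_; _:=_)

  sumOver-update-∈ : ∀ (X : Config q n) {S v} a f → v ∈ S → sumOver (X [ v ]≔ a) S f ≈ sumOver X S f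
  sumOver-update-∈ X {S} a f v∈S = sumConfig-cong ∣ S ∣ λ d →
      reflexive (≡.cong f (overwrite-update-∈ X d a v∈S))

  heatBath-update-∈ : ∀ X {S v} a f → v ∈ S → heatBath S f (X [ v ]≔ a) ≈ heatBath S f X
  heatBath-update-∈ X {S} {v} a f v∈S = trans (heatBath≈ S f (X [ v ]≔ a))
    (trans (*-cong (sumOver-update-∈ X a (λ Y → weight S Y * f Y) v∈S)
                   (⁻¹-cong (sumOver-update-∈ X a (weight S) v∈S)))
           (sym (heatBath≈ S f X)))

  neighboursIn : Fin n → Subset n → Carrier
  neighboursIn v S = sum λ u → ind (adj? v u) * ind (u ∈? S)

  neighboursIn-nonNeg : ∀ v S → 0# ≤ neighboursIn v S
  neighboursIn-nonNeg v S = sum-nonNeg λ u → *-nonNeg (ind-nonNeg (adj? v u)) (ind-nonNeg (u ∈? S))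

  Conflict : Subset n → Fin n → Fin q → Fin q → Config q n → Set
  Conflict S v a b Y = ∃ λ u → Adj v u × u ∈ S × (lookup Y u ≡ a ⊎ lookup Y u ≡ b)

  conflict? : ∀ S v a b Y → Dec (Conflict S v a b Y)
  conflict? S v a b Y = Fin.any? λ u →
      adj? v u ×-dec ((u ∈? S) ×-dec ((lookup Y u Fin.≟ a) ⊎-dec (lookup Y u Fin.≟ b)))

  conflicts : Subset n → Fin n → Fin q → Fin q → Config q n → Carrier
  conflicts S v a b Y = sum λ u →
      ind (adj? v u) * ind (u ∈? S) * (ind (lookup Y u Fin.≟ a) + ind (lookup Y u Fin.≟ b))

  module _ (S : Subset n) (v : Fin n) (a b : Fin q) where

    conflict-term-nonNeg : ∀ Y u →
        0# ≤ ind (adj? v u) * ind (u ∈? S) * (ind (lookup Y u Fin.≟ a) + ind (lookup Y u Fin.≟ b))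
    conflict-term-nonNeg Y u = *-nonNeg (*-nonNeg (ind-nonNeg (adj? v u)) (ind-nonNeg (u ∈? S)))
      (+-nonNeg (ind-nonNeg (lookup Y u Fin.≟ a)) (ind-nonNeg (lookup Y u Fin.≟ b)))

    conflicts-nonNeg : ∀ Y → 0# ≤ conflicts S v a b Y
    conflicts-nonNeg Y = sum-nonNeg (conflict-term-nonNeg Y)

    1≤conflicts : ∀ Y → Conflict S v a b Y → 1# ≤ conflicts S v a b Y
    1≤conflicts Y (u , vu , u∈S , hit) = begin
      1#                       ≤⟨ colour hit ⟩
      ind (lookup Y u Fin.≟ a) + ind (lookup Y u Fin.≟ b)
        ≈⟨ trans (*-congʳ (trans (*-cong (ind-yes (adj? v u) vu) (ind-yes (u ∈? S) u∈S))
            (*-identityˡ 1#))) (*-identityˡ _) ⟨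
      ind (adj? v u) * ind (u ∈? S) * (ind (lookup Y u Fin.≟ a) + ind (lookup Y u Fin.≟ b))
          ≤⟨ term≤sum (conflict-term-nonNeg Y) u ⟩
      conflicts S v a b Y      ∎
      where
      colour : lookup Y u ≡ a ⊎ lookup Y u ≡ b →
          1# ≤ ind (lookup Y u Fin.≟ a) + ind (lookup Y u Fin.≟ b)
      colour (inj₁ eq) = ≤-trans (≈⇒≤ (sym (ind-yes (lookup Y u Fin.≟ a) eq)))
          (x≤x+y _ (ind-nonNeg (lookup Y u Fin.≟ b)))
      colour (inj₂ eq) = ≤-trans (≈⇒≤ (sym (ind-yes (lookup Y u Fin.≟ b) eq)))
          (x≤y+x _ (ind-nonNeg (lookup Y u Fin.≟ a)))

    -- v is not its own neighbour, so its colour is never inspected. Hence one function serves as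
    -- the error bound under both laws.
    conflicts-update : ∀ Y x → conflicts S v a b (Y [ v ]≔ x) ≈ conflicts S v a b Y
    conflicts-update Y x = sum-cong-≋ term
      where
      term : ∀ u → ind (adj? v u) * ind (u ∈? S) *
          (ind (lookup (Y [ v ]≔ x) u Fin.≟ a) + ind (lookup (Y [ v ]≔ x) u Fin.≟ b)) ≈
                   ind (adj? v u) * ind (u ∈? S) *
                       (ind (lookup Y u Fin.≟ a) + ind (lookup Y u Fin.≟ b))
      term u with u Fin.≟ v
      ... | no u≢v     = *-congˡ
          (reflexive (≡.cong (λ y → ind (y Fin.≟ a) + ind (y Fin.≟ b))
          (Vec.lookup∘update′ u≢v Y x)))
      ... | yes ≡.refl = trans (vanish _) (sym (vanish _))
        where
        vanish : ∀ y → ind (adj? v v) * ind (v ∈? S) * y ≈ 0#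
        vanish y = trans (*-congʳ (trans (*-congʳ (ind-no (adj? v v) irrefl)) (zeroˡ _))) (zeroˡ y)

  mono-update : ∀ {S v} {Y Y′ : Config q n} → v ∉ S → (∀ x → x ≢ v → lookup Y x ≡ lookup Y′ x) →
                (∀ u → Adj v u → u ∈ S → lookup Y u ≢ lookup Y v) →
                ∀ {e} → e ∈ˡ edges G → Mono G Y e × Meets G {q} S e → Mono G Y′ e × Meets G {q} S e
  mono-update {S} {v} {Y} {Y′} v∉S agree differ {x , y} e∈ (m , s) with x Fin.≟ v | y Fin.≟ v
  ... | no x≢v     | no y≢v = ≡.trans (≡.sym (agree x x≢v)) (≡.trans m (agree y y≢v)) , s
  ... | yes ≡.refl | _ with s
  ...   | inj₁ v∈S = ⊥-elim (v∉S v∈S)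
  ...   | inj₂ y∈S = ⊥-elim (differ y (proj₂ (edge⁻ G e∈)) y∈S (≡.sym m))
  mono-update v∉S agree differ e∈ (m , s) | no x≢v | yes ≡.refl with s
  ...   | inj₁ x∈S = ⊥-elim (differ _ (adj-sym (proj₂ (edge⁻ G e∈))) x∈S m)
  ...   | inj₂ v∈S = ⊥-elim (v∉S v∈S)

  -- An edge that meets S and depends on the colour of v joins v to some u in S. If u has neither
  -- the old nor the new colour of v, that edge is bichromatic both before and after.
  weight-update : ∀ {S v} Y a → v ∉ S → ¬ Conflict S v (lookup Y v) a Y →
      weight S (Y [ v ]≔ a) ≡ weight S Y
  weight-update {S} {v} Y a v∉S none = ≡.cong (lam ^_) (count-cong
    (λ e → mono? G (Y [ v ]≔ a) e ×-dec meets? G {q} S e) (λ e → mono? G Y e ×-dec meets? G {q} S e)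
        (edges G)
    (mono-update {Y = Y [ v ]≔ a} {Y} v∉S (λ x x≢v → Vec.lookup∘update′ x≢v Y a)
      λ u vu u∈S eq → none
          (u , vu , u∈S , inj₂ (≡.trans (≡.sym (Vec.lookup∘update′ (λ { ≡.refl → v∉S u∈S }) Y a))
                                                   (≡.trans eq (Vec.lookup∘update v Y a)))))
    (mono-update {Y = Y} {Y [ v ]≔ a} v∉S (λ x x≢v → ≡.sym (Vec.lookup∘update′ x≢v Y a))
      λ u vu u∈S eq → none (u , vu , u∈S , inj₁ eq)))

  partition-pos : 1# ≤ lam → 1 ℕ.≤ q → ∀ S X → 0# < partition S X
  partition-pos 1≤lam 1≤q S X = <-≤-trans (weight-pos 1≤lam S (overwrite X S d))
      (term≤sumConfig ∣ S ∣ (λ e → weight-nonNeg 1≤lam S (overwrite X S e)) d)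
    where
    d : Config q ∣ S ∣
    d = Vec.replicate ∣ S ∣ (Fin.fromℕ< 1≤q)

  module _ (1≤lam : 1# ≤ lam) (1≤q : 1 ℕ.≤ q) (S : Subset n) {r : Carrier} (0≤r : 0# ≤ r)
           (colour≤ : ∀ X a {u} → u ∈ S →
              sumOver X S (λ Y → weight S Y * ind (lookup Y u Fin.≟ a))
                  ≤ fromℕ 2 * (r * partition S X)) where

    -- Each neighbour of v in S is charged for two colours, at 2r each.
    conflicts-mass : ∀ X v a b → sumOver X S (λ Y → weight S Y * conflicts S v a b Y) ≤
                                 neighboursIn v S * (fromℕ 4 * r) * partition S X
    conflicts-mass X v a b = begin
      sumOver X S (λ Y → weight S Y * conflicts S v a b Y)
        ≈⟨ sumConfig-cong ∣ S ∣ (λ d → trans (*-distribˡ-sum (weight S (Y d)) (λ u → term u (Y d)))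
            (sum-cong-≋ λ u → expand u (Y d))) ⟩
      sumOver X S (λ Y → sum λ u →
          A u * (weight S Y * ind (lookup Y u Fin.≟ a) + weight S Y * ind (lookup Y u Fin.≟ b)))
        ≈⟨ sumConfig-sum ∣ S ∣ (λ d u →
            A u * (weight S (Y d) * ind (lookup (Y d) u Fin.≟ a) + weight S
            (Y d) * ind (lookup (Y d) u Fin.≟ b))) ⟩
      sum (λ u → sumOver X S
          (λ Y → A u * (weight S Y * ind (lookup Y u Fin.≟ a) + weight S
          Y * ind (lookup Y u Fin.≟ b))))
        ≈⟨ sum-cong-≋ (λ u → trans (sym (*-distribˡ-sumConfig ∣ S ∣ (A u) _))
            (*-congˡ (sumConfig-+ ∣ S ∣ _ _))) ⟩
      sum (λ u → A u * (hits a u + hits b u))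
        ≤⟨ sum-mono bound ⟩
      sum (λ u → A u * (fromℕ 4 * r * partition S X))
        ≈⟨ *-distribʳ-sum (fromℕ 4 * r * partition S X) A ⟨
      neighboursIn v S * (fromℕ 4 * r * partition S X)
        ≈⟨ *-assoc _ _ _ ⟨
      neighboursIn v S * (fromℕ 4 * r) * partition S X ∎
      where
      Y : Config q ∣ S ∣ → Config q n
      Y d = overwrite X S d
      A : Fin n → Carrier
      A u = ind (adj? v u) * ind (u ∈? S)
      term : Fin n → Config q n → Carrier
      term u Y = A u * (ind (lookup Y u Fin.≟ a) + ind (lookup Y u Fin.≟ b))
      hits : Fin q → Fin n → Carrier
      hits a u = sumOver X S λ Y → weight S Y * ind (lookup Y u Fin.≟ a)
      open Solver using (solve; _:+_; _:*_; _:=_; con)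
      expand : ∀ u Y → weight S Y * term u Y
          ≈ A u * (weight S Y * ind (lookup Y u Fin.≟ a) + weight S Y * ind (lookup Y u Fin.≟ b))
      expand u Y = solve 4 (λ w A i j → w :* (A :* (i :+ j)) := A :* (w :* i :+ w :* j)) refl
        (weight S Y) (A u) (ind (lookup Y u Fin.≟ a)) (ind (lookup Y u Fin.≟ b))
      bound : ∀ u → A u * (hits a u + hits b u) ≤ A u * (fromℕ 4 * r * partition S X)
      bound u with u ∈? S
      ... | no _    = ≈⇒≤ (trans (vanish _) (sym (vanish _)))
        where
        vanish : ∀ x → ind (adj? v u) * 0# * x ≈ 0#
        vanish x = trans (*-congʳ (zeroʳ _)) (zeroˡ x)
      ... | yes u∈S = *-monoʳ-≤ (*-nonNeg (ind-nonNeg (adj? v u)) 0≤1) (begin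
        hits a u + hits b u  ≤⟨ +-mono-≤ (colour≤ X a u∈S) (colour≤ X b u∈S) ⟩
        fromℕ 2 * (r * partition S X) + fromℕ 2 * (r * partition S X)
          ≈⟨ solve 2 (λ r z → numeral 2 :* (r :* z) :+ numeral 2 :* (r :* z) := numeral 4 :* r :* z)
              refl r (partition S X) ⟩
        fromℕ 4 * r * partition S X ∎)
        
    divide : ∀ {A B C x y} → 0# < x → 0# < y → A * x ≤ B * y + C * (x * y) → A / y ≤ B / x + C
    divide {A} {B} {C} {x} {y} 0<x 0<y h = *-cancelˡ-≤ (*-pos 0<x 0<y) (begin
      x * y * (A / y)
          ≈⟨ solve 4 (λ x y A i → x :* y :* (A :* i) := A :* x :* (y :* i)) refl x y A (y ⁻¹) ⟩
      A * x * (y * y ⁻¹)         ≈⟨ trans (*-congˡ (*-inv 0<y)) (*-identityʳ _) ⟩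
      A * x                      ≤⟨ h ⟩
      B * y + C * (x * y)        ≈⟨ +-congʳ (trans (*-congˡ (*-inv 0<x)) (*-identityʳ _)) ⟨
      B * y * (x * x ⁻¹) + C * (x * y)
          ≈⟨ solve 5 (λ x y B C i → B :* y :* (x :* i) :+ C :* (x :* y) := x :* y :* (B :* i :+ C))
          refl x y B C (x ⁻¹) ⟩
      x * y * (B / x + C)        ∎)
      where open Solver using (solve; _:+_; _:*_; _:=_)

    module _ {f : Config q n → Carrier} {L : Carrier} (lip : Lip L f) (0≤L : 0# ≤ L) where

      -- The surviving difference at v costs L. `expectation-gap` compares the rest with R = |S| L,
      -- since two colourings of S differ in at most |S| places; the conflict mass 4rN is incurred
      -- under both laws, whence the 8.
      heatBath-update-∉ : ∀ X {v} a → v ∉ S →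
        heatBath S f (X [ v ]≔ a)
            ≤ heatBath S f X + L * (1# + fromℕ 8 * (fromℕ ∣ S ∣ * r) * neighboursIn v S)
      heatBath-update-∉ X {v} a v∉S = begin
        heatBath S f X′                               ≈⟨ heatBath≈ S f X′ ⟩
        sumOver X′ S (λ Y → weight S Y * f Y) / Z′    ≤⟨ divide 0<Z 0<Z′ cross ⟩
        sumOver X S (λ Y → weight S Y * f Y) / Z + L * (1# + fromℕ 8 * (fromℕ ∣ S ∣ * r) * N)
            ≈⟨ +-congʳ (heatBath≈ S f X) ⟨
        heatBath S f X + L * (1# + fromℕ 8 * (fromℕ ∣ S ∣ * r) * N) ∎
        where
        open Comparison ℝ {q} ∣ S ∣
        open Solver using (solve; _:+_; _:*_; _:=_; con)
        X′ = X [ v ]≔ a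
        Z = partition S X
        Z′ = partition S X′
        N = neighboursIn v S
        0<Z = partition-pos 1≤lam 1≤q S X
        0<Z′ = partition-pos 1≤lam 1≤q S X′
        Y Y′ : Config q ∣ S ∣ → Config q n
        Y d = overwrite X S d
        Y′ d = overwrite X′ S d
        w w′ g b : Config q ∣ S ∣ → Carrier
        w d = weight S (Y d)
        w′ d = weight S (Y′ d)
        g d = f (Y d)
        b d = conflicts S v (lookup X v) a (Y d)
        0≤w : ∀ d → 0# ≤ w d
        0≤w d = weight-nonNeg 1≤lam S (Y d)
        0≤w′ : ∀ d → 0# ≤ w′ d
        0≤w′ d = weight-nonNeg 1≤lam S (Y′ d)
        Y′≡ : ∀ d → Y′ d ≡ Y d [ v ]≔ a
        Y′≡ d = overwrite-update-∉ X S d a v∉S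
        R = fromℕ ∣ S ∣ * L
        0≤R : 0# ≤ R
        0≤R = *-nonNeg (0≤fromℕ ∣ S ∣) 0≤L
        same : ∀ d → ¬ Conflict S v (lookup X v) a (Y d) → w d ≈ w′ d
        same d none = sym (reflexive (≡.trans (≡.cong (weight S) (Y′≡ d)) (weight-update (Y d) a v∉S
          (≡.subst (λ x → ¬ Conflict S v x a (Y d)) (≡.sym (lookup-overwrite-∉ X S d v∉S)) none))))
        w′b≤ : sumConfig ∣ S ∣ (λ d → w′ d * b d) ≤ N * (fromℕ 4 * r) * Z′
        w′b≤ = ≤-trans (≈⇒≤ (sumConfig-cong ∣ S ∣ λ d →
            *-congˡ (trans (sym (conflicts-update S v (lookup X v) a (Y d) a))
            (reflexive (≡.cong (conflicts S v (lookup X v) a) (≡.sym (Y′≡ d)))))))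
          (conflicts-mass X′ v (lookup X v) a)
        -- Replacing `f (Y′ d)` by `f (Y d) + L` leaves two laws and a single function `g` to
        -- compare.
        f≤ : sumOver X′ S (λ Y → weight S Y * f Y) ≤ sumConfig ∣ S ∣ (λ d → w′ d * g d) + Z′ * L
        f≤ = begin
          sumOver X′ S (λ Y → weight S Y * f Y)
            ≤⟨ sumConfig-mono ∣ S ∣ (λ d →
                *-monoʳ-≤ (0≤w′ d) (≤-trans (≈⇒≤ (reflexive (≡.cong f (Y′≡ d)))) (lip (Y d) v a))) ⟩
          (sumConfig ∣ S ∣ λ d → w′ d * (g d + L))
            ≈⟨ trans (sumConfig-cong ∣ S ∣ λ d → distribˡ (w′ d) (g d) L)
                (sumConfig-+ ∣ S ∣ (λ d → w′ d * g d) (λ d → w′ d * L)) ⟩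
          _ + (sumConfig ∣ S ∣ λ d → w′ d * L)  ≈⟨ +-congˡ (*-distribʳ-sumConfig ∣ S ∣ L w′) ⟨
          _ + Z′ * L ∎
        cross : sumOver X′ S (λ Y → weight S Y * f Y) * Z ≤
                sumOver X S (λ Y → weight S Y * f Y) * Z′ + L *
                    (1# + fromℕ 8 * (fromℕ ∣ S ∣ * r) * N) * (Z * Z′)
        cross = begin
          sumOver X′ S (λ Y → weight S Y * f Y) * Z                 ≤⟨ *-monoˡ-≤ (proj₁ 0<Z) f≤ ⟩
          ((sumConfig ∣ S ∣ λ d → w′ d * g d) + Z′ * L) * Z         ≈⟨ distribʳ Z _ _ ⟩
          (sumConfig ∣ S ∣ λ d → w′ d * g d) * Z + Z′ * L * Z
            ≤⟨ +-monoˡ-≤ (Z′ * L * Z) (≤-trans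
                 (expectation-gap {w} {w′} {g} {b} (λ d → conflict? S v (lookup X v) a (Y d)) 0≤w
                     0≤w′
                    (λ d → conflicts-nonNeg S v (lookup X v) a (Y d)) 0≤R same
                    (λ d → 1≤conflicts S v (lookup X v) a (Y d)) (Lip-overwrite {f = f} lip X S))
                 (+-monoʳ-≤ _ (+-mono-≤ (*-monoʳ-≤ 0≤R (*-monoˡ-≤ (proj₁ 0<Z) w′b≤))
                                        (*-monoʳ-≤ 0≤R (*-monoʳ-≤ (proj₁ 0<Z′)
                                            (conflicts-mass X v (lookup X v) a)))))) ⟩
          Z′ * E + (R * (N * (fromℕ 4 * r) * Z′ * Z) + R * (Z′ * (N * (fromℕ 4 * r) * Z))) + Z′ * L
              * Z
            ≈⟨ solve 7 (λ Z Z′ E s L N r →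
                Z′ :* E :+ (s :* L :* (N :* (numeral 4 :* r) :* Z′ :* Z) :+ s :* L :*
                (Z′ :* (N :* (numeral 4 :* r) :* Z))) :+ Z′ :* L :* Z
                 := E :* Z′ :+ L :* (con 1 :+ numeral 8 :* (s :* r) :* N) :* (Z :* Z′)) refl Z Z′ E
                     (fromℕ ∣ S ∣) L N r ⟩
          E * Z′ + L * (1# + fromℕ 8 * (fromℕ ∣ S ∣ * r) * N) * (Z * Z′) ∎
          where
          E = sumOver X S (λ Y → weight S Y * f Y)

      heatBath-update : ∀ X v a → heatBath S f (X [ v ]≔ a) ≤
        heatBath S f X + L * (ind (¬? (v ∈? S)) + fromℕ 8 * (fromℕ ∣ S ∣ * r) * neighboursIn v S)
      heatBath-update X v a with v ∈? S
      ... | no v∉S  = heatBath-update-∉ X a v∉S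
      ... | yes v∈S = ≤-trans (≈⇒≤ (heatBath-update-∈ X a f v∈S)) (x≤x+y _ (*-nonNeg 0≤L
        (+-nonNeg ≤-refl (*-nonNeg (*-nonNeg (0≤fromℕ 8) (*-nonNeg (0≤fromℕ ∣ S ∣) 0≤r))
            (neighboursIn-nonNeg v S)))))

-- Stationarity and mixing

module Stationarity {c ℓ₁ ℓ₂} (ℝ : CompleteOrderedField c ℓ₁ ℓ₂)
                    {n : ℕ} (G : SimpleGraph n) (q : ℕ) (lam : CompleteOrderedField.Carrier ℝ) where
  open OrderedField ℝ
  open FiniteSums ℝ
  open ≤R
  open ColourBound ℝ G q lam using (mono-meeting; weight; weight-pos; weight-nonNeg)
  open BlockContraction ℝ G q lam
  open Solver using (solve; _:+_; _:*_; _:=_)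

  π : Config q n → Carrier
  π = gibbs G lam q

  total-weight : Carrier
  total-weight = sumConfig n λ σ → lam ^ μ G {q} σ

  mono-avoiding : Config q n → Subset n → ℕ
  mono-avoiding Y S = length (filter (λ e → mono? G Y e ×-dec ¬? (meets? G {q} S e)) (edges G))

  μ-split : ∀ S Y → lam ^ μ G Y ≈ lam ^ mono-avoiding Y S * weight S Y
  μ-split S Y = trans
      (^-congʳ lam (≡.trans (count-split (mono? G Y) (meets? G {q} S) (edges G))
      (ℕ.+-comm (mono-meeting Y S) _)))
                      (^-homo-* lam (mono-avoiding Y S) (mono-meeting Y S))

  mono-avoiding-overwrite : ∀ Y S d → mono-avoiding (overwrite Y S d) S ≡ mono-avoiding Y S
  mono-avoiding-overwrite Y S d = count-cong
      (λ e → mono? G (overwrite Y S d) e ×-dec ¬? (meets? G {q} S e))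
          (λ e → mono? G Y e ×-dec ¬? (meets? G {q} S e)) (edges G)
      (λ {e} _ (m , ¬s) → ≡.trans (≡.sym (off₁ e ¬s)) (≡.trans m (off₂ e ¬s)) , ¬s)
      (λ {e} _ (m , ¬s) → ≡.trans (off₁ e ¬s) (≡.trans m (≡.sym (off₂ e ¬s))) , ¬s)
    where
    off₁ : ∀ e → ¬ Meets G {q} S e → lookup (overwrite Y S d) (proj₁ e) ≡ lookup Y (proj₁ e)
    off₁ e ¬s = lookup-overwrite-∉ Y S d (¬s ∘ inj₁)
    off₂ : ∀ e → ¬ Meets G {q} S e → lookup (overwrite Y S d) (proj₂ e) ≡ lookup Y (proj₂ e)
    off₂ e ¬s = lookup-overwrite-∉ Y S d (¬s ∘ inj₂)

  partition-overwrite : ∀ S Y d → partition S (overwrite Y S d) ≈ partition S Y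
  partition-overwrite S Y d = sumConfig-cong ∣ S ∣ λ e →
      reflexive (≡.cong (weight S) (overwrite-idem Y S d e))

  expect : (Config q n → Carrier) → Carrier
  expect f = sumConfig n λ σ → π σ * f σ

  expect≈ : ∀ f → expect f ≈ sumConfig n (λ σ → lam ^ μ G σ * f σ) / total-weight
  expect≈ f = trans (sumConfig-cong n λ σ → solve 3 (λ x y z → x :* y :* z := x :* z :* y) refl
      (lam ^ μ G σ) (total-weight ⁻¹) (f σ))
      (sym (*-distribʳ-sumConfig n (total-weight ⁻¹) λ σ → lam ^ μ G σ * f σ))

  module _ (1≤lam : 1# ≤ lam) (1≤q : 1 ℕ.≤ q) where

    σ₀ : Config q n
    σ₀ = Vec.replicate n (Fin.fromℕ< 1≤q)

    -- The sum over all configurations is `sumOver` with the full vertex set; `σ₀` is only a base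
    -- point, available because q ≥ 1.
    sumConfig-swap : ∀ T (H : Config q n → Config q n → Carrier) →
                     sumConfig n (λ Y → sumOver Y T λ Z → H Y Z) ≈ sumConfig n
                         (λ Y → sumOver Y T λ Z → H Z Y)
    sumConfig-swap T H = trans (sym (sumOver-⊤ σ₀ _))
        (trans (sumOver-swap σ₀ ⊤ T ⊆⊤ H) (sumOver-⊤ σ₀ _))

    total-weight-pos : 0# < total-weight
    total-weight-pos = <-≤-trans (1≤⇒0< (1≤x^ 1≤lam (μ G σ₀)))
      (term≤sumConfig n (λ σ → ^-nonNeg (≤-trans 0≤1 1≤lam) (μ G σ)) σ₀)

    π-nonNeg : ∀ σ → 0# ≤ π σ
    π-nonNeg σ = *-nonNeg (^-nonNeg (≤-trans 0≤1 1≤lam) (μ G σ)) (inv-nonNeg total-weight-pos)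

    sum-π : sumConfig n π ≈ 1#
    sum-π = trans (sym (*-distribʳ-sumConfig n (total-weight ⁻¹) λ σ → lam ^ μ G {q} σ))
        (*-inv total-weight-pos)

    -- Detailed balance. The Gibbs weight of X times the chance of moving to Y is the weight of
    -- edges avoiding S, times `weight S X * weight S Y`, over the partition sum. The first and last
    -- factors depend only on the colours off S, so the expression is symmetric in X and Y.
    heatBath-reversible : ∀ S f → sumConfig n (λ X → lam ^ μ G X * heatBath S f X) ≈ sumConfig n
        (λ X → lam ^ μ G X * f X)
    heatBath-reversible S f = begin-equality
      sumConfig n (λ X → lam ^ μ G X * heatBath S f X)
        ≈⟨ sumConfig-cong n (λ X → trans (*-distribˡ-sumConfig ∣ S ∣ (lam ^ μ G X) _)
             (sumConfig-cong ∣ S ∣ λ d → *-congʳ (μ-split S X))) ⟩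
      sumConfig n (λ X → sumOver X S λ Y → H X Y)
        ≈⟨ sumConfig-swap S H ⟩
      sumConfig n (λ X → sumOver X S λ Y → H Y X)
        ≈⟨ sumConfig-cong n (λ X → sumConfig-cong ∣ S ∣ λ d → reverse X d) ⟩
      sumConfig n (λ X → sumOver X S λ Y → lam ^ μ G X * f X * (partition S X ⁻¹) * weight S Y)
        ≈⟨ sumConfig-cong n
            (λ X → *-distribˡ-sumConfig ∣ S ∣ (lam ^ μ G X * f X * (partition S X ⁻¹)) λ d →
            weight S (overwrite X S d)) ⟨
      sumConfig n (λ X → lam ^ μ G X * f X * (partition S X ⁻¹) * partition S X)
        ≈⟨ sumConfig-cong n
            (λ X → trans (*-assoc _ _ _)
            (trans (*-congˡ (trans (*-comm _ _) (*-inv (partition-pos 1≤lam 1≤q S X))))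
            (*-identityʳ _))) ⟩
      sumConfig n (λ X → lam ^ μ G X * f X) ∎
      where
      H : Config q n → Config q n → Carrier
      H X Y = lam ^ mono-avoiding X S * weight S X * (weight S Y / partition S X * f Y)
      reverse : ∀ X d → H (overwrite X S d) X ≈ lam ^ μ G X * f X * (partition S X ⁻¹) * weight S
          (overwrite X S d)
      reverse X d = trans
        (*-cong (*-congʳ (^-congʳ lam (mono-avoiding-overwrite X S d)))
            (*-congʳ (*-congˡ (⁻¹-cong (partition-overwrite S X d)))))
        (trans (solve 5 (λ o w′ w i f → o :* w′ :* (w :* i :* f) := o :* w :* f :* i :* w′) refl
                  (lam ^ mono-avoiding X S) (weight S (overwrite X S d)) (weight S X)
                      (partition S X ⁻¹) (f X))
               (*-congʳ (*-congʳ (*-congʳ (sym (μ-split S X))))))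

    expect-heatBath : ∀ S f → expect (heatBath S f) ≈ expect f
    expect-heatBath S f = trans (expect≈ (heatBath S f))
        (trans (*-congʳ (heatBath-reversible S f)) (sym (expect≈ f)))

-- Kernels acting on functions, and total variation distance.

module Kernels {c ℓ₁ ℓ₂} (ℝ : CompleteOrderedField c ℓ₁ ℓ₂) {q n : ℕ} where
  open OrderedField ℝ
  open FiniteSums ℝ
  open ≤R

  _▷_ : Kernel {q} {n} → (Config q n → Carrier) → Config q n → Carrier
  (P ▷ f) X = sumConfig n λ Y → P X Y * f Y

  ▷-zero : ∀ P f X → ((P ^ᵏ 0) ▷ f) X ≈ f X
  ▷-zero P f X = sumConfig-ind n X f

  ▷-suc : ∀ P t f X → ((P ^ᵏ suc t) ▷ f) X ≈ (P ▷ ((P ^ᵏ t) ▷ f)) X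
  ▷-suc P t f X = begin-equality
    sumConfig n (λ Y → sumConfig n (λ Z → P X Z * (P ^ᵏ t) Z Y) * f Y)
      ≈⟨ sumConfig-cong n
          (λ Y → trans (*-distribʳ-sumConfig n (f Y) _) (sumConfig-cong n λ Z → *-assoc _ _ _)) ⟩
    sumConfig n (λ Y → sumConfig n λ Z → P X Z * ((P ^ᵏ t) Z Y * f Y))
      ≈⟨ sumConfig-comm n n (λ Y Z → P X Z * ((P ^ᵏ t) Z Y * f Y)) ⟩
    sumConfig n (λ Z → sumConfig n λ Y → P X Z * ((P ^ᵏ t) Z Y * f Y))
      ≈⟨ sumConfig-cong n (λ Z → *-distribˡ-sumConfig n (P X Z) λ Y → (P ^ᵏ t) Z Y * f Y) ⟨
    (P ▷ ((P ^ᵏ t) ▷ f)) X ∎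

  sign : Carrier → Carrier
  sign x = if does (0# ≤? x) then 1# else - 1#

  sign≤1 : ∀ x → sign x ≤ 1#
  sign≤1 x with 0# ≤? x
  ... | yes _ = ≤-refl
  ... | no _  = ≤-trans (≤-trans (neg-mono 0≤1) (≈⇒≤ -0#≈0#)) 0≤1

  -1≤sign : ∀ x → - 1# ≤ sign x
  -1≤sign x with 0# ≤? x
  ... | yes _ = ≤-trans (≤-trans (neg-mono 0≤1) (≈⇒≤ -0#≈0#)) 0≤1
  ... | no _  = ≤-refl

  sign-gap : ∀ x y → sign x ≤ sign y + fromℕ 2
  sign-gap x y = begin
    sign x             ≤⟨ sign≤1 x ⟩
    1#                 ≈⟨ trans (+-cong (-‿inverseˡ 1#) (+-identityʳ 1#)) (+-identityˡ 1#) ⟨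
    - 1# + 1# + fromℕ 1  ≈⟨ +-assoc _ _ _ ⟩
    - 1# + fromℕ 2     ≤⟨ +-monoˡ-≤ _ (-1≤sign y) ⟩
    sign y + fromℕ 2   ∎

  abs≈sign : ∀ x y → abs (x - y) + y * sign (x - y) ≈ x * sign (x - y)
  abs≈sign x y with 0# ≤? (x - y)
  ... | yes _ = trans (+-congˡ (*-identityʳ y)) (trans (x-y+y≈x x y) (sym (*-identityʳ x)))
  ... | no _  = begin-equality
    - (x - y) + y * - 1#   ≈⟨ +-cong (sym (-‿+-comm x (- y))) (neg-one y) ⟩
    - x + - - y + - y      ≈⟨ trans (+-assoc _ _ _) (+-congˡ (-‿inverseˡ (- y))) ⟩
    - x + 0#               ≈⟨ +-identityʳ _ ⟩
    - x                    ≈⟨ neg-one x ⟨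
    x * - 1#               ∎
    where
    neg-one : ∀ z → z * - 1# ≈ - z
    neg-one z = trans (sym (-‿distribʳ-* z 1#)) (-‿cong (*-identityʳ z))

  -- Total variation distance is half the largest difference of expectations of a ±1-valued
  -- function; by stationarity the second expectation is an average of values of P^t f.
  tv-bound : ∀ (P : Kernel {q} {n}) (π : Config q n → Carrier) t x δ →
    (∀ σ → 0# ≤ π σ) → sumConfig n π ≈ 1# →
    (∀ f → sumConfig n (λ σ → π σ * ((P ^ᵏ t) ▷ f) σ) ≈ sumConfig n (λ σ → π σ * f σ)) →
    (∀ f → (∀ X Y → f X ≤ f Y + fromℕ 2) → ∀ y →
        ((P ^ᵏ t) ▷ f) x ≤ ((P ^ᵏ t) ▷ f) y + fromℕ 2 * δ) →
    tv ((P ^ᵏ t) x) π ≤ δ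
  tv-bound P π t x δ 0≤π sum-π stationary gap = x≤y*z⇒x/z≤y (fromℕ-pos 1)
      (+-cancelʳ-≤ (sumConfig n λ σ → π σ * f σ) (begin
    sumConfig n (λ σ → abs (α σ - π σ)) + sumConfig n (λ σ → π σ * f σ)
      ≈⟨ sumConfig-+ n (λ σ → abs (α σ - π σ)) (λ σ → π σ * f σ) ⟨
    sumConfig n (λ σ → abs (α σ - π σ) + π σ * f σ)
      ≈⟨ sumConfig-cong n (λ σ → abs≈sign (α σ) (π σ)) ⟩
    g x
      ≈⟨ trans (*-congʳ sum-π) (*-identityˡ (g x)) ⟨
    sumConfig n π * g x
      ≈⟨ *-distribʳ-sumConfig n (g x) π ⟩
    sumConfig n (λ σ → π σ * g x)
      ≤⟨ sumConfig-mono n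
          (λ σ → *-monoʳ-≤ (0≤π σ) (gap f (λ X Y → sign-gap (α X - π X) (α Y - π Y)) σ)) ⟩
    sumConfig n (λ σ → π σ * (g σ + fromℕ 2 * δ))
      ≈⟨ trans (sumConfig-cong n λ σ → distribˡ (π σ) (g σ) (fromℕ 2 * δ))
          (sumConfig-+ n (λ σ → π σ * g σ) (λ σ → π σ * (fromℕ 2 * δ))) ⟩
    sumConfig n (λ σ → π σ * g σ) + sumConfig n (λ σ → π σ * (fromℕ 2 * δ))
      ≈⟨ +-cong (stationary f)
          (trans (sym (*-distribʳ-sumConfig n (fromℕ 2 * δ) π))
          (trans (*-congʳ sum-π) (*-identityˡ (fromℕ 2 * δ)))) ⟩
    sumConfig n (λ σ → π σ * f σ) + fromℕ 2 * δ
      ≈⟨ +-comm _ _ ⟩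
    fromℕ 2 * δ + sumConfig n (λ σ → π σ * f σ) ∎))
    where
    α f g : Config q n → Carrier
    α = (P ^ᵏ t) x
    f σ = sign (α σ - π σ)
    g = (P ^ᵏ t) ▷ f

-- Existence of the mixing time: bounded search and maxima over configurations.

least : ∀ {p} {P : ℕ → Set p} → (∀ t → Dec (P t)) → ∀ B → P B →
        Σ ℕ λ t → P t × (∀ s → P s → t ℕ.≤ s) × t ℕ.≤ B
least P? B pB with P? 0
... | yes p0 = 0 , p0 , (λ _ _ → ℕ.z≤n) , ℕ.z≤n
least P? zero    pB | no ¬p0 = ⊥-elim (¬p0 pB)
least {P = P} P? (suc B) pB | no ¬p0 with least {P = P ∘ suc} (P? ∘ suc) B pB
... | t , pt , min , t≤B = suc t , pt , min′ , ℕ.s≤s t≤B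
  where
  min′ : ∀ s → P s → suc t ℕ.≤ s
  min′ zero    p0 = ⊥-elim (¬p0 p0)
  min′ (suc s) ps = ℕ.s≤s (min s ps)

argmax-Fin : ∀ {m} (f : Fin (suc m) → ℕ) → ∃ λ i → ∀ j → f j ℕ.≤ f i
argmax-Fin {zero}  f = zero , λ { zero → ℕ.≤-refl }
argmax-Fin {suc m} f with argmax-Fin (f ∘ suc)
... | i , max with ℕ.≤-total (f zero) (f (suc i))
...   | inj₁ f0≤ = suc i , λ { zero → f0≤ ; (suc j) → max j }
...   | inj₂ ≤f0 = zero , λ { zero → ℕ.≤-refl ; (suc j) → ℕ.≤-trans (max j) ≤f0 }

-- The best completion is chosen for each first colour, and then the best first colour.
argmax-Config : ∀ {q} n (f : Config (suc q) n → ℕ) → ∃ λ σ → ∀ τ → f τ ℕ.≤ f σ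
argmax-Config zero    f = [] , λ { [] → ℕ.≤-refl }
argmax-Config (suc n) f with argmax-Fin (λ a → f (a ∷ proj₁ (argmax-Config n (f ∘ (a ∷_)))))
... | a , max = a ∷ _ , λ { (b ∷ τ) → ℕ.≤-trans (proj₂ (argmax-Config n (f ∘ (b ∷_))) τ) (max b) }

module MixingTime {c ℓ₁ ℓ₂} (ℝ : CompleteOrderedField c ℓ₁ ℓ₂) where
  open OrderedField ℝ

  mixing-time : ∀ {q n} → 1 ℕ.≤ q → (P : Kernel {q} {n}) (π : Config q n → Carrier) (ε : Carrier)
      (B : ℕ) →
                (∀ x → tv ((P ^ᵏ B) x) π ≤ ε) → Σ ℕ λ τ → IsMixingTime P π ε τ × τ ℕ.≤ B
  mixing-time {suc q} {n} 1≤q P π ε B mixed = time x* ,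
      ((λ x → time x , is-time x , longest x) , x* , is-time x*) , time≤B x*
    where
    first : ∀ x → _
    first x = least {P = λ t → tv ((P ^ᵏ t) x) π ≤ ε} (λ t → tv ((P ^ᵏ t) x) π ≤? ε) B (mixed x)
    time : Config (suc q) n → ℕ
    time x = proj₁ (first x)
    is-time : ∀ x → IsMixingTimeFrom P π ε x (time x)
    is-time x = proj₁ (proj₂ (first x)) , proj₁ (proj₂ (proj₂ (first x)))
    time≤B : ∀ x → time x ℕ.≤ B
    time≤B x = proj₂ (proj₂ (proj₂ (first x)))
    slowest = argmax-Config n time
    x* = proj₁ slowest
    longest = proj₂ slowest

-- Contraction and distance to equilibrium for the whole chain.

module Dynamics {c ℓ₁ ℓ₂} (ℝ : CompleteOrderedField c ℓ₁ ℓ₂) {p k : ℕ} (G : SimpleGraph (suc p))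
    (q : ℕ)
                (lam : CompleteOrderedField.Carrier ℝ) (𝒮 : BlockSystem G k) where
  open OrderedField ℝ
  open FiniteSums ℝ
  open ≤R
  open SimpleGraph G
  open BlockSystem 𝒮
  open ColourBound ℝ G q lam using (weight; weight-pos; weight-nonNeg)
  open BlockContraction ℝ G q lam
  open Stationarity ℝ G q lam
  open Kernels ℝ {q} {suc p}
  open Lipschitz ℝ {q}
  open Walks ℝ G
  open ExpBounds ℝ

  n : ℕ
  n = suc p

  P : Kernel {q} {n}
  P = blockDynamics G lam q 𝒮 (uniform n)

  n⁻¹ : Carrier
  n⁻¹ = 1# / fromℕ n

  n*n⁻¹≈1 : fromℕ n * n⁻¹ ≈ 1#
  n*n⁻¹≈1 = *-/-cancel (fromℕ-pos p) 1#

  0≤n⁻¹ : 0# ≤ n⁻¹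
  0≤n⁻¹ = *-nonNeg 0≤1 (inv-nonNeg (fromℕ-pos p))

  P▷≈ : ∀ f X → (P ▷ f) X ≈ sum λ v → n⁻¹ * heatBath (block v) f X
  P▷≈ f X = begin-equality
    sumConfig n (λ Y → sum (λ v → n⁻¹ * upd v Y) * f Y)
      ≈⟨ sumConfig-cong n
          (λ Y → trans (*-distribʳ-sum (f Y) λ v → n⁻¹ * upd v Y)
          (sum-cong-≋ λ v → *-assoc n⁻¹ (upd v Y) (f Y))) ⟩
    sumConfig n (λ Y → sum λ v → n⁻¹ * (upd v Y * f Y))
      ≈⟨ sumConfig-sum n (λ Y v → n⁻¹ * (upd v Y * f Y)) ⟩
    sum (λ v → sumConfig n λ Y → n⁻¹ * (upd v Y * f Y))
      ≈⟨ sum-cong-≋ (λ v → trans (sym (*-distribˡ-sumConfig n n⁻¹ λ Y → upd v Y * f Y))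
          (*-congˡ (update (block v)))) ⟩
    sum (λ v → n⁻¹ * heatBath (block v) f X) ∎
    where
    upd : Fin n → Config q n → Carrier
    upd v = blockUpdate G lam q (block v) X
    update : ∀ S → sumConfig n (λ Y → blockUpdate G lam q S X Y * f Y) ≈ heatBath S f X
    update S = begin-equality
      sumConfig n (λ Y → blockUpdate G lam q S X Y * f Y)
        ≈⟨ sumConfig-cong n
            (λ Y → trans (*-distribʳ-sumConfig ∣ S ∣ (f Y) λ d → bw d * ind (overwrite X S d ≟ᶜ Y))
             (sumConfig-cong ∣ S ∣ λ d → *-assoc (bw d) (ind (overwrite X S d ≟ᶜ Y)) (f Y))) ⟩
      sumConfig n (λ Y → sumConfig ∣ S ∣ λ d → bw d * (ind (overwrite X S d ≟ᶜ Y) * f Y))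
        ≈⟨ sumConfig-comm n ∣ S ∣ (λ Y d → bw d * (ind (overwrite X S d ≟ᶜ Y) * f Y)) ⟩
      (sumConfig ∣ S ∣ λ d → sumConfig n λ Y → bw d * (ind (overwrite X S d ≟ᶜ Y) * f Y))
        ≈⟨ (sumConfig-cong ∣ S ∣ λ d →
            trans (sym (*-distribˡ-sumConfig n (bw d) λ Y → ind (overwrite X S d ≟ᶜ Y) * f Y))
             (*-congˡ (sumConfig-ind n (overwrite X S d) f))) ⟩
      heatBath S f X ∎
      where
      bw : Config q ∣ S ∣ → Carrier
      bw = blockWeight G lam q X S

  module _ (1≤lam : 1# ≤ lam) (1≤q : 1 ℕ.≤ q) where

    average : ∀ x → sum {n} (λ _ → n⁻¹ * x) ≈ x
    average x = trans (sum-const n (n⁻¹ * x))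
        (trans (sym (*-assoc _ _ _)) (trans (*-congʳ n*n⁻¹≈1) (*-identityˡ x)))

    expect-cong : ∀ {f g} → (∀ σ → f σ ≈ g σ) → expect f ≈ expect g
    expect-cong h = sumConfig-cong n λ σ → *-cong (refl {π σ}) (h σ)

    expect-P : ∀ f → expect (P ▷ f) ≈ expect f
    expect-P f = begin-equality
      expect (P ▷ f)
        ≈⟨ expect-cong (P▷≈ f) ⟩
      sumConfig n (λ σ → π σ * sum λ v → n⁻¹ * heatBath (block v) f σ)
        ≈⟨ sumConfig-cong n (λ σ → trans (*-distribˡ-sum (π σ) (λ v → n⁻¹ * heatBath (block v) f σ))
             (sum-cong-≋ λ v → solve 3 (λ x y z → x :* (y :* z) := y :* (x :* z)) refl (π σ) n⁻¹
                 (heatBath (block v) f σ))) ⟩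
      sumConfig n (λ σ → sum λ v → n⁻¹ * (π σ * heatBath (block v) f σ))
        ≈⟨ sumConfig-sum n (λ σ v → n⁻¹ * (π σ * heatBath (block v) f σ)) ⟩
      sum (λ v → sumConfig n λ σ → n⁻¹ * (π σ * heatBath (block v) f σ))
        ≈⟨ sum-cong-≋ (λ v →
            trans (sym (*-distribˡ-sumConfig n n⁻¹ λ σ → π σ * heatBath (block v) f σ))
             (*-congˡ (expect-heatBath 1≤lam 1≤q (block v) f))) ⟩
      sum {n} (λ _ → n⁻¹ * expect f)
        ≈⟨ average (expect f) ⟩
      expect f ∎
      where open Solver using (solve; _:*_; _:=_)

    expect-P^ : ∀ t f → expect ((P ^ᵏ t) ▷ f) ≈ expect f
    expect-P^ zero    f = expect-cong (▷-zero P f)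
    expect-P^ (suc t) f = trans (expect-cong (▷-suc P t f))
        (trans (expect-P ((P ^ᵏ t) ▷ f)) (expect-P^ t f))

    module _ {r : Carrier} (0≤r : 0# ≤ r) (1≤Δ : 1 ℕ.≤ Δ G)
             (colour≤ : ∀ w X a {u} → u ∈ block w →
                sumOver X (block w) (λ Y → weight (block w) Y * ind (lookup Y u Fin.≟ a))
                    ≤ fromℕ 2 * (r * partition (block w) X))
             (r-small : fromℕ 4 * (fromℕ 8 * (fromℕ k * r) * (fromℕ k * fromℕ (Δ G) ^ k)) ≤ 1#)
                 where

      C : Carrier
      C = fromℕ 8 * (fromℕ k * r)

      0≤C : 0# ≤ C
      0≤C = *-nonNeg (0≤fromℕ 8) (*-nonNeg (0≤fromℕ k) 0≤r)

      cost : Fin n → Fin n → Carrier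
      cost v w = ind (¬? (v ∈? block w)) + C * neighboursIn v (block w)

      -- At most n - 1 = p blocks avoid v, because the block indexed by v contains it, and `r-small`
      -- bounds all conflicts together by 1/4. The mean is therefore at most (p + 1/4)/n = 1 -
      -- 3/(4n).
      total-cost : ∀ v → n⁻¹ * sum (cost v) ≤ rate p
      total-cost v = z*x≤y⇒x≤y/z (fromℕ-pos (p ℕ.+ 3 ℕ.* suc p)) (begin
        fromℕ (4 ℕ.* n) * (n⁻¹ * sum (cost v))       ≈⟨ *-congʳ (fromℕ-* 4 n) ⟩
        fromℕ 4 * fromℕ n * (n⁻¹ * sum (cost v))
            ≈⟨ solve 4 (λ a b c d → a :* b :* (c :* d) := a :* (b :* c :* d)) refl (fromℕ 4)
            (fromℕ n) n⁻¹ (sum (cost v)) ⟩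
        fromℕ 4 * (fromℕ n * n⁻¹ * sum (cost v))
            ≈⟨ *-congˡ (trans (*-congʳ n*n⁻¹≈1) (*-identityˡ _)) ⟩
        fromℕ 4 * sum (cost v)
            ≈⟨ *-congˡ (trans (∑-distrib-+ (λ w → ind (¬? (v ∈? block w)))
            (λ w → C * neighboursIn v (block w)))
                                                          (+-congˡ (sym (*-distribˡ-sum C λ w →
                                                              neighboursIn v (block w))))) ⟩
        fromℕ 4 * (sum (λ w → ind (¬? (v ∈? block w))) + C * sum (λ w → neighboursIn v (block w)))
          ≤⟨ *-monoʳ-≤ (0≤fromℕ 4)
              (+-mono-≤ avoiding≤p (*-monoʳ-≤ 0≤C (sum-neighbours-in-blocks 𝒮 1≤Δ v))) ⟩
        fromℕ 4 * (fromℕ p + C * (fromℕ k * fromℕ (Δ G) ^ k)) ≈⟨ distribˡ (fromℕ 4) (fromℕ p) _ ⟩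
        fromℕ 4 * fromℕ p + fromℕ 4 * (C * (fromℕ k * fromℕ (Δ G) ^ k)) ≤⟨ +-monoʳ-≤ _ r-small ⟩
        fromℕ 4 * fromℕ p + 1#
            ≈⟨ trans (+-comm _ _) (+-congˡ (sym (fromℕ-* 4 p))) ⟩
        fromℕ (suc (4 ℕ.* p))                        ∎)
        where
        open Solver using (solve; _:*_; _:=_)
        avoiding≤p : sum (λ w → ind (¬? (v ∈? block w))) ≤ fromℕ p
        avoiding≤p = +-cancelʳ-≤ 1# (begin
          sum (λ w → ind (¬? (v ∈? block w))) + 1#
            ≈⟨ +-congˡ (trans (sum-single v λ w w≢v → ind-no (v Fin.≟ w) (w≢v ∘ ≡.sym))
                (ind-yes (v Fin.≟ v) ≡.refl)) ⟨
          sum (λ w → ind (¬? (v ∈? block w))) + sum (λ w → ind (v Fin.≟ w))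
            ≈⟨ ∑-distrib-+ (λ w → ind (¬? (v ∈? block w))) (λ w → ind (v Fin.≟ w)) ⟨
          sum (λ w → ind (¬? (v ∈? block w)) + ind (v Fin.≟ w))
            ≤⟨ sum-mono at-most-one ⟩
          sum {n} (λ _ → 1#)  ≈⟨ trans (sum-const n 1#) (*-identityʳ _) ⟩
          1# + fromℕ p        ≈⟨ +-comm _ _ ⟩
          fromℕ p + 1#        ∎)
          where
          at-most-one : ∀ w → ind (¬? (v ∈? block w)) + ind (v Fin.≟ w) ≤ 1#
          at-most-one w with v Fin.≟ w
          ... | yes ≡.refl = ≈⇒≤ (trans (+-congʳ (ind-no (¬? (v ∈? block v)) λ v∉ → v∉ (block-∋ v)))
              (+-identityˡ 1#))
          ... | no _       = ≤-trans (≈⇒≤ (+-identityʳ _)) (ind-≤1 (¬? (v ∈? block w)))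

      P-contracts : ∀ {f L} → Lip L f → 0# ≤ L → Lip (rate p * L) (P ▷ f)
      P-contracts {f} {L} lip 0≤L X v a = begin
        (P ▷ f) (X [ v ]≔ a)                                         ≈⟨ P▷≈ f (X [ v ]≔ a) ⟩
        sum (λ w → n⁻¹ * heatBath (block w) f (X [ v ]≔ a))
            ≤⟨ sum-mono (λ w → *-monoʳ-≤ 0≤n⁻¹ (block-step w)) ⟩
        sum (λ w → n⁻¹ * (heatBath (block w) f X + L * cost v w))
          ≈⟨ sum-cong-≋ (λ w →
              solve 4 (λ i h l t → i :* (h :+ l :* t) := i :* h :+ i :* l :* t) refl n⁻¹
              (heatBath (block w) f X) L (cost v w)) ⟩
        sum (λ w → n⁻¹ * heatBath (block w) f X + n⁻¹ * L * cost v w)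
          ≈⟨ ∑-distrib-+ (λ w → n⁻¹ * heatBath (block w) f X) (λ w → n⁻¹ * L * cost v w) ⟩
        sum (λ w → n⁻¹ * heatBath (block w) f X) + sum (λ w → n⁻¹ * L * cost v w)
          ≈⟨ +-cong (P▷≈ f X) (*-distribˡ-sum (n⁻¹ * L) (cost v)) ⟨
        (P ▷ f) X + n⁻¹ * L * sum (cost v)
          ≈⟨ +-congˡ (solve 3 (λ i l s → i :* l :* s := i :* s :* l) refl n⁻¹ L (sum (cost v))) ⟩
        (P ▷ f) X + n⁻¹ * sum (cost v) * L
            ≤⟨ +-monoʳ-≤ _ (*-monoˡ-≤ 0≤L (total-cost v)) ⟩
        (P ▷ f) X + rate p * L                                       ∎
        where
        open Solver using (solve; _:+_; _:*_; _:=_)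
        block-step : ∀ w → heatBath (block w) f (X [ v ]≔ a) ≤ heatBath (block w) f X + L * cost v w
        block-step w = ≤-trans
            (heatBath-update 1≤lam 1≤q (block w) 0≤r (colour≤ w) {f} lip 0≤L X v a)
          (≈⇒≤ (+-congˡ (*-congˡ
              (+-congˡ (*-congʳ (*-congˡ (*-congʳ (reflexive (≡.cong fromℕ (block-size w))))))))))

      P^-contracts : ∀ t {f L} → Lip L f → 0# ≤ L → Lip (rate p ^ t * L) ((P ^ᵏ t) ▷ f)
      P^-contracts zero {f} {L} lip 0≤L X v a = begin
        ((P ^ᵏ 0) ▷ f) (X [ v ]≔ a)  ≈⟨ ▷-zero P f (X [ v ]≔ a) ⟩
        f (X [ v ]≔ a)               ≤⟨ lip X v a ⟩
        f X + L                      ≈⟨ +-cong (▷-zero P f X) (*-identityˡ L) ⟨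
        ((P ^ᵏ 0) ▷ f) X + 1# * L    ∎
      P^-contracts (suc t) {f} {L} lip 0≤L X v a = begin
        ((P ^ᵏ suc t) ▷ f) (X [ v ]≔ a)                     ≈⟨ ▷-suc P t f (X [ v ]≔ a) ⟩
        (P ▷ ((P ^ᵏ t) ▷ f)) (X [ v ]≔ a)
            ≤⟨ P-contracts (P^-contracts t {f} lip 0≤L)
            (*-nonNeg (^-nonNeg (proj₁ (rate-pos p)) t) 0≤L) X v a ⟩
        (P ▷ ((P ^ᵏ t) ▷ f)) X + rate p * (rate p ^ t * L)
            ≈⟨ +-cong (▷-suc P t f X) (*-assoc _ _ _) ⟨
        ((P ^ᵏ suc t) ▷ f) X + rate p ^ suc t * L           ∎

      -- Settles ε ≥ 1 with time 0; the rounding estimate is made for ε ≤ 1.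
      tv≤1 : ∀ x → tv ((P ^ᵏ 0) x) π ≤ 1#
      tv≤1 x = tv-bound P π 0 x 1# (π-nonNeg 1≤lam 1≤q) (sum-π 1≤lam 1≤q) (expect-P^ 0) λ f gap y →
          begin
        ((P ^ᵏ 0) ▷ f) x                  ≈⟨ ▷-zero P f x ⟩
        f x                               ≤⟨ gap x y ⟩
        f y + fromℕ 2                     ≈⟨ +-cong (▷-zero P f y) (*-identityʳ (fromℕ 2)) ⟨
        ((P ^ᵏ 0) ▷ f) y + fromℕ 2 * 1#   ∎

      -- A function of oscillation 2 has Lipschitz constant 2, the Hamming diameter is at most n,
      -- and the 2 cancels against the half in the total variation distance.
      tv≤ : ∀ t x → tv ((P ^ᵏ t) x) π ≤ fromℕ n * rate p ^ t
      tv≤ t x = tv-bound P π t x (fromℕ n * rate p ^ t) (π-nonNeg 1≤lam 1≤q) (sum-π 1≤lam 1≤q)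
          (expect-P^ t) λ f gap y → begin
        ((P ^ᵏ t) ▷ f) x
          ≤⟨ Lip-global {f = (P ^ᵏ t) ▷ f}
              (P^-contracts t {f} (λ X v a → gap (X [ v ]≔ a) X) (0≤fromℕ 2)) x y ⟩
        ((P ^ᵏ t) ▷ f) y + fromℕ n * (rate p ^ t * fromℕ 2)
          ≈⟨ +-congˡ (solve 3 (λ n r t → n :* (r :* t) := t :* (n :* r)) refl (fromℕ n) (rate p ^ t)
              (fromℕ 2)) ⟩
        ((P ^ᵏ t) ▷ f) y + fromℕ 2 * (fromℕ n * rate p ^ t) ∎
        where open Solver using (solve; _:*_; _:=_)

first-step : ∀ {a r} {A : Set a} {R : A → A → Set r} {u v} → u ≢ v → Star R u v → ∃ λ z → R u z
first-step u≢v nil        = ⊥-elim (u≢v ≡.refl)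
first-step u≢v (edge ◅ _) = _ , edge

1≤Δ : ∀ {n} (G : SimpleGraph n) {u v} → u ≢ v → Connected G → 1 ℕ.≤ Δ G
1≤Δ G {u} {v} u≢v connected = ℕ.≤-trans
    (filter-some (adj? u) (lose (∈-allFin (proj₁ neighbour)) (proj₂ neighbour))) (degree≤Δ G u)
  where
  open SimpleGraph G
  neighbour = first-step u≢v (connected u v)

-- Consequences of the lower bound on q.

constant : ℕ → ℕ → ℕ
constant Δ k = 2 ℕ.^ (k ℕ.+ 1) ℕ.* Δ ℕ.^ (2 ℕ.* k) ℕ.* k ℕ.^ (2 ℕ.* k ℕ.+ 1)

-- Factor by factor, with k ≥ 2: the exponents k + 1, 2k and 2k + 1 are at least 3, k and 4.
constant-≥ : ∀ {Δ k} → 1 ℕ.≤ Δ → 2 ℕ.≤ k → 8 ℕ.* Δ ℕ.^ k ℕ.* k ℕ.^ 4 ℕ.≤ constant Δ k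
constant-≥ {suc Δ} {k@(suc _)} 1≤Δ 2≤k = ℕ.*-mono-≤ (ℕ.*-mono-≤
    (ℕ.^-monoʳ-≤ 2 {3} (ℕ.+-monoˡ-≤ 1 2≤k)) (ℕ.^-monoʳ-≤ (suc Δ) (ℕ.m≤m+n k _)))
  (ℕ.^-monoʳ-≤ k (ℕ.≤-trans (ℕ.*-monoʳ-≤ 2 2≤k) (ℕ.m≤m+n _ 1)))

1≤^ : ∀ {x} e → 1 ℕ.≤ x → 1 ℕ.≤ x ℕ.^ e
1≤^ {suc x} e _ = ℕ.^-monoʳ-≤ (suc x) {0} {e} ℕ.z≤n

module Parameters {c ℓ₁ ℓ₂} (ℝ : CompleteOrderedField c ℓ₁ ℓ₂) {D k q : ℕ} (1≤D : 1 ℕ.≤ D)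
    (2≤k : 2 ℕ.≤ k) where
  open OrderedField ℝ
  open ≤R

  module _ {lam root : Carrier} (1<lam : 1# < lam) (isRoot : IsRoot k lam root)
           (q-large : fromℕ (constant D k) * (lam ^ (D ℕ.∸ 1) * root) ≤ fromℕ q) where

    1≤lam : 1# ≤ lam
    1≤lam = proj₁ 1<lam
    0≤root : 0# ≤ root
    0≤root = proj₁ isRoot
    rootᵏ≈lam : root ^ k ≈ lam
    rootᵏ≈lam = proj₂ isRoot
    K : ℕ
    K = constant D k

    1≤root : 1# ≤ root
    1≤root with 1# ≤? root
    ... | yes h = h
    ... | no h  = ⊥-elim (<⇒≱ 1<lam (≤-trans (≈⇒≤ (sym rootᵏ≈lam)) (x^≤1 0≤root (proj₁ (≰⇒> h)) k)))

    ρ : Carrier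
    ρ = lam ^ (D ℕ.∸ 1) * root

    1≤ρ : 1# ≤ ρ
    1≤ρ = ≤-trans (≈⇒≤ (sym (*-identityˡ 1#)))
        (*-mono-≤ (≤-trans 0≤1 (1≤x^ 1≤lam (D ℕ.∸ 1))) 0≤1 (1≤x^ 1≤lam (D ℕ.∸ 1)) 1≤root)

    0≤ρ : 0# ≤ ρ
    0≤ρ = ≤-trans 0≤1 1≤ρ

    1≤K : 1 ℕ.≤ K
    1≤K = ℕ.≤-trans (ℕ.*-mono-≤ {1} {8 ℕ.* D ℕ.^ k} {1} {k ℕ.^ 4}
        (ℕ.*-mono-≤ {1} {8} {1} {D ℕ.^ k} (ℕ.s≤s ℕ.z≤n) (1≤^ k 1≤D))
            (1≤^ 4 (ℕ.≤-trans (ℕ.s≤s ℕ.z≤n) 2≤k)))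
      (constant-≥ 1≤D 2≤k)

    1≤q : 1 ℕ.≤ q
    1≤q = fromℕ-reflect-≤ {1} {q} (begin
      fromℕ 1      ≤⟨ fromℕ-mono 1≤K ⟩
      fromℕ K      ≈⟨ *-identityʳ _ ⟨
      fromℕ K * 1# ≤⟨ *-monoʳ-≤ (0≤fromℕ K) 1≤ρ ⟩
      fromℕ K * ρ  ≤⟨ q-large ⟩
      fromℕ q      ∎)

    0<q : 0# < fromℕ q
    0<q = 1≤⇒0< (≤-trans (≈⇒≤ (sym (+-identityʳ 1#))) (fromℕ-mono 1≤q))

    r : Carrier
    r = ρ / fromℕ q

    0≤r : 0# ≤ r
    0≤r = *-nonNeg 0≤ρ (inv-nonNeg 0<q)

    -- The hypothesis on q says Kρ ≤ q, that is, Kr ≤ 1. Every smallness condition on r then becomes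
    -- a comparison of natural numbers with K.
    small : ∀ {j} → j ℕ.≤ K → fromℕ j * r ≤ 1#
    small {j} j≤K = begin
      fromℕ j * r             ≤⟨ *-monoˡ-≤ 0≤r (fromℕ-mono j≤K) ⟩
      fromℕ K * r             ≈⟨ *-assoc _ _ _ ⟨
      fromℕ K * ρ / fromℕ q   ≤⟨ *-monoˡ-≤ (inv-nonNeg 0<q) q-large ⟩
      fromℕ q / fromℕ q       ≈⟨ *-inv 0<q ⟩
      1#                      ∎

    powers : ∀ t → fromℕ q ^ t * r ^ t ≈ lam ^ ((D ℕ.∸ 1) ℕ.* t) * root ^ t
    powers t = begin-equality
      fromℕ q ^ t * r ^ t              ≈⟨ ^-distrib-* (fromℕ q) r t ⟨
      (fromℕ q * r) ^ t                ≈⟨ ^-congˡ t (*-/-cancel 0<q ρ) ⟩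
      ρ ^ t                            ≈⟨ ^-distrib-* _ root t ⟩
      (lam ^ (D ℕ.∸ 1)) ^ t * root ^ t ≈⟨ *-congʳ (^-assocʳ lam (D ℕ.∸ 1) t) ⟩
      lam ^ ((D ℕ.∸ 1) ℕ.* t) * root ^ t ∎

    component : ∀ t → lam ^ ((D ℕ.∸ 1) ℕ.* t) ≤ fromℕ q ^ t * r ^ t
    component t = begin
      lam ^ ((D ℕ.∸ 1) ℕ.* t)            ≈⟨ *-identityʳ _ ⟨
      lam ^ ((D ℕ.∸ 1) ℕ.* t) * 1#
          ≤⟨ *-monoʳ-≤ (≤-trans 0≤1 (1≤x^ 1≤lam ((D ℕ.∸ 1) ℕ.* t))) (1≤x^ 1≤root t) ⟩
      lam ^ ((D ℕ.∸ 1) ℕ.* t) * root ^ t ≈⟨ powers t ⟨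
      fromℕ q ^ t * r ^ t                ∎

    -- The exponent 1/k is calibrated for this: over k vertices the roots multiply to one factor
    -- lam, the one for the additional edge.
    component-k : lam ^ ((D ℕ.∸ 1) ℕ.* k ℕ.+ 1) ≤ fromℕ q ^ k * r ^ k
    component-k = ≈⇒≤ (begin-equality
      lam ^ ((D ℕ.∸ 1) ℕ.* k ℕ.+ 1)      ≈⟨ ^-homo-* lam ((D ℕ.∸ 1) ℕ.* k) 1 ⟩
      lam ^ ((D ℕ.∸ 1) ℕ.* k) * lam ^ 1  ≈⟨ *-congˡ (trans (*-identityʳ lam) (sym rootᵏ≈lam)) ⟩
      lam ^ ((D ℕ.∸ 1) ℕ.* k) * root ^ k ≈⟨ powers k ⟨
      fromℕ q ^ k * r ^ k                ∎)

    32k²Δᵏ≤K : 4 ℕ.* (8 ℕ.* k ℕ.* (k ℕ.* D ℕ.^ k)) ℕ.≤ K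
    -- 32 = 8 · 4, and 4 ≤ k² turns 32k²Δ^k into at most 8Δ^k k⁴.
    32k²Δᵏ≤K = ℕ.≤-trans (ℕ.≤-trans
        (ℕ.≤-reflexive (solveℕ 2
            (λ k d → conℕ 4 ⊛ (conℕ 8 ⊛ k ⊛ (k ⊛ d)) ⊜ conℕ 8 ⊛ d ⊛ (k ⊛ (k ⊛ (conℕ 2 ⊛ conℕ 2))))
            ≡.refl k (D ℕ.^ k)))
        (ℕ.*-monoʳ-≤ (8 ℕ.* D ℕ.^ k)
            (ℕ.*-monoʳ-≤ k (ℕ.*-monoʳ-≤ k
            (ℕ.*-mono-≤ 2≤k (ℕ.≤-trans 2≤k (ℕ.≤-reflexive (≡.sym (ℕ.*-identityʳ k)))))))))
      (constant-≥ 1≤D 2≤k)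
      where open +-*-Solver using () renaming
              (solve to solveℕ; _:*_ to _⊛_; con to conℕ; _:=_ to _⊜_)

    r-small : fromℕ 4 * (fromℕ 8 * (fromℕ k * r) * (fromℕ k * fromℕ D ^ k)) ≤ 1#
    r-small = begin
      fromℕ 4 * (fromℕ 8 * (fromℕ k * r) * (fromℕ k * fromℕ D ^ k))
        ≈⟨ solve 5 (λ a b k d r →
            a :* (b :* (k :* r) :* (k :* d)) := a :* (b :* k :* (k :* d)) :* r) refl (fromℕ 4)
            (fromℕ 8) (fromℕ k) (fromℕ D ^ k) r ⟩
      fromℕ 4 * (fromℕ 8 * fromℕ k * (fromℕ k * fromℕ D ^ k)) * r
        ≈⟨ *-congʳ (trans (fromℕ-* 4 (8 ℕ.* k ℕ.* (k ℕ.* D ℕ.^ k)))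
            (*-congˡ (trans (fromℕ-* (8 ℕ.* k) (k ℕ.* D ℕ.^ k))
             (*-cong (fromℕ-* 8 k) (trans (fromℕ-* k (D ℕ.^ k)) (*-congˡ (fromℕ-^ D k))))))) ⟨
      fromℕ (4 ℕ.* (8 ℕ.* k ℕ.* (k ℕ.* D ℕ.^ k))) * r
        ≤⟨ small 32k²Δᵏ≤K ⟩
      1# ∎
      where open Solver using (solve; _:*_; _:=_)

    2k≤K : 2 ℕ.* k ℕ.≤ K
    2k≤K = ℕ.≤-trans (ℕ.≤-trans (ℕ.*-mono-≤ {2} {4} (ℕ.s≤s (ℕ.s≤s ℕ.z≤n)) k≤) ℕ.≤-refl) 32k²Δᵏ≤K
      where
      k≤ : k ℕ.≤ 8 ℕ.* k ℕ.* (k ℕ.* D ℕ.^ k)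
      k≤ = ℕ.≤-trans (ℕ.m≤n*m k 8)
          (ℕ.m≤m*n (8 ℕ.* k) (k ℕ.* D ℕ.^ k)
          {{ℕ.>-nonZero (ℕ.*-mono-≤ {1} {k} {1} (ℕ.≤-trans (ℕ.s≤s ℕ.z≤n) 2≤k) (1≤^ k 1≤D))}})

    2kr≤1 : fromℕ 2 * (fromℕ k * r) ≤ 1#
    2kr≤1 = ≤-trans (≈⇒≤ (trans (sym (*-assoc _ _ _)) (*-congʳ (sym (fromℕ-* 2 k))))) (small 2k≤K)


-- From the contraction estimates to the mixing time.

module Bound {c ℓ₁ ℓ₂} (ℝ : CompleteOrderedField c ℓ₁ ℓ₂) {p k q : ℕ} (G : SimpleGraph (suc p))
    (2≤p : 2 ℕ.≤ p)
             (𝒮 : BlockSystem G k) (1≤q : 1 ℕ.≤ q) (1≤Δ : 1 ℕ.≤ Δ G)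
             {lam r : CompleteOrderedField.Carrier ℝ} where
  open OrderedField ℝ
  open FiniteSums ℝ
  open ExpBounds ℝ
  open ColourBound ℝ G q lam using (weight; colour-probability)
  open BlockContraction ℝ G q lam using (partition)
  open MixingTime ℝ
  module D = Dynamics ℝ G q lam 𝒮
  open BlockSystem 𝒮

  n : ℕ
  n = suc p

  P : Kernel {q} {n}
  P = blockDynamics G lam q 𝒮 (uniform n)

  module _ (1≤lam : 1# ≤ lam) (0≤r : 0# ≤ r)
           (component : ∀ t → lam ^ ((Δ G ℕ.∸ 1) ℕ.* t) ≤ fromℕ q ^ t * r ^ t)
           (component-k : lam ^ ((Δ G ℕ.∸ 1) ℕ.* k ℕ.+ 1) ≤ fromℕ q ^ k * r ^ k)
           (2kr≤1 : fromℕ 2 * (fromℕ k * r) ≤ 1#)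
           (r-small : fromℕ 4 * (fromℕ 8 * (fromℕ k * r) * (fromℕ k * fromℕ (Δ G) ^ k)) ≤ 1#)
           {ε logTerm : Carrier} (0<ε : 0# < ε) (ε≤n : ε ≤ fromℕ n)
               (isLog : IsLog (fromℕ n / ε) logTerm) where

    colour≤ : ∀ w X a {u} → u ∈ block w →
      sumOver X (block w) (λ Y → weight (block w) Y * ind (lookup Y u Fin.≟ a))
          ≤ fromℕ 2 * (r * partition (block w) X)
    colour≤ w X a u∈ = colour-probability 1≤lam a (block-connected w) X 0≤r 1≤q component
      (≡.subst (λ s → lam ^ ((Δ G ℕ.∸ 1) ℕ.* s ℕ.+ 1) ≤ fromℕ q ^ s * r ^ s)
          (≡.sym (block-size w)) component-k)
      (≡.subst (λ s → fromℕ 2 * (fromℕ s * r) ≤ 1#) (≡.sym (block-size w)) 2kr≤1) u∈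
    Deadline : Set ℓ₂
    Deadline = Σ ℕ λ t → (∀ x → tv ((P ^ᵏ t) x) (gibbs G lam q) ≤ ε) × fromℕ t
        ≤ fromℕ (2 ℕ.* n) * logTerm

    -- For ε ≥ 1 the time is 0, and ε ≤ n makes the logarithm on the right nonnegative. Otherwise
    -- `time-bound` supplies the time.
    deadline : Dec (1# ≤ ε) → Deadline
    deadline (yes 1≤ε) = 0 , (λ x → ≤-trans (D.tv≤1 1≤lam 1≤q 0≤r 1≤Δ colour≤ r-small x) 1≤ε) ,
      *-nonNeg (0≤fromℕ (2 ℕ.* n))
          (log-nonNeg isLog (z*x≤y⇒x≤y/z 0<ε (≤-trans (≈⇒≤ (*-identityʳ ε)) ε≤n)))
    deadline (no 1≰ε) = proj₁ bound ,
        (λ x → ≤-trans (D.tv≤ 1≤lam 1≤q 0≤r 1≤Δ colour≤ r-small (proj₁ bound) x)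
        (proj₂ (proj₂ bound))) , proj₁ (proj₂ bound)
      where
      bound = time-bound p 2≤p 0<ε (proj₁ (≰⇒> 1≰ε)) isLog

    from-deadline : Deadline → Σ ℕ λ τ → IsMixingTime P (gibbs G lam q) ε τ × fromℕ τ
        ≤ fromℕ (2 ℕ.* n) * logTerm
    from-deadline (t , mixed , t≤) = proj₁ mix , proj₁ (proj₂ mix) , ≤-trans
        (fromℕ-mono (proj₂ (proj₂ mix))) t≤
      where
      mix = mixing-time 1≤q P (gibbs G lam q) ε t mixed

    mixing-time-bound : Σ ℕ λ τ → IsMixingTime P (gibbs G lam q) ε τ × fromℕ τ
        ≤ fromℕ (2 ℕ.* n) * logTerm
    mixing-time-bound = from-deadline (deadline (1# ≤? ε))

theorem2p7 :
  ∀ {c ℓ₁ ℓ₂} (ℝ : CompleteOrderedField c ℓ₁ ℓ₂) →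
  let open Real ℝ in
  (n k q : ℕ) (G : SimpleGraph n) →
  Connected G →
  2 ℕ.≤ k → k ℕ.< n →
  (𝒮 : BlockSystem G k) →
  (lam : Carrier) → 1# < lam →
  -- root is lam^(1/k); the exponent Δ - 1 is a natural number since Δ ≥ 2
  (root : Carrier) → IsRoot k lam root →
  let Δ = maxDegree G in
  fromℕ (2 ℕ.^ (k ℕ.+ 1) ℕ.* Δ ℕ.^ (2 ℕ.* k) ℕ.* k ℕ.^ (2 ℕ.* k ℕ.+ 1))
    * (lam ^ (Δ ℕ.∸ 1) * root) ≤ fromℕ q →
  (ε : Carrier) → 0# < ε → ε ≤ fromℕ n →
  -- logTerm is log (n / ε)
  (logTerm : Carrier) → IsLog (fromℕ n / ε) logTerm →
  Σ ℕ λ τ →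
    IsMixingTime (blockDynamics G lam q 𝒮 (uniform n)) (gibbs G lam q) ε τ
    × fromℕ τ ≤ fromℕ (2 ℕ.* n) * logTerm
theorem2p7 ℝ (suc (suc m)) k q G connected 2≤k k<n 𝒮 lam 1<lam root isRoot q-large ε 0<ε ε≤n logTerm
    isLog =
  mixing-time-bound (Q.1≤lam 1<lam isRoot q-large) (Q.0≤r 1<lam isRoot q-large)
      (Q.component 1<lam isRoot q-large)
    (Q.component-k 1<lam isRoot q-large) (Q.2kr≤1 1<lam isRoot q-large)
        (Q.r-small 1<lam isRoot q-large) 0<ε ε≤n isLog
  where
  -- Two distinct vertices of a connected graph force an edge.
  1≤D = 1≤Δ G {zero} {suc zero} (λ ()) connected
  module Q = Parameters ℝ {maxDegree G} {k} {q} 1≤D 2≤k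
  -- 2 ≤ k < n gives at least three vertices, as the rounding step requires.
  open Bound ℝ G (ℕ.≤-pred (ℕ.≤-trans (ℕ.s≤s 2≤k) k<n)) 𝒮 (Q.1≤q 1<lam isRoot q-large) 1≤D
theorem2p7 ℝ zero _ _ _ _ _ ()
theorem2p7 ℝ (suc zero) _ _ _ _ (ℕ.s≤s _) (ℕ.s≤s ())
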